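{- Let $\widetilde{W}/W\in\{\widetilde{C}_n/C_n,\widetilde{B}_n/B_n,\widetilde{B}_n/D_n,\widetilde{D}_n/D_n\}$ and let $a=\mathcal{A}(w)$ be the abacus corresponding to a minimal length coset representative $w\in\widetilde{W}/W$. For $1\le i\le n$, let $B(i)$ be the lowest bead occurring in either runner $i$ or runner $N-i$, and let $b(i)$ be the bead with $n+1\le b(i)\le N+n$ occurring in $B(i)$'s runner. Let $g_i$ be the number of gaps between $B(i)$ and $b(i)$ in $a$. Then $$\ell(w)=\sum_{1\le i\le n}g_i+(1+x_0+x_n)\cdot\big(\text{number of beads of }a\text{ that are}>N+n\big)+\sum_{\substack{b\text{ a bead of }a\\ N+1\le b\le N+n}}(b-N+x_0).$$
   Context: Offsets: $x_0=0$ in types $\widetilde{C}/C,\widetilde{B}/D$ and $x_0=-1$ in types $\widetilde{B}/B,\widetilde{D}/D$; $x_n=0$ in types $\widetilde{C}/C,\widetilde{B}/B$ and $x_n=-1$ in types $\widetilde{B}/D,\widetilde{D}/D$. Groups. Let $N=2n+1$. A mirrored $\mathbb{Z}$-permutation is a bijection $w:\mathbb{Z}\to\mathbb{Z}$ with $w(i+N)=w(i)+N$ and $w(-i)=-w(i)$ for all $i\in\mathbb{Z}$; it is determined by $(w(1),\dots,w(n))$. Under composition these form the affine Coxeter group $\widetilde{C}_n$. Define elements by their images $(w(1),\dots,w(n))$: $s_i=(1,\dots,i-1,i+1,i,i+2,\dots,n)$ for $1\le i\le n-1$; $s_0^C=(-1,2,3,\dots,n)$; $s_0^D=(-2,-1,3,\dots,n)$;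 $s_n^C=(1,\dots,n-1,n+1)$; $s_n^D=(1,\dots,n-2,n+1,n+2)$. The four types are: - $\widetilde{C}/C$: $\widetilde{W}$ is all mirrored $\mathbb{Z}$-permutations, generators $s_0=s_0^C,s_1,\dots,s_{n-1},s_n=s_n^C$ ($n\ge2$). - $\widetilde{B}/B$: those with $|\{i\le0:w(i)\ge1\}|$ even, generators $s_0=s_0^D,s_1,\dots,s_{n-1},s_n=s_n^C$ ($n\ge3$). - $\widetilde{B}/D$: those with $|\{i\le n:w(i)\ge n+1\}|$ even, generators $s_0=s_0^C,s_1,\dots,s_{n-1},s_n=s_n^D$ ($n\ge3$). - $\widetilde{D}/D$: those satisfying both parity conditions, generators $s_0=s_0^D,s_1,\dots,s_{n-1},s_n=s_n^D$ ($n\ge4$). $W$ is generated by $s_1,\dots,s_n$, and $\widetilde{W}/W$ denotes the set of minimal length representatives of the cosets $wW$. $\ell$ is Coxeter length in $\widetilde{W}$ with respect to $s_0,\dots,s_n$. Abaci. An abacus has runners (columns) $1,\dots,2n$; runner $i$ has entries labeled $mN+i$ for each level $m\in\mathbb{Z}$ (so the entries are the integers not divisible by $N$); some entries are beads, the others gaps. Reading order is the order of the labels; "lowest" means largest label; "between" refers to reading order (over all runners). The abacus is flush if no bead is preceded by a gap on its runner. $\mathcal{A}(w)$ is the flush abacus whose lowest bead in each runner is an element of $\{w(1),\dots,w(2n)\}$. -}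

module Defs where

open import Data.Bool.Base using (if_then_else_)
open import Data.Fin.Base as Fin using (Fin; toℕ)
open import Data.Integer.Base
  using (ℤ; +_; -[1+_]; 0ℤ; 1ℤ; -1ℤ; _+_; _-_; -_; _*_; _≤_; _<_)
open import Data.Integer.DivMod using (_/ℕ_; _%ℕ_)
open import Data.Integer.Divisibility using (_∣_)
open import Data.List.Base using (List; foldr; length; map)
open import Data.List.Membership.Propositional using (_∈_)
open import Data.List.Relation.Unary.Unique.Propositional using (Unique)
open import Data.Nat.Base as ℕ using (ℕ; zero; suc; _≡ᵇ_; _≤ᵇ_)
import Data.Nat.Divisibility as ℕ
open import Data.Product.Base using (∃; ∃-syntax; _×_)
open import Data.Sum.Base using (_⊎_)
open import Data.Unit.Base using (⊤)
open import Function.Base using (_∘_; id)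
open import Function.Bundles using (_⇔_)
open import Function.Definitions using (Bijective)
open import Level using (0ℓ)
open import Relation.Binary.PropositionalEquality using (_≡_; _≗_)
open import Relation.Nullary using (¬_)
open import Relation.Unary using (Pred; Decidable)

-- xs lists the elements of P, each exactly once.  Any two such lists are
-- permutations of one another, so |P| is `length xs`, and a sum over P
-- is the corresponding sum over xs.
Enumerates : List ℤ → Pred ℤ 0ℓ → Set
Enumerates xs P = Unique xs × (∀ e → (e ∈ xs) ⇔ P e)

EvenCardinality : Pred ℤ 0ℓ → Set
EvenCardinality P = ∃[ xs ] Enumerates xs P × 2 ℕ.∣ length xs

Σℤ : List ℤ → ℤ
Σℤ = foldr _+_ 0ℤ

N : ℕ → ℤ
N n = + suc (2 ℕ.* n)

record MirroredPermutation (n : ℕ) : Set where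
  field
    perm      : ℤ → ℤ
    bijective : Bijective _≡_ _≡_ perm
    shift     : ∀ i → perm (i + N n) ≡ perm i + N n
    mirror    : ∀ i → perm (- i) ≡ - perm i

open MirroredPermutation public

-- The function w with w(j) = f j for 1 ≤ j ≤ n, w(i + N) = w(i) + N and
-- w(- i) = - w(i).  These laws force w(N) = N and w(r) = N - w(N - r),
-- which gives the residues r = 0 and r > n.
extend : (n : ℕ) → (ℕ → ℤ) → ℤ → ℤ
extend n f i = base (i %ℕ suc (2 ℕ.* n)) + (i /ℕ suc (2 ℕ.* n)) * N n
  where
  base : ℕ → ℤ
  base zero      = 0ℤ
  base r@(suc _) = if r ≤ᵇ n then f r else N n - f (suc (2 ℕ.* n) ℕ.∸ r)

s : (n i : ℕ) → ℤ → ℤ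
s n i = extend n λ j →
  if j ≡ᵇ i then + suc i else if j ≡ᵇ suc i then + i else + j

s₀C s₀D sₙC sₙD : ℕ → ℤ → ℤ
s₀C n = extend n λ j → if j ≡ᵇ 1 then - (+ 1) else + j
s₀D n = extend n λ j →
  if j ≡ᵇ 1 then - (+ 2) else if j ≡ᵇ 2 then - (+ 1) else + j
sₙC n = extend n λ j → if j ≡ᵇ n then + (n ℕ.+ 1) else + j
sₙD n = extend n λ j →
  if suc j ≡ᵇ n then + (n ℕ.+ 1) else if j ≡ᵇ n then + (n ℕ.+ 2) else + j

data Type : Set where
  C̃/C B̃/B B̃/D D̃/D : Type

minRank : Type → ℕ
minRank C̃/C = 2
minRank B̃/B = 3
minRank B̃/D = 3
minRank D̃/D = 4

x₀ : Type → ℤ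
x₀ C̃/C = 0ℤ
x₀ B̃/B = -1ℤ
x₀ B̃/D = 0ℤ
x₀ D̃/D = -1ℤ

xₙ : Type → ℤ
xₙ C̃/C = 0ℤ
xₙ B̃/B = 0ℤ
xₙ B̃/D = -1ℤ
xₙ D̃/D = -1ℤ

Even₀ Evenₙ : {n : ℕ} → MirroredPermutation n → Set
Even₀     w = EvenCardinality λ i → i ≤ 0ℤ × 1ℤ ≤ perm w i
Evenₙ {n} w = EvenCardinality λ i → i ≤ + n × + suc n ≤ perm w i

InW̃ : Type → {n : ℕ} → MirroredPermutation n → Set
InW̃ C̃/C w = ⊤
InW̃ B̃/B w = Even₀ w
InW̃ B̃/D w = Evenₙ w
InW̃ D̃/D w = Even₀ w × Evenₙ w

first last : Type → ℕ → ℤ → ℤ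
first C̃/C = s₀C
first B̃/B = s₀D
first B̃/D = s₀C
first D̃/D = s₀D
last C̃/C = sₙC
last B̃/B = sₙC
last B̃/D = sₙD
last D̃/D = sₙD

generator : Type → (n : ℕ) → Fin (suc n) → ℤ → ℤ
generator t n Fin.zero = first t n
generator t n k@(Fin.suc _) =
  if toℕ k ≡ᵇ n then last t n else s n (toℕ k)

Word : ℕ → Set
Word n = List (Fin (suc n))

product : Type → (n : ℕ) → Word n → ℤ → ℤ
product t n = foldr (λ k f → generator t n k ∘ f) id

HasLength : Type → (n : ℕ) → (ℤ → ℤ) → ℕ → Set
HasLength t n w l =
  (∃[ v ] product t n v ≗ w × length v ≡ l) ×
  (∀ v → product t n v ≗ w → l ℕ.≤ length v)

-- The generators are involutions, so words without inverse letters
-- suffice to describe the subgroup generated by s₁, …, sₙ.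
InW : Type → (n : ℕ) → (ℤ → ℤ) → Set
InW t n u = ∃[ v ] product t n (map Fin.suc v) ≗ u

record IsMinimalRepresentative
       (t : Type) {n : ℕ} (w : MirroredPermutation n) : Set where
  field
    inW̃     : InW̃ t w
    minimal : ∀ u → InW t n u →
              ∀ l m → HasLength t n (perm w) l →
                      HasLength t n (perm w ∘ u) m → l ℕ.≤ m

Entry : ℕ → Pred ℤ 0ℓ
Entry n e = ¬ (N n ∣ e)

record Abacus (n : ℕ) : Set₁ where
  field
    Bead       : Pred ℤ 0ℓ
    bead-entry : ∀ {e} → Bead e → Entry n e
    bead?      : Decidable Bead

  Gap : Pred ℤ 0ℓ
  Gap e = Entry n e × ¬ Bead e

open Abacus public

RunnerIndex : ℕ → Pred ℤ 0ℓ
RunnerIndex n i = 1ℤ ≤ i × i ≤ + (2 ℕ.* n)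

OnRunner : (n : ℕ) → ℤ → Pred ℤ 0ℓ
OnRunner n i e = ∃[ m ] e ≡ m * N n + i

SameRunner : (n : ℕ) → ℤ → ℤ → Set
SameRunner n e e′ =
  ∃[ i ] RunnerIndex n i × OnRunner n i e × OnRunner n i e′

Flush : {n : ℕ} → Abacus n → Set
Flush {n} a = ∀ {e e′} → SameRunner n e e′ → e < e′ → Bead a e′ → ¬ Gap a e

-- "Lowest" refers to the picture of the abacus, in which labels increase
-- downwards: the lowest bead is the one with the largest label.
IsLowestBead : {n : ℕ} → Abacus n → Pred ℤ 0ℓ → ℤ → Set
IsLowestBead a P e =
  Bead a e × P e × (∀ e′ → Bead a e′ → P e′ → e′ ≤ e)

record IsAbacusOf {n : ℕ} (w : MirroredPermutation n) (a : Abacus n) : Set where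
  field
    flush  : Flush a
    lowest : ∀ i → RunnerIndex n i →
             ∃[ j ] 1ℤ ≤ j × j ≤ + (2 ℕ.* n) ×
                    IsLowestBead a (OnRunner n i) (perm w j)

Between : ℤ → ℤ → Pred ℤ 0ℓ
Between x y e = (x < e × e < y) ⊎ (y < e × e < x)

index : {n : ℕ} → Fin n → ℤ
index i = + suc (toℕ i)

IsB : {n : ℕ} → Abacus n → Fin n → ℤ → Set
IsB {n} a i =
  IsLowestBead a λ e → OnRunner n (index i) e ⊎ OnRunner n (N n - index i) e

-- b is b(i), where B = B(i).
Isb : {n : ℕ} → Abacus n → (B b : ℤ) → Set
Isb {n} a B b =
  Bead a b × + suc n ≤ b × b ≤ N n + + n × SameRunner n B b

{-# OPTIONS --safe #-}
module Submission where

-- The coset w W is determined by the integers q k = ⌊ w⁻¹(k) / N ⌋, 1 ≤ k ≤ n: the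
-- lowest beads on the runners k and N - k are k - q k N and N - k + q k N.  Left
-- multiplication by a generator acts on q as follows: the middle ones swap neighbours,
-- s₀ is q 1 ↦ -1 - q 1 (type C) or (q 1, q 2) ↦ (-1 - q 2, -1 - q 1) (type D), and sₙ is
-- q n ↦ - q n or (q (n-1), q n) ↦ (- q n, - q (n-1)).  Let fold q = q for q ≥ 0 and
-- -1 - q for q < 0.  Under each generator
--   ℓ = Σ_k ((1 + x₀) |q k| + (1 + xₙ) fold (q k)) + Σ_{i<k} (max(|2 q i + 1|, |2 q k|) - 1)
-- changes by at most 1, and some generator decreases it unless q = 0 or q = (-1, 0, …, 0);
-- parity excludes the latter.  Hence every word for w has at least ℓ letters, and
-- w = v u with v of length at most ℓ and u in W, so ℓ is the least length in w W.
-- Counting the gaps between B(i) and b(i) runner by runner and collecting the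
-- contributions of each pair of runners turns the right-hand side into ℓ.

open import Defs
open import Data.Bool.Base using (true; false; if_then_else_; T)
open import Data.Empty using (⊥; ⊥-elim)
open import Data.Fin.Base as Fin using (Fin; toℕ)
import Data.Fin.Properties as Fin
open import Data.Integer.Base
  using (ℤ; +_; -[1+_]; 0ℤ; 1ℤ; -1ℤ; _+_; _-_; -_; _*_; _≤_; _<_; ∣_∣; +≤+; +<+; -<-)
open import Data.Integer.DivMod using (_/ℕ_; _%ℕ_; a≡a%ℕn+[a/ℕn]*n; n%ℕd<d)
import Data.Integer.Divisibility.Signed as Signed
import Data.Integer.Properties as ℤ
open import Data.Integer.Tactic.RingSolver using (solve-∀)
open import Data.List.Base using (List; []; _∷_; _++_; foldr; length; map; tabulate; upTo)
open import Data.List.Membership.Propositional using (_∈_)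
open import Data.List.Membership.Propositional.Properties
  using (∈-map⁺; ∈-map⁻; ∈-++⁺ˡ; ∈-++⁺ʳ; ∈-++⁻; ∈-upTo⁺; ∈-upTo⁻)
open import Data.List.Membership.Propositional.Properties.WithK using (unique∧set⇒bag)
import Data.List.Properties as List
open import Data.List.Relation.Binary.BagAndSetEquality using (∼bag⇒↭)
open import Data.List.Relation.Binary.Permutation.Propositional as ↭ using (_↭_)
open import Data.List.Relation.Binary.Permutation.Propositional.Properties using (↭-length)
open import Data.List.Relation.Unary.AllPairs using ([])
open import Data.List.Relation.Unary.Unique.Propositional using (Unique)
import Data.List.Relation.Unary.Unique.Propositional.Properties as Unique
open import Data.Nat.Base as ℕ using (ℕ; zero; suc; z≤n; s≤s; _⊔_; _∸_; _≡ᵇ_; _≤ᵇ_)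
import Data.Nat.Divisibility as ℕ
open import Data.Nat.ListAction using (sum)
import Data.Nat.Properties as ℕ
import Data.Nat.Tactic.RingSolver as ℕSolver
open import Data.Product.Base using (_×_; _,_; ∃-syntax; proj₁; proj₂)
open import Data.Product.Function.NonDependent.Propositional using (_×-⇔_)
open import Data.Sum.Base as Sum using (_⊎_; inj₁; inj₂)
open import Data.Unit.Base using (⊤; tt)
open import Function.Base using (_∘_; id)
open import Function.Bundles using (_⇔_; mk⇔; Equivalence)
open import Function.Construct.Composition using (_⇔-∘_)
open import Level using (0ℓ)
open import Relation.Binary.PropositionalEquality
open import Relation.Nullary using (¬_; Dec; yes; no)
open import Relation.Nullary.Decidable using (map′)
open import Relation.Unary using (Pred)

-- The terms of ℓ count reflecting hyperplanes. Let p = w⁻¹ and read the p(k) / N as coordinates. On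
-- the way from the base alcove to the nearest alcove of the coset, coordinate k crosses |q k|
-- integers and fold (q k) half-integers, which belong to the conjugates of `s₀C` and `sₙC`; the
-- factors 1 + x₀ and 1 + xₙ remove them in type D. For i < k the difference and the sum of two
-- coordinates cross |q i - q k + 1/2| - 1/2 and |q i + q k + 1/2| - 1/2 integers, and |a - b| + |a
-- + b| = 2 max(|a|, |b|) merges the two counts. The geometry itself is not formalised: ℓ serves as
-- a potential, so only the effect of one generator on one or two entries of q is examined. Since W̃
-- is given by parity conditions, the descent must also show that w is a word. At q = 0 all p(k) lie
-- strictly between 0 and N; such p form a group of type C, twice as large as W when sₙ has type D.
-- A second parity, that of the sum of the integers nearest to p(k) / N, then places p in W.

<⇒1+≤ : ∀ {i j} → i < j → 1ℤ + i ≤ j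
<⇒1+≤ = ℤ.i<j⇒suc[i]≤j

1+≤⇒< : ∀ {i j} → 1ℤ + i ≤ j → i < j
1+≤⇒< = ℤ.suc[i]≤j⇒i<j

nonneg⇒≤ : ∀ {d i j} → 0ℤ ≤ d → d ≡ j - i → i ≤ j
nonneg⇒≤ 0≤d refl = ℤ.0≤i-j⇒j≤i 0≤d

-- Linear arithmetic: an inequality follows from others when the
-- differences of the two sides add up.
linear₁ : ∀ {a b i j} → a ≤ b → b - a ≡ j - i → i ≤ j
linear₁ a≤b = nonneg⇒≤ (ℤ.i≤j⇒0≤j-i a≤b)

linear₂ : ∀ {a b c d i j} → a ≤ b → c ≤ d → (b - a) + (d - c) ≡ j - i → i ≤ j
linear₂ a≤b c≤d = nonneg⇒≤ (ℤ.+-mono-≤ (ℤ.i≤j⇒0≤j-i a≤b) (ℤ.i≤j⇒0≤j-i c≤d))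

linear₃ : ∀ {a b c d e f i j} → a ≤ b → c ≤ d → e ≤ f →
          (b - a) + (d - c) + (f - e) ≡ j - i → i ≤ j
linear₃ a≤b c≤d e≤f =
  nonneg⇒≤ (ℤ.+-mono-≤ (ℤ.+-mono-≤ (ℤ.i≤j⇒0≤j-i a≤b) (ℤ.i≤j⇒0≤j-i c≤d))
                       (ℤ.i≤j⇒0≤j-i e≤f))

<-irrefl-by : ∀ {i j} → 1ℤ + i ≤ j → j ≤ i → ⊥
<-irrefl-by p q = ℤ.<⇒≱ (1+≤⇒< p) q

0≤*⁺ : ∀ {i} k → 0ℤ ≤ i → 0ℤ ≤ i * + k
0≤*⁺ {+ i} k _ = subst (0ℤ ≤_) (ℤ.pos-* i k) (+≤+ z≤n)

-- Division by `N` and rounding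

module _ (n : ℕ) where

  M : ℤ
  M = N n

  M≡ : M ≡ 1ℤ + (+ n + + n)
  M≡ rewrite ℕ.+-identityʳ n = refl

  -- _/ℕ_ rounds down, also for negative x.
  ⌊_⌋ : ℤ → ℤ
  ⌊ x ⌋ = x /ℕ suc (2 ℕ.* n)

  rem : ℤ → ℤ
  rem x = + (x %ℕ suc (2 ℕ.* n))

  div-rem : ∀ x → x ≡ rem x + ⌊ x ⌋ * M
  div-rem x = a≡a%ℕn+[a/ℕn]*n x (suc (2 ℕ.* n))

  0≤rem : ∀ x → 0ℤ ≤ rem x
  0≤rem x = +≤+ z≤n

  rem<M : ∀ x → 1ℤ + rem x ≤ M
  rem<M x = +≤+ (n%ℕd<d x (suc (2 ℕ.* n)))

  *M-mono-≤ : ∀ {i j} → i ≤ j → i * M ≤ j * M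
  *M-mono-≤ {i} {j} i≤j =
    linear₁ (0≤*⁺ (suc (2 ℕ.* n)) (ℤ.i≤j⇒0≤j-i i≤j)) (lemma i j M)
    where
    lemma : ∀ i j m → (j - i) * m - 0ℤ ≡ j * m - i * m
    lemma = solve-∀

  -- Raising the level by one adds `M`, which outweighs the difference of the offsets because y < x
  -- + M.
  level-≤ : ∀ {x y i j} → x + i * M ≤ y + j * M → 1ℤ + y ≤ x + M → i ≤ j
  level-≤ {x} {y} {i} {j} p q = ℤ.≮⇒≥ λ j<i →
    <-irrefl-by (linear₂ p q (lemma x y i j M)) (*M-mono-≤ (<⇒1+≤ j<i))
    where
    lemma : ∀ x y i j m →
      (y + j * m - (x + i * m)) + (x + m - (1ℤ + y)) ≡ (1ℤ + j) * m - (1ℤ + i * m)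
    lemma = solve-∀

  level-< : ∀ {x y i j} → x + i * M ≤ y + j * M → 1ℤ + y ≤ x → 1ℤ + i ≤ j
  level-< {x} {y} {i} {j} p q =
    level-≤ {x - M} {y} (linear₁ p (lemma x y i j M)) (linear₁ q (lemma′ x y M))
    where
    lemma : ∀ x y i j m → y + j * m - (x + i * m) ≡ y + j * m - (x - m + (1ℤ + i) * m)
    lemma = solve-∀
    lemma′ : ∀ x y m → x - (1ℤ + y) ≡ x - m + m - (1ℤ + y)
    lemma′ = solve-∀

  level-mono : ∀ {x y i j} → x ≤ y → i ≤ j → x + i * M ≤ y + j * M
  level-mono x≤y i≤j = ℤ.+-mono-≤ x≤y (*M-mono-≤ i≤j)

  level-mono-< : ∀ {x y i j} → x ≤ y + M → 1ℤ + i ≤ j → x + i * M ≤ y + j * M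
  level-mono-< {x} {y} {i} {j} p q =
    linear₂ p (*M-mono-≤ q) (lemma x y i j M)
    where
    lemma : ∀ x y i j m → (y + m - x) + (j * m - (1ℤ + i) * m) ≡ y + j * m - (x + i * m)
    lemma = solve-∀

  floor-least : ∀ x {t} → t ≤ ⌊ x ⌋ → t * M ≤ x
  floor-least x {t} p = ℤ.≤-trans (*M-mono-≤ p)
    (linear₁ (0≤rem x) (trans (ℤ.+-identityʳ _)
      (trans (lemma (rem x) (⌊ x ⌋ * M)) (cong (_- ⌊ x ⌋ * M) (sym (div-rem x))))))
    where
    lemma : ∀ r q → r ≡ r + q - q
    lemma = solve-∀

  floor-greatest : ∀ x {t} → t * M ≤ x → t ≤ ⌊ x ⌋
  floor-greatest x {t} p =
    level-≤ {0ℤ} {rem x} (subst₂ _≤_ (sym (ℤ.+-identityˡ _)) (div-rem x) p)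
      (subst (1ℤ + rem x ≤_) (sym (ℤ.+-identityˡ M)) (rem<M x))

  floor-unique : ∀ {x q} r → 0ℤ ≤ r → 1ℤ + r ≤ M → x ≡ r + q * M → ⌊ x ⌋ ≡ q
  floor-unique {x} {q} r 0≤r r<M refl = ℤ.≤-antisym
    (level-≤ {0ℤ} {r} {⌊ x ⌋} {q}
      (subst (_≤ r + q * M) (sym (ℤ.+-identityˡ (⌊ x ⌋ * M))) (floor-least x ℤ.≤-refl))
      (subst (1ℤ + r ≤_) (sym (ℤ.+-identityˡ M)) r<M))
    (floor-greatest x (linear₁ 0≤r (lemma r (q * M))))
    where
    lemma : ∀ r q → r - 0ℤ ≡ r + q - q
    lemma = solve-∀

  floor-shift : ∀ x t → ⌊ x + t * M ⌋ ≡ ⌊ x ⌋ + t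
  floor-shift x t = floor-unique (rem x) (0≤rem x) (rem<M x)
    (trans (cong (_+ t * M) (div-rem x)) (lemma (rem x) ⌊ x ⌋ t M))
    where
    lemma : ∀ r q t m → r + q * m + t * m ≡ r + (q + t) * m
    lemma = solve-∀

  -- The positive remainder excludes the multiples of `N`, where negation would give `- ⌊ x ⌋`
  -- instead.
  floor-neg : ∀ x → 1ℤ ≤ rem x → ⌊ - x ⌋ ≡ - 1ℤ - ⌊ x ⌋
  floor-neg x 1≤r = floor-unique (M - rem x)
    (linear₁ (rem<M x) (lemma₁ (rem x) M) ≤∙ +≤+ z≤n)
    (linear₁ 1≤r (lemma₂ (rem x) M))
    (trans (cong -_ (div-rem x)) (lemma₃ (rem x) ⌊ x ⌋ M))
    where
    _≤∙_ : ∀ {i j k} → j ≤ k → i ≤ j → i ≤ k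
    p ≤∙ q = ℤ.≤-trans q p
    lemma₁ : ∀ r m → m - (1ℤ + r) ≡ m - r - 1ℤ
    lemma₁ = solve-∀
    lemma₂ : ∀ r m → r - 1ℤ ≡ m - (1ℤ + (m - r))
    lemma₂ = solve-∀
    lemma₃ : ∀ r q m → - (r + q * m) ≡ m - r + (- 1ℤ - q) * m
    lemma₃ = solve-∀

  floor-reflect : ∀ x → 1ℤ ≤ rem x → ⌊ M - x ⌋ ≡ - ⌊ x ⌋
  floor-reflect x 1≤r =
    trans (cong ⌊_⌋ (lemma x M)) (trans (floor-shift (- x) 1ℤ)
      (trans (cong (_+ 1ℤ) (floor-neg x 1≤r)) (lemma′ ⌊ x ⌋)))
    where
    lemma : ∀ x m → m - x ≡ - x + 1ℤ * m
    lemma = solve-∀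
    lemma′ : ∀ q → - 1ℤ - q + 1ℤ ≡ - q
    lemma′ = solve-∀

  -- The integer nearest to x / N.
  ⌊_⌉ : ℤ → ℤ
  ⌊ x ⌉ = ⌊ x + + n ⌋

  -- `N` is odd, so x / N is never half way between two integers and rounding treats both signs
  -- alike.
  round-neg : ∀ x → ⌊ - x ⌉ ≡ - ⌊ x ⌉
  round-neg x = floor-unique (+ n + + n - rem y)
    (linear₁ (rem<M y) (trans (cong (_- (1ℤ + rem y)) M≡) (lemma₁ (rem y) (+ n))))
    (linear₁ (0≤rem y) (trans (lemma₂ (rem y) (+ n)) (cong (_- (1ℤ + (+ n + + n - rem y))) (sym M≡))))
    (trans (lemma₃ x (+ n)) (trans (cong (λ z → + n + + n - z) (div-rem y))
      (lemma₄ (rem y) ⌊ y ⌋ M (+ n))))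
    where
    y = x + + n
    lemma₁ : ∀ r k → 1ℤ + (k + k) - (1ℤ + r) ≡ k + k - r - 0ℤ
    lemma₁ = solve-∀
    lemma₂ : ∀ r k → r - 0ℤ ≡ 1ℤ + (k + k) - (1ℤ + (k + k - r))
    lemma₂ = solve-∀
    lemma₃ : ∀ x k → - x + k ≡ k + k - (x + k)
    lemma₃ = solve-∀
    lemma₄ : ∀ r q m k → k + k - (r + q * m) ≡ k + k - r + - q * m
    lemma₄ = solve-∀

  round-reflect : ∀ x → ⌊ M - x ⌉ ≡ 1ℤ - ⌊ x ⌉
  round-reflect x =
    trans (cong ⌊_⌋ (lemma x M (+ n))) (trans (floor-shift (- x + + n) 1ℤ)
      (trans (cong (_+ 1ℤ) (round-neg x)) (ℤ.+-comm (- ⌊ x ⌉) 1ℤ)))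
    where
    lemma : ∀ x m k → m - x + k ≡ - x + k + 1ℤ * m
    lemma = solve-∀

-- The length function on q

-- fold q = |2 q + 1| / 2 rounded down; it is invariant under q ↦ -1 - q
-- as ∣ q ∣ is under q ↦ - q.
fold : ℤ → ℕ
fold (+ q)    = q
fold -[1+ q ] = q

fold-reflect : ∀ q → fold (- 1ℤ - q) ≡ fold q
fold-reflect (+ zero)     = refl
fold-reflect (+ suc q)    = refl
fold-reflect -[1+ zero ]  = refl
fold-reflect -[1+ suc q ] = refl

fold≤∣∣ : ∀ q → fold q ℕ.≤ ∣ q ∣
fold≤∣∣ (+ q)    = ℕ.≤-refl
fold≤∣∣ -[1+ q ] = ℕ.n≤1+n q

∣∣≤1+fold : ∀ q → ∣ q ∣ ℕ.≤ suc (fold q)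
∣∣≤1+fold (+ q)    = ℕ.n≤1+n q
∣∣≤1+fold -[1+ q ] = ℕ.≤-refl

∣reflect∣≤ : ∀ q → ∣ - 1ℤ - q ∣ ℕ.≤ 1 ℕ.+ ∣ q ∣
∣reflect∣≤ q = ℕ.≤-trans (∣∣≤1+fold (- 1ℤ - q))
  (s≤s (subst (ℕ._≤ ∣ q ∣) (sym (fold-reflect q)) (fold≤∣∣ q)))

∣reflect∣< : ∀ q → q < 0ℤ → suc ∣ - 1ℤ - q ∣ ℕ.≤ ∣ q ∣
∣reflect∣< (+ _) (+<+ ())
∣reflect∣< -[1+ zero ]  _ = ℕ.≤-refl
∣reflect∣< -[1+ suc q ] _ = ℕ.≤-refl

fold-neg≤ : ∀ q → fold (- q) ℕ.≤ 1 ℕ.+ fold q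
fold-neg≤ q = ℕ.≤-trans (fold≤∣∣ (- q)) (subst (ℕ._≤ suc (fold q)) (sym (ℤ.∣-i∣≡∣i∣ q)) (∣∣≤1+fold q))

fold-neg< : ∀ q → 0ℤ < q → suc (fold (- q)) ℕ.≤ fold q
fold-neg< (+ zero)  (+<+ ())
fold-neg< (+ suc q) _ = ℕ.≤-refl

-- max(|2 x + 1|, |2 y|) - 1; the truncation at y = 0 does not affect the maximum.
pair : ℤ → ℤ → ℕ
pair x y = (2 ℕ.* fold x) ⊔ (2 ℕ.* ∣ y ∣ ∸ 1)

pair-reflectˡ : ∀ x y → pair (- 1ℤ - x) y ≡ pair x y
pair-reflectˡ x y = cong (λ m → 2 ℕ.* m ⊔ (2 ℕ.* ∣ y ∣ ∸ 1)) (fold-reflect x)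

pair-negʳ : ∀ x y → pair x (- y) ≡ pair x y
pair-negʳ x y = cong (λ m → 2 ℕ.* fold x ⊔ (2 ℕ.* m ∸ 1)) (ℤ.∣-i∣≡∣i∣ y)

-- Exchanging the arguments replaces |2 x + 1| by |2 x| and |2 y| by |2 y + 1|. Each number changes
-- by exactly 1, so their maximum changes by at most 1.
pair-swap≤ : ∀ x y → pair y x ℕ.≤ 1 ℕ.+ pair x y
pair-swap≤ x y = ℕ.⊔-lub
  (ℕ.≤-trans (ℕ.*-monoʳ-≤ 2 (fold≤∣∣ y))
    (ℕ.≤-trans (ℕ.m≤n+m∸n (2 ℕ.* ∣ y ∣) 1) (s≤s (ℕ.m≤n⊔m (2 ℕ.* fold x) _))))
  (ℕ.≤-trans (ℕ.∸-monoˡ-≤ 1 (ℕ.*-monoʳ-≤ 2 (∣∣≤1+fold x)))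
    (ℕ.≤-trans (ℕ.≤-reflexive (double (fold x))) (s≤s (ℕ.m≤m⊔n (2 ℕ.* fold x) _))))
  where
  double : ∀ m → 2 ℕ.* suc m ∸ 1 ≡ suc (2 ℕ.* m)
  double m = ℕ.+-suc m (m ℕ.+ 0)

-- By |a - b| + |a + b| = 2 max(|a|, |b|) the difference of the two pairs is |x - y + 1/2| - |x - y
-- - 1/2|, which equals 1 for x > y. The cases below are those of the signs.
pair-swap< : ∀ x y → y < x → suc (pair y x) ℕ.≤ pair x y
pair-swap< (+ zero) (+ _) (+<+ ())
pair-swap< (+ suc x) (+ y) (+<+ y<x) = ℕ.⊔-lub
  (ℕ.≤-trans (ℕ.≤-trans (ℕ.n≤1+n _) (ℕ.≤-reflexive (double y)))
    (ℕ.≤-trans (ℕ.*-monoʳ-≤ 2 y<x) (ℕ.m≤m⊔n (2 ℕ.* suc x) (2 ℕ.* ∣ + y ∣ ∸ 1))))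
  (ℕ.m≤m⊔n (2 ℕ.* suc x) (2 ℕ.* ∣ + y ∣ ∸ 1))
  where
  double : ∀ m → 2 ℕ.+ 2 ℕ.* m ≡ 2 ℕ.* suc m
  double m = cong suc (sym (ℕ.+-suc m (m ℕ.+ 0)))
pair-swap< (+ zero) -[1+ y ] _ = ℕ.≤-reflexive
    (trans (cong suc (ℕ.⊔-identityʳ _)) (sym (ℕ.+-suc y (y ℕ.+ 0))))
pair-swap< (+ suc x) -[1+ y ] _ = ℕ.⊔-lub
  (ℕ.≤-trans (ℕ.≤-reflexive (sym (ℕ.+-suc y (y ℕ.+ 0)))) (ℕ.m≤n⊔m (2 ℕ.* suc x) _))
  (ℕ.m≤m⊔n (2 ℕ.* suc x) (2 ℕ.* suc y ∸ 1))
pair-swap< -[1+ x ] -[1+ y ] (-<- x<y) = ℕ.⊔-lub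
  (ℕ.≤-trans (ℕ.≤-reflexive (sym (ℕ.+-suc y (y ℕ.+ 0)))) (ℕ.m≤n⊔m (2 ℕ.* x) _))
  (ℕ.≤-trans (ℕ.*-monoʳ-≤ 2 x<y)
    (ℕ.≤-trans (ℕ.n≤1+n _) (ℕ.≤-trans (ℕ.≤-reflexive (sym (ℕ.+-suc y (y ℕ.+ 0)))) (ℕ.m≤n⊔m (2 ℕ.* x) _))))

module Length (e₀ eₙ : ℕ) where

  weight : ℤ → ℕ
  weight q = e₀ ℕ.* ∣ q ∣ ℕ.+ eₙ ℕ.* fold q

  cross : ℤ → List ℤ → ℕ
  cross x []       = 0
  cross x (y ∷ ys) = pair x y ℕ.+ cross x ys

  cosetLength : List ℤ → ℕ
  cosetLength []       = 0
  cosetLength (x ∷ xs) = weight x ℕ.+ cross x xs ℕ.+ cosetLength xs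

  cross-fold : ∀ {x y} zs → fold x ≡ fold y → cross x zs ≡ cross y zs
  cross-fold []       _ = refl
  cross-fold (z ∷ zs) p =
    cong₂ ℕ._+_ (cong (λ m → 2 ℕ.* m ⊔ (2 ℕ.* ∣ z ∣ ∸ 1)) p) (cross-fold zs p)

  cross-++ : ∀ a xs {ys zs} → cross a ys ≡ cross a zs → cross a (xs ++ ys) ≡ cross a (xs ++ zs)
  cross-++ a []       p = p
  cross-++ a (x ∷ xs) p = cong (pair a x ℕ.+_) (cross-++ a xs p)

  -- The constants `c` and `d` serve two purposes: 0 and 1 bound the growth under a generator, 1 and
  -- 0 express a strict descent.
  prefix-≤ : ∀ c d xs {ys zs} → (∀ a → cross a ys ≡ cross a zs) →
             c ℕ.+ cosetLength ys ℕ.≤ d ℕ.+ cosetLength zs →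
             c ℕ.+ cosetLength (xs ++ ys) ℕ.≤ d ℕ.+ cosetLength (xs ++ zs)
  prefix-≤ c d []       p q = q
  prefix-≤ c d (x ∷ xs) {ys} {zs} p q = begin
    c ℕ.+ (k ℕ.+ cross x (xs ++ ys) ℕ.+ cosetLength (xs ++ ys))
      ≡⟨ cong (λ m → c ℕ.+ (k ℕ.+ m ℕ.+ cosetLength (xs ++ ys))) (cross-++ x xs (p x)) ⟩
    c ℕ.+ (k ℕ.+ l ℕ.+ cosetLength (xs ++ ys))
      ≡⟨ lemma c (k ℕ.+ l) _ ⟩
    k ℕ.+ l ℕ.+ (c ℕ.+ cosetLength (xs ++ ys))
      ≤⟨ ℕ.+-monoʳ-≤ (k ℕ.+ l) (prefix-≤ c d xs p q) ⟩
    k ℕ.+ l ℕ.+ (d ℕ.+ cosetLength (xs ++ zs))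
      ≡⟨ lemma d (k ℕ.+ l) _ ⟨
    d ℕ.+ (k ℕ.+ l ℕ.+ cosetLength (xs ++ zs)) ∎
    where
    open ℕ.≤-Reasoning
    k = weight x
    l = cross x (xs ++ zs)
    lemma : ∀ a b c → a ℕ.+ (b ℕ.+ c) ≡ b ℕ.+ (a ℕ.+ c)
    lemma = ℕSolver.solve-∀

  two-≤ : ∀ c d x y x′ y′ zs →
          weight x′ ℕ.+ weight y′ ≡ weight x ℕ.+ weight y →
          cross x′ zs ℕ.+ cross y′ zs ≡ cross x zs ℕ.+ cross y zs →
          c ℕ.+ pair x′ y′ ℕ.≤ d ℕ.+ pair x y →
          c ℕ.+ cosetLength (x′ ∷ y′ ∷ zs) ℕ.≤ d ℕ.+ cosetLength (x ∷ y ∷ zs)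
  two-≤ c d x y x′ y′ zs p q r = begin
    c ℕ.+ cosetLength (x′ ∷ y′ ∷ zs) ≡⟨ lemma c (pair x′ y′) (weight x′) (weight y′) (cross x′ zs)
        (cross y′ zs) (cosetLength zs) ⟩
    c ℕ.+ pair x′ y′ ℕ.+ ((weight x′ ℕ.+ weight y′) ℕ.+ (cross x′ zs ℕ.+ cross y′ zs) ℕ.+ cosetLength zs)
      ≤⟨ ℕ.+-mono-≤ r (ℕ.≤-reflexive (cong₂ (λ u v → u ℕ.+ v ℕ.+ cosetLength zs) p q)) ⟩
    d ℕ.+ pair x y ℕ.+ ((weight x ℕ.+ weight y) ℕ.+ (cross x zs ℕ.+ cross y zs) ℕ.+ cosetLength zs)
      ≡⟨ lemma d (pair x y) (weight x) (weight y) (cross x zs) (cross y zs) (cosetLength zs) ⟨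
    d ℕ.+ cosetLength (x ∷ y ∷ zs) ∎
    where
    open ℕ.≤-Reasoning
    lemma : ∀ a b c d e f g → a ℕ.+ (c ℕ.+ (b ℕ.+ e) ℕ.+ (d ℕ.+ f ℕ.+ g)) ≡ a ℕ.+ b ℕ.+
        ((c ℕ.+ d) ℕ.+ (e ℕ.+ f) ℕ.+ g)
    lemma = ℕSolver.solve-∀

  one-≤ : ∀ c d x x′ zs → cross x′ zs ≡ cross x zs →
          c ℕ.+ weight x′ ℕ.≤ d ℕ.+ weight x →
          c ℕ.+ cosetLength (x′ ∷ zs) ℕ.≤ d ℕ.+ cosetLength (x ∷ zs)
  one-≤ c d x x′ zs p q = begin
    c ℕ.+ cosetLength (x′ ∷ zs) ≡⟨ lemma c (weight x′) (cross x′ zs) (cosetLength zs) ⟩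
    c ℕ.+ weight x′ ℕ.+ (cross x′ zs ℕ.+ cosetLength zs) ≤⟨ ℕ.+-mono-≤ q
        (ℕ.≤-reflexive (cong (ℕ._+ cosetLength zs) p)) ⟩
    d ℕ.+ weight x ℕ.+ (cross x zs ℕ.+ cosetLength zs) ≡⟨ lemma d (weight x) (cross x zs) (cosetLength zs) ⟨
    d ℕ.+ cosetLength (x ∷ zs) ∎
    where
    open ℕ.≤-Reasoning
    lemma : ∀ a b c d → a ℕ.+ (b ℕ.+ c ℕ.+ d) ≡ a ℕ.+ b ℕ.+ (c ℕ.+ d)
    lemma = ℕSolver.solve-∀

  cross-swap : ∀ x y zs a → cross a (y ∷ x ∷ zs) ≡ cross a (x ∷ y ∷ zs)
  cross-swap x y zs a = lemma (pair a x) (pair a y) (cross a zs)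
    where
    lemma : ∀ b c d → c ℕ.+ (b ℕ.+ d) ≡ b ℕ.+ (c ℕ.+ d)
    lemma = ℕSolver.solve-∀

  length-swap : ∀ c d xs x y zs → c ℕ.+ pair y x ℕ.≤ d ℕ.+ pair x y →
    c ℕ.+ cosetLength (xs ++ y ∷ x ∷ zs) ℕ.≤ d ℕ.+ cosetLength (xs ++ x ∷ y ∷ zs)
  length-swap c d xs x y zs p = prefix-≤ c d xs (cross-swap x y zs)
    (two-≤ c d x y y x zs (ℕ.+-comm (weight y) _) (ℕ.+-comm (cross y zs) _) p)

-- The first entry occurs in pairs only as a left argument, where only its `fold` matters. The pairs
-- are therefore unchanged, and the summand `∣ x ∣` of the weight decides.
length-s₀C : ∀ eₙ c d x zs → c ℕ.+ ∣ - 1ℤ - x ∣ ℕ.≤ d ℕ.+ ∣ x ∣ → let open Length 1 eₙ in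
  c ℕ.+ cosetLength (- 1ℤ - x ∷ zs) ℕ.≤ d ℕ.+ cosetLength (x ∷ zs)
length-s₀C eₙ c d x zs p = one-≤ c d x (- 1ℤ - x) zs (cross-fold zs (fold-reflect x)) (begin
  c ℕ.+ (∣ - 1ℤ - x ∣ ℕ.+ 0 ℕ.+ eₙ ℕ.* fold (- 1ℤ - x)) ≡⟨ cong
      (λ m → c ℕ.+ (∣ - 1ℤ - x ∣ ℕ.+ 0 ℕ.+ eₙ ℕ.* m)) (fold-reflect x) ⟩
  c ℕ.+ (∣ - 1ℤ - x ∣ ℕ.+ 0 ℕ.+ eₙ ℕ.* fold x) ≡⟨ lemma c _ _ ⟩
  c ℕ.+ ∣ - 1ℤ - x ∣ ℕ.+ eₙ ℕ.* fold x ≤⟨ ℕ.+-monoˡ-≤ _ p ⟩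
  d ℕ.+ ∣ x ∣ ℕ.+ eₙ ℕ.* fold x ≡⟨ lemma d _ _ ⟨
  d ℕ.+ (∣ x ∣ ℕ.+ 0 ℕ.+ eₙ ℕ.* fold x) ∎)
  where
  open Length 1 eₙ
  open ℕ.≤-Reasoning
  lemma : ∀ a b c → a ℕ.+ (b ℕ.+ 0 ℕ.+ c) ≡ a ℕ.+ b ℕ.+ c
  lemma = ℕSolver.solve-∀

-- Dually, the last entry occurs in pairs only as a right argument, where only its absolute value
-- matters.
length-sₙC : ∀ e₀ c d xs x → c ℕ.+ fold (- x) ℕ.≤ d ℕ.+ fold x → let open Length e₀ 1 in
  c ℕ.+ cosetLength (xs ++ - x ∷ []) ℕ.≤ d ℕ.+ cosetLength (xs ++ x ∷ [])
length-sₙC e₀ c d xs x p = prefix-≤ c d xs (λ a → cong (ℕ._+ 0) (pair-negʳ a x))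
  (one-≤ c d x (- x) [] refl (begin
  c ℕ.+ (e₀ ℕ.* ∣ - x ∣ ℕ.+ (fold (- x) ℕ.+ 0)) ≡⟨ cong (λ m → c ℕ.+ (e₀ ℕ.* m ℕ.+ (fold (- x) ℕ.+ 0)))
      (ℤ.∣-i∣≡∣i∣ x) ⟩
  c ℕ.+ (e₀ ℕ.* ∣ x ∣ ℕ.+ (fold (- x) ℕ.+ 0)) ≡⟨ lemma c _ _ ⟩
  c ℕ.+ fold (- x) ℕ.+ e₀ ℕ.* ∣ x ∣ ≤⟨ ℕ.+-monoˡ-≤ _ p ⟩
  d ℕ.+ fold x ℕ.+ e₀ ℕ.* ∣ x ∣ ≡⟨ lemma d _ _ ⟨
  d ℕ.+ (e₀ ℕ.* ∣ x ∣ ℕ.+ (fold x ℕ.+ 0)) ∎))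
  where
  open Length e₀ 1
  open ℕ.≤-Reasoning
  lemma : ∀ a b c → a ℕ.+ (b ℕ.+ (c ℕ.+ 0)) ≡ a ℕ.+ c ℕ.+ b
  lemma = ℕSolver.solve-∀

-- With u = -1 - x the reflection is the swap of u and y, because only
-- the fold of the earlier entry matters.
length-s₀D : ∀ eₙ c d x y zs → c ℕ.+ pair y (- 1ℤ - x) ℕ.≤ d ℕ.+ pair (- 1ℤ - x) y →
  let open Length 0 eₙ in
  c ℕ.+ cosetLength (- 1ℤ - y ∷ - 1ℤ - x ∷ zs) ℕ.≤ d ℕ.+ cosetLength (x ∷ y ∷ zs)
length-s₀D eₙ c d x y zs p = two-≤ c d x y (- 1ℤ - y) (- 1ℤ - x) zs
  (trans (cong₂ (λ u v → eₙ ℕ.* u ℕ.+ eₙ ℕ.* v) (fold-reflect y) (fold-reflect x))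
      (ℕ.+-comm (eₙ ℕ.* fold y) _))
  (trans (cong₂ ℕ._+_ (cross-fold zs (fold-reflect y)) (cross-fold zs (fold-reflect x)))
      (ℕ.+-comm (cross y zs) _))
  (subst₂ (λ u v → c ℕ.+ u ℕ.≤ d ℕ.+ v) (sym (pair-reflectˡ y (- 1ℤ - x))) (pair-reflectˡ x y) p)
  where open Length 0 eₙ

-- Dual to `length-s₀D`: once the sign of y is changed, which no pair notices on the right, the
-- reflection is a swap of x and - y.
length-sₙD : ∀ e₀ c d xs x y → c ℕ.+ pair (- y) x ℕ.≤ d ℕ.+ pair x (- y) →
  let open Length e₀ 0 in
  c ℕ.+ cosetLength (xs ++ - y ∷ - x ∷ []) ℕ.≤ d ℕ.+ cosetLength (xs ++ x ∷ y ∷ [])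
length-sₙD e₀ c d xs x y p = prefix-≤ c d xs
  (λ a → trans (cong₂ (λ u v → u ℕ.+ (v ℕ.+ 0)) (pair-negʳ a y) (pair-negʳ a x)) (cross-swap x y [] a))
  (two-≤ c d x y (- y) (- x) []
    (trans (cong₂ (λ u v → e₀ ℕ.* u ℕ.+ 0 ℕ.+ (e₀ ℕ.* v ℕ.+ 0)) (ℤ.∣-i∣≡∣i∣ y) (ℤ.∣-i∣≡∣i∣ x))
           (ℕ.+-comm (e₀ ℕ.* ∣ y ∣ ℕ.+ 0) _))
    refl
    (subst₂ (λ u v → c ℕ.+ u ℕ.≤ d ℕ.+ v) (sym (pair-negʳ (- y) x)) (pair-negʳ x y) p))
  where open Length e₀ 0

-- Mirrored functions and the generators

i≡-i⇒i≡0 : ∀ i → i ≡ - i → i ≡ 0ℤ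
i≡-i⇒i≡0 (+ zero) _ = refl

if-true : ∀ {A : Set} {b} {x y : A} → T b → (if b then x else y) ≡ x
if-true {b = true} _ = refl

if-false : ∀ {A : Set} {b} {x y : A} → ¬ T b → (if b then x else y) ≡ y
if-false {b = false} _ = refl
if-false {b = true}  p = ⊥-elim (p _)

-- Bijectivity is left out so that generators qualify before they are known to be involutions.
record Mirrored (n : ℕ) (p : ℤ → ℤ) : Set where
  field
    shifted : ∀ i → p (i + N n) ≡ p i + N n
    odd     : ∀ i → p (- i) ≡ - p i

open Mirrored

module _ {n : ℕ} where

  id-mirrored : Mirrored n id
  id-mirrored .shifted _ = refl
  id-mirrored .odd     _ = refl

  ∘-mirrored : ∀ {p q} → Mirrored n p → Mirrored n q → Mirrored n (p ∘ q)
  ∘-mirrored {p} {q} mp mq .shifted i = trans (cong p (mq .shifted i)) (mp .shifted (q i))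
  ∘-mirrored {p} {q} mp mq .odd     i = trans (cong p (mq .odd i)) (mp .odd (q i))

  fixes-0 : ∀ {p} → Mirrored n p → p 0ℤ ≡ 0ℤ
  fixes-0 {p} mp = i≡-i⇒i≡0 (p 0ℤ) (mp .odd 0ℤ)

  shifted-* : ∀ {p} → Mirrored n p → ∀ i t → p (i + t * N n) ≡ p i + t * N n
  shifted-* {p} mp i (+ t) = go i t
    where
    step : ∀ i t m → i + (1ℤ + t) * m ≡ i + t * m + m
    step = solve-∀
    go : ∀ i t → p (i + + t * N n) ≡ p i + + t * N n
    go i zero    = trans (cong p (ℤ.+-identityʳ i)) (sym (ℤ.+-identityʳ (p i)))
    go i (suc t) = trans (cong p (step i (+ t) (N n))) (trans (mp .shifted _)
      (trans (cong (_+ N n) (go i t)) (sym (step (p i) (+ t) (N n)))))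
  shifted-* {p} mp i -[1+ t ] = trans (undo (p (i + -[1+ t ] * N n)) (+ suc t) (N n))
    (cong (_+ -[1+ t ] * N n) (trans (sym (shifted-* mp (i + -[1+ t ] * N n) (+ suc t)))
      (cong p (sym (undo′ i (+ suc t) (N n))))))
    where
    undo : ∀ i t m → i ≡ i + t * m + - t * m
    undo = solve-∀
    undo′ : ∀ i t m → i ≡ i + - t * m + t * m
    undo′ = solve-∀

  reflected : ∀ {p} → Mirrored n p → ∀ i → p (N n - i) ≡ N n - p i
  reflected {p} mp i = trans (cong p (ℤ.+-comm (N n) (- i)))
    (trans (mp .shifted (- i)) (trans (cong (_+ N n) (mp .odd i)) (ℤ.+-comm (- p i) (N n))))

  +≤n⇒<M : ∀ {j} → j ℕ.≤ n → 1ℤ + + j ≤ N n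
  +≤n⇒<M j≤n = +≤+ (s≤s (ℕ.≤-trans j≤n (ℕ.m≤m+n n _)))

  N-+ : ∀ {r} → suc n ℕ.≤ r → r ℕ.≤ 2 ℕ.* n → ∃[ j ] 1 ℕ.≤ j × j ℕ.≤ n × N n - + j ≡ + r
  N-+ {r} n<r r≤2n = suc (2 ℕ.* n) ∸ r , ℕ.m<n⇒0<n∸m (s≤s r≤2n) ,
    ℕ.≤-trans (ℕ.∸-monoʳ-≤ (suc (2 ℕ.* n)) n<r)
      (ℕ.≤-reflexive (trans (cong (ℕ._∸ n) (cong (n ℕ.+_) (ℕ.+-identityʳ n))) (ℕ.m+n∸n≡m n n))) ,
    trans (cong (λ z → N n - z) (sym (trans (ℤ.m-n≡m⊖n (suc (2 ℕ.* n)) r) (ℤ.⊖-≥ (ℕ.m≤n⇒m≤1+n r≤2n)))))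
      (lemma (N n) (+ r))
    where
    lemma : ∀ m r → m - (m - r) ≡ r
    lemma = solve-∀

  agree : ∀ {p q} → Mirrored n p → Mirrored n q →
          (∀ j → 1 ℕ.≤ j → j ℕ.≤ n → p (+ j) ≡ q (+ j)) → p ≗ q
  agree {p} {q} mp mq eq i = begin
    p i                          ≡⟨ cong p (div-rem n i) ⟩
    p (rem n i + ⌊_⌋ n i * N n)   ≡⟨ shifted-* mp _ (⌊_⌋ n i) ⟩
    p (rem n i) + ⌊_⌋ n i * N n   ≡⟨ cong (_+ ⌊_⌋ n i * N n) (small _ (ℕ.≤-pred (n%ℕd<d i (suc (2 ℕ.* n))))) ⟩
    q (rem n i) + ⌊_⌋ n i * N n   ≡⟨ shifted-* mq _ (⌊_⌋ n i) ⟨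
    q (rem n i + ⌊_⌋ n i * N n)   ≡⟨ cong q (div-rem n i) ⟨
    q i                          ∎
    where
    open ≡-Reasoning
    small : ∀ r → r ℕ.≤ 2 ℕ.* n → p (+ r) ≡ q (+ r)
    small zero r≤ = trans (fixes-0 mp) (sym (fixes-0 mq))
    small (suc r) r≤ with suc r ℕ.≤? n
    ... | yes r≤n = eq (suc r) (s≤s z≤n) r≤n
    ... | no r≰n with N-+ (ℕ.≰⇒> r≰n) r≤
    ...   | j , 1≤j , j≤n , e = begin
      p (+ suc r)   ≡⟨ cong p e ⟨
      p (N n - + j) ≡⟨ reflected mp (+ j) ⟩
      N n - p (+ j) ≡⟨ cong (λ z → N n - z) (eq j 1≤j j≤n) ⟩
      N n - q (+ j) ≡⟨ reflected mq (+ j) ⟨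
      q (N n - + j) ≡⟨ cong q e ⟩
      q (+ suc r)   ∎

  rem-unique : ∀ {x q} r → 0ℤ ≤ r → 1ℤ + r ≤ N n → x ≡ r + q * N n → rem n x ≡ r
  rem-unique {x} {q} r 0≤r r<M e = ∙-cancelʳ (rem n x) r (⌊_⌋ n x * N n)
    (trans (sym (div-rem n x)) (trans e (cong (λ z → r + z * N n)
        (sym (floor-unique n {x} {q} r 0≤r r<M e)))))
    where
    ∙-cancelʳ : ∀ i j k → i + k ≡ j + k → i ≡ j
    ∙-cancelʳ i j k p = trans (undo i k) (trans (cong (_- k) p) (sym (undo j k)))
      where
      undo : ∀ i k → i ≡ i + k - k
      undo = solve-∀

module Extend (n : ℕ) (f : ℕ → ℤ) where

  -- The same function as the one local to `extend`, restated so that lemmas can refer to it.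
  base : ℕ → ℤ
  base zero      = 0ℤ
  base r@(suc _) = if r ≤ᵇ n then f r else N n - f (suc (2 ℕ.* n) ∸ r)

  extend≡ : ∀ i → extend n f i ≡ base (i %ℕ suc (2 ℕ.* n)) + ⌊_⌋ n i * N n
  extend≡ i with i %ℕ suc (2 ℕ.* n)
  ... | zero  = refl
  ... | suc _ = refl

  extend-unique : ∀ {i q} r → r ℕ.≤ 2 ℕ.* n → i ≡ + r + q * N n → extend n f i ≡ base r + q * N n
  extend-unique {i} {q} r r≤ e = trans (extend≡ i) (cong₂ (λ a b → base a + b * N n)
    (ℤ.+-injective (rem-unique {n} {i} {q} (+ r) (+≤+ z≤n) (+≤+ (s≤s r≤)) e))
    (floor-unique n {i} {q} (+ r) (+≤+ z≤n) (+≤+ (s≤s r≤)) e))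

  extend-value : ∀ j → 1 ℕ.≤ j → j ℕ.≤ n → extend n f (+ j) ≡ f j
  extend-value (suc j) 1≤j j≤n = begin
    extend n f (+ suc j)     ≡⟨ extend-unique {+ suc j} {0ℤ} (suc j) (ℕ.≤-trans j≤n (ℕ.m≤m+n n _))
        (sym (ℤ.+-identityʳ (+ suc j))) ⟩
    base (suc j) + 0ℤ * N n  ≡⟨ ℤ.+-identityʳ _ ⟩
    base (suc j)             ≡⟨ if-true (ℕ.≤⇒≤ᵇ j≤n) ⟩
    f (suc j)                ∎
    where open ≡-Reasoning

  -- The sum N = 2 n + 1 of the two residues is odd, so exactly one of them is at most n; the other
  -- is given by the second branch of `base`.
  base-reflect : ∀ r r′ → suc r ℕ.+ suc r′ ≡ suc (2 ℕ.* n) → base (suc r′) ≡ N n - base (suc r)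
  base-reflect r r′ e with suc r ℕ.≤? n
  ... | yes r≤n = begin
    base (suc r′) ≡⟨ if-false (λ p → ℕ.<⇒≱ n<r′ (ℕ.≤ᵇ⇒≤ _ _ p)) ⟩
    N n - f (suc (2 ℕ.* n) ∸ suc r′) ≡⟨ cong (λ m → N n - f m)
        (trans (cong (_∸ suc r′) (sym e)) (ℕ.m+n∸n≡m (suc r) (suc r′))) ⟩
    N n - f (suc r) ≡⟨ cong (λ z → N n - z) (if-true (ℕ.≤⇒≤ᵇ r≤n)) ⟨
    N n - base (suc r) ∎
    where
    open ≡-Reasoning
    n<r′ : n ℕ.< suc r′
    n<r′ = ℕ.+-cancelˡ-< n n (suc r′) (subst (ℕ._≤ n ℕ.+ suc r′)
      (trans e (cong (λ m → suc (n ℕ.+ m)) (ℕ.+-identityʳ n))) (ℕ.+-monoˡ-≤ (suc r′) r≤n))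
  ... | no r≰n = begin
    base (suc r′) ≡⟨ if-true (ℕ.≤⇒≤ᵇ r′≤n) ⟩
    f (suc r′) ≡⟨ lemma (N n) _ ⟩
    N n - (N n - f (suc r′)) ≡⟨ cong (λ m → N n - (N n - f m))
        (trans (cong (_∸ suc r) (sym e)) (ℕ.m+n∸m≡n (suc r) (suc r′))) ⟨
    N n - (N n - f (2 ℕ.* n ∸ r)) ≡⟨ cong (λ z → N n - z) (if-false (λ p → r≰n (ℕ.≤ᵇ⇒≤ _ _ p))) ⟨
    N n - base (suc r) ∎
    where
    open ≡-Reasoning
    lemma : ∀ m x → x ≡ m - (m - x)
    lemma = solve-∀
    r′≤n : suc r′ ℕ.≤ n
    r′≤n = ℕ.+-cancelˡ-≤ (suc n) (suc r′) n (subst (suc n ℕ.+ suc r′ ℕ.≤_)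
      (trans e (cong (λ m → suc (n ℕ.+ m)) (ℕ.+-identityʳ n))) (ℕ.+-monoˡ-≤ (suc r′) (ℕ.≰⇒> r≰n)))

  extend-mirrored : Mirrored n (extend n f)
  extend-mirrored .shifted i = begin
    extend n f (i + N n) ≡⟨ extend-unique {_} {⌊_⌋ n i + 1ℤ} r r≤
        (trans (cong (_+ N n) (div-rem n i)) (lemma (+ r) (⌊_⌋ n i) (N n))) ⟩
    base r + (⌊_⌋ n i + 1ℤ) * N n ≡⟨ lemma (base r) (⌊_⌋ n i) (N n) ⟨
    base r + ⌊_⌋ n i * N n + N n ≡⟨ cong (_+ N n) (extend≡ i) ⟨
    extend n f i + N n ∎
    where
    open ≡-Reasoning
    r = i %ℕ suc (2 ℕ.* n)
    r≤ = ℕ.≤-pred (n%ℕd<d i (suc (2 ℕ.* n)))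
    lemma : ∀ r q m → r + q * m + m ≡ r + (q + 1ℤ) * m
    lemma = solve-∀
  extend-mirrored .odd i = go (i %ℕ suc (2 ℕ.* n)) (ℕ.≤-pred (n%ℕd<d i (suc (2 ℕ.* n)))) (div-rem n i)
      (extend≡ i)
    where
    open ≡-Reasoning
    q = ⌊_⌋ n i
    go : ∀ r → r ℕ.≤ 2 ℕ.* n → i ≡ + r + q * N n → extend n f i ≡ base r + q * N n →
         extend n f (- i) ≡ - extend n f i
    go zero _ e e′ = begin
      extend n f (- i) ≡⟨ extend-unique {_} { - q} 0 z≤n (trans (cong -_ e) (lemma q (N n))) ⟩
      0ℤ + - q * N n ≡⟨ lemma q (N n) ⟨
      - (0ℤ + q * N n) ≡⟨ cong -_ e′ ⟨
      - extend n f i ∎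
      where
      lemma : ∀ q m → - (0ℤ + q * m) ≡ 0ℤ + - q * m
      lemma = solve-∀
    go (suc r) r<2n e e′ with ℕ.m≤n⇒∃[o]m+o≡n r<2n
    ... | r′ , r+r′≡ = begin
      extend n f (- i) ≡⟨ extend-unique {_} { - 1ℤ - q} (suc r′)
        (subst (suc r′ ℕ.≤_) sum≡ (s≤s (ℕ.m≤n+m r′ r)))
        (trans (cong -_ e) (trans (lemma (+ suc r) q (N n)) (cong (_+ (- 1ℤ - q) * N n) reflect≡))) ⟩
      base (suc r′) + (- 1ℤ - q) * N n ≡⟨ cong (_+ (- 1ℤ - q) * N n)
          (base-reflect r r′ (cong suc (trans (ℕ.+-suc r r′) r+r′≡))) ⟩
      N n - base (suc r) + (- 1ℤ - q) * N n ≡⟨ lemma (base (suc r)) q (N n) ⟨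
      - (base (suc r) + q * N n) ≡⟨ cong -_ e′ ⟨
      - extend n f i ∎
      where
      lemma : ∀ r q m → - (r + q * m) ≡ m - r + (- 1ℤ - q) * m
      lemma = solve-∀
      sum≡ : suc (r ℕ.+ r′) ≡ 2 ℕ.* n
      sum≡ = r+r′≡
      reflect≡ : N n - + suc r ≡ + suc r′
      reflect≡ = trans (cong (λ m → + suc m - + suc r) (sym sum≡)) (cancel (+ r) (+ r′))
        where
        cancel : ∀ a b → 1ℤ + (1ℤ + (a + b)) - (1ℤ + a) ≡ 1ℤ + b
        cancel = solve-∀

-- Each of these commutes with every mirrored function. The middle generators use `keep`, the
-- versions of s₀ the mirror at 0, and those of sₙ the mirror at N / 2.
data Symmetry : Set where
  keep negate reflect : Symmetry

act : ℕ → Symmetry → ℤ → ℤ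
act n keep    x = x
act n negate  x = - x
act n reflect x = N n - x

act-involutive : ∀ n φ x → act n φ (act n φ x) ≡ x
act-involutive n keep    x = refl
act-involutive n negate  x = ℤ.neg-involutive x
act-involutive n reflect x = lemma (N n) x
  where
  lemma : ∀ m x → m - (m - x) ≡ x
  lemma = solve-∀

act-commutes : ∀ {n p} → Mirrored n p → ∀ φ x → p (act n φ x) ≡ act n φ (p x)
act-commutes mp keep    x = refl
act-commutes mp negate  x = mp .odd x
act-commutes mp reflect x = reflected mp x

record Single (n : ℕ) (φ : Symmetry) (a : ℕ) (g : ℤ → ℤ) : Set where
  field
    at    : g (+ a) ≡ act n φ (+ a)
    fixes : ∀ j → 1 ℕ.≤ j → j ℕ.≤ n → j ≢ a → g (+ j) ≡ + j

-- With `keep` these are the middle generators, with `negate` and `reflect` the ends of type D; thus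
-- all of them are treated as swaps of neighbours up to a symmetry.
record Double (n : ℕ) (φ : Symmetry) (a : ℕ) (g : ℤ → ℤ) : Set where
  field
    at     : g (+ a) ≡ act n φ (+ suc a)
    at-suc : g (+ suc a) ≡ act n φ (+ a)
    fixes  : ∀ j → 1 ℕ.≤ j → j ℕ.≤ n → j ≢ a → j ≢ suc a → g (+ j) ≡ + j

single-involutive : ∀ {n φ a g} → Mirrored n g → Single n φ a g → g ∘ g ≗ id
single-involutive {n} {φ} {a} {g} mg sg = agree (∘-mirrored mg mg) id-mirrored go
  where
  open Single sg
  go : ∀ j → 1 ℕ.≤ j → j ℕ.≤ n → g (g (+ j)) ≡ + j
  go j 1≤j j≤n with j ℕ.≟ a
  ... | yes refl = trans (cong g at) (trans (act-commutes mg φ (+ j))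
    (trans (cong (act n φ) at) (act-involutive n φ (+ j))))
  ... | no j≢a = trans (cong g e) e
    where e = fixes j 1≤j j≤n j≢a

double-involutive : ∀ {n φ a g} → Mirrored n g → Double n φ a g → g ∘ g ≗ id
double-involutive {n} {φ} {a} {g} mg dg = agree (∘-mirrored mg mg) id-mirrored go
  where
  open Double dg
  go : ∀ j → 1 ℕ.≤ j → j ℕ.≤ n → g (g (+ j)) ≡ + j
  go j 1≤j j≤n with j ℕ.≟ a | j ℕ.≟ suc a
  ... | yes refl | _ = trans (cong g at) (trans (act-commutes mg φ _)
    (trans (cong (act n φ) at-suc) (act-involutive n φ (+ j))))
  ... | no _ | yes refl = trans (cong g at-suc) (trans (act-commutes mg φ _)
    (trans (cong (act n φ) at) (act-involutive n φ (+ j))))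
  ... | no j≢a | no j≢1+a = trans (cong g e) e
    where e = fixes j 1≤j j≤n j≢a j≢1+a

≡⇒≡ᵇ-if : ∀ {A : Set} {x y : A} j → (if j ≡ᵇ j then x else y) ≡ x
≡⇒≡ᵇ-if j = if-true (ℕ.≡⇒≡ᵇ j j refl)

≢⇒≡ᵇ-if : ∀ {A : Set} {x y : A} {i j} → i ≢ j → (if i ≡ᵇ j then x else y) ≡ y
≢⇒≡ᵇ-if i≢j = if-false (i≢j ∘ ℕ.≡ᵇ⇒≡ _ _)

module _ (n : ℕ) where

  M-n : N n - + n ≡ + (n ℕ.+ 1)
  M-n = trans (cong (_- + n) (M≡ n)) (trans (lemma (+ n)) (cong +_ (ℕ.+-comm 1 n)))
    where
    lemma : ∀ k → 1ℤ + (k + k) - k ≡ 1ℤ + k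
    lemma = solve-∀

  s-double : ∀ i → 1 ℕ.≤ i → suc i ℕ.≤ n → Double n keep i (s n i)
  s-double i 1≤i i<n = record
    { at     = trans (Extend.extend-value n f i 1≤i (ℕ.<⇒≤ i<n)) (≡⇒≡ᵇ-if i)
    ; at-suc = trans (Extend.extend-value n f (suc i) (s≤s z≤n) i<n)
        (trans (≢⇒≡ᵇ-if (ℕ.1+n≢n {i})) (≡⇒≡ᵇ-if i))
    ; fixes  = λ j 1≤j j≤n j≢i j≢1+i → trans (Extend.extend-value n f j 1≤j j≤n)
        (trans (≢⇒≡ᵇ-if j≢i) (≢⇒≡ᵇ-if j≢1+i))
    }
    where
    f : ℕ → ℤ
    f j = if j ≡ᵇ i then + suc i else if j ≡ᵇ suc i then + i else + j

  s₀C-single : 1 ℕ.≤ n → Single n negate 1 (s₀C n)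
  s₀C-single 1≤n = record
    { at    = Extend.extend-value n f 1 (s≤s z≤n) 1≤n
    ; fixes = λ j 1≤j j≤n j≢1 → trans (Extend.extend-value n f j 1≤j j≤n) (≢⇒≡ᵇ-if j≢1)
    }
    where
    f : ℕ → ℤ
    f j = if j ≡ᵇ 1 then - (+ 1) else + j

  s₀D-double : 2 ℕ.≤ n → Double n negate 1 (s₀D n)
  s₀D-double 2≤n = record
    { at     = Extend.extend-value n f 1 (s≤s z≤n) (ℕ.<⇒≤ 2≤n)
    ; at-suc = Extend.extend-value n f 2 (s≤s z≤n) 2≤n
    ; fixes  = λ j 1≤j j≤n j≢1 j≢2 → trans (Extend.extend-value n f j 1≤j j≤n)
        (trans (≢⇒≡ᵇ-if j≢1) (≢⇒≡ᵇ-if j≢2))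
    }
    where
    f : ℕ → ℤ
    f j = if j ≡ᵇ 1 then - (+ 2) else if j ≡ᵇ 2 then - (+ 1) else + j

  sₙC-single : 1 ℕ.≤ n → Single n reflect n (sₙC n)
  sₙC-single 1≤n = record
    { at    = trans (Extend.extend-value n f n 1≤n ℕ.≤-refl) (trans (≡⇒≡ᵇ-if n) (sym M-n))
    ; fixes = λ j 1≤j j≤n j≢n → trans (Extend.extend-value n f j 1≤j j≤n) (≢⇒≡ᵇ-if j≢n)
    }
    where
    f : ℕ → ℤ
    f j = if j ≡ᵇ n then + (n ℕ.+ 1) else + j

  sₙD-double : ∀ i → 1 ℕ.≤ i → suc i ≡ n → Double n reflect i (sₙD n)
  sₙD-double i 1≤i refl = record
    { at     = trans (Extend.extend-value n f i 1≤i (ℕ.n≤1+n i)) (trans (≡⇒≡ᵇ-if i) (sym M-n))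
    ; at-suc = trans (Extend.extend-value n f (suc i) (s≤s z≤n) ℕ.≤-refl)
        (trans (≢⇒≡ᵇ-if (ℕ.1+n≢n {i})) (trans (≡⇒≡ᵇ-if i)
          (sym (trans (lemma (N n) (+ i)) (trans (cong (λ z → 1ℤ + z) M-n) (cong +_ (sym (ℕ.+-suc n 1))))))))
    ; fixes  = λ j 1≤j j≤n j≢i j≢1+i → trans (Extend.extend-value n f j 1≤j j≤n)
        (trans (≢⇒≡ᵇ-if j≢i) (≢⇒≡ᵇ-if j≢1+i))
    }
    where
    f : ℕ → ℤ
    f j = if suc j ≡ᵇ n then + (n ℕ.+ 1) else if j ≡ᵇ n then + (n ℕ.+ 2) else + j
    lemma : ∀ m i → m - i ≡ 1ℤ + (m - (1ℤ + i))
    lemma = solve-∀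

  first-mirrored : ∀ t → Mirrored n (first t n)
  first-mirrored C̃/C = Extend.extend-mirrored n _
  first-mirrored B̃/B = Extend.extend-mirrored n _
  first-mirrored B̃/D = Extend.extend-mirrored n _
  first-mirrored D̃/D = Extend.extend-mirrored n _

  last-mirrored : ∀ t → Mirrored n (last t n)
  last-mirrored C̃/C = Extend.extend-mirrored n _
  last-mirrored B̃/B = Extend.extend-mirrored n _
  last-mirrored B̃/D = Extend.extend-mirrored n _
  last-mirrored D̃/D = Extend.extend-mirrored n _

  generator-last : ∀ t k → suc (toℕ k) ≡ n → generator t n (Fin.suc k) ≡ last t n
  generator-last t k e = if-true (ℕ.≡⇒≡ᵇ (suc (toℕ k)) n e)

  generator-middle : ∀ t k → suc (toℕ k) ≢ n → generator t n (Fin.suc k) ≡ s n (suc (toℕ k))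
  generator-middle t k e = if-false (e ∘ ℕ.≡ᵇ⇒≡ _ _)

  generator-mirrored : ∀ t k → Mirrored n (generator t n k)
  generator-mirrored t Fin.zero = first-mirrored t
  generator-mirrored t (Fin.suc k) with suc (toℕ k) ℕ.≟ n
  ... | yes e = subst (Mirrored n) (sym (generator-last t k e)) (last-mirrored t)
  ... | no  e = subst (Mirrored n) (sym (generator-middle t k e)) (Extend.extend-mirrored n _)

  first-involutive : ∀ t → 2 ℕ.≤ n → first t n ∘ first t n ≗ id
  first-involutive C̃/C 2≤n = single-involutive (first-mirrored C̃/C) (s₀C-single (ℕ.<⇒≤ 2≤n))
  first-involutive B̃/B 2≤n = double-involutive (first-mirrored B̃/B) (s₀D-double 2≤n)
  first-involutive B̃/D 2≤n = single-involutive (first-mirrored B̃/D) (s₀C-single (ℕ.<⇒≤ 2≤n))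
  first-involutive D̃/D 2≤n = double-involutive (first-mirrored D̃/D) (s₀D-double 2≤n)

last-involutive : ∀ t n → 2 ℕ.≤ n → last t n ∘ last t n ≗ id
last-involutive C̃/C n 2≤n = single-involutive (last-mirrored n C̃/C) (sₙC-single n (ℕ.<⇒≤ 2≤n))
last-involutive B̃/B n 2≤n = single-involutive (last-mirrored n B̃/B) (sₙC-single n (ℕ.<⇒≤ 2≤n))
last-involutive B̃/D (suc n) (s≤s 1≤n) = double-involutive (last-mirrored (suc n) B̃/D)
    (sₙD-double (suc n) n 1≤n refl)
last-involutive D̃/D (suc n) (s≤s 1≤n) = double-involutive (last-mirrored (suc n) D̃/D)
    (sₙD-double (suc n) n 1≤n refl)

generator-involutive : ∀ t n → 2 ℕ.≤ n → ∀ k → generator t n k ∘ generator t n k ≗ id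
generator-involutive t n 2≤n Fin.zero = first-involutive n t 2≤n
generator-involutive t n 2≤n (Fin.suc k) with suc (toℕ k) ℕ.≟ n
... | yes e = subst (λ g → g ∘ g ≗ id) (sym (generator-last n t k e)) (last-involutive t n 2≤n)
... | no  e = subst (λ g → g ∘ g ≗ id) (sym (generator-middle n t k e))
  (double-involutive (Extend.extend-mirrored n _)
    (s-double n (suc (toℕ k)) (s≤s z≤n) (ℕ.≤∧≢⇒< (Fin.toℕ<n k) e)))

-- Lists of values under a generator

range : ℕ → ℕ → List ℕ
range a zero    = []
range a (suc m) = a ∷ range (suc a) m

range-++ : ∀ a k m → range a (k ℕ.+ m) ≡ range a k ++ range (a ℕ.+ k) m
range-++ a zero    m = cong (λ b → range b m) (sym (ℕ.+-identityʳ a))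
range-++ a (suc k) m = cong (a ∷_) (trans (range-++ (suc a) k m)
  (cong (λ b → range (suc a) k ++ range b m) (sym (ℕ.+-suc a k))))

module _ {A : Set} where

  map-range-cong : ∀ {f g : ℕ → A} a m → (∀ j → a ℕ.≤ j → j ℕ.< a ℕ.+ m → f j ≡ g j) →
                   map f (range a m) ≡ map g (range a m)
  map-range-cong a zero    e = refl
  map-range-cong a (suc m) e = cong₂ _∷_ (e a ℕ.≤-refl (ℕ.m<m+n a (s≤s z≤n)))
    (map-range-cong (suc a) m λ j a<j j< → e j (ℕ.<⇒≤ a<j) (subst (j ℕ.<_) (sym (ℕ.+-suc a m)) j<))

  map-range-++ : ∀ (f : ℕ → A) k m → map f (range 1 (k ℕ.+ m)) ≡ map f (range 1 k) ++ map f (range (suc k) m)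
  map-range-++ f k m = trans (cong (map f) (range-++ 1 k m)) (List.map-++ f (range 1 k) _)

  module _ {n} {p : ℤ → ℤ} (mp : Mirrored n p) (h : ℤ → A) where

    values : (ℤ → ℤ) → ℕ → A
    values q j = h (q (+ j))

    single-list : ∀ {g φ} a m → n ≡ a ℕ.+ (1 ℕ.+ m) → Single n φ (suc a) g →
      map (values (p ∘ g)) (range 1 n) ≡
      map (values p) (range 1 a) ++ h (act n φ (p (+ suc a))) ∷ map (values p) (range (2 ℕ.+ a) m)
    single-list {g} {φ} a m refl sg = trans (map-range-++ (values (p ∘ g)) a (1 ℕ.+ m))
      (cong₂ _++_
        (map-range-cong 1 a λ j 1≤j j≤a → cong (h ∘ p)
          (fixes j 1≤j (ℕ.≤-trans (ℕ.<⇒≤ j≤a) (ℕ.≤-trans (ℕ.+-monoʳ-≤ 1 (ℕ.m≤m+n a m))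
              (ℕ.≤-reflexive (sym (ℕ.+-suc a m))))) (ℕ.<⇒≢ j≤a)))
        (cong₂ _∷_ (cong h (trans (cong p at) (act-commutes mp φ _)))
          (map-range-cong (2 ℕ.+ a) m λ j a<j j< → cong (h ∘ p)
            (fixes j (ℕ.≤-trans (s≤s z≤n) a<j) (ℕ.≤-trans (ℕ.≤-pred j<) (ℕ.≤-reflexive (sym (ℕ.+-suc a m))))
                (ℕ.<⇒≢ a<j ∘ sym)))))
      where open Single sg

    double-list : ∀ {g φ} a m → n ≡ a ℕ.+ (2 ℕ.+ m) → Double n φ (suc a) g →
      map (values (p ∘ g)) (range 1 n) ≡
      map (values p) (range 1 a) ++ h (act n φ (p (+ suc (suc a)))) ∷ h (act n φ (p (+ suc a)))
        ∷ map (values p) (range (3 ℕ.+ a) m)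
    double-list {g} {φ} a m refl dg = trans (map-range-++ (values (p ∘ g)) a (2 ℕ.+ m))
      (cong₂ _++_
        (map-range-cong 1 a λ j 1≤j j≤a → cong (h ∘ p)
          (fixes j 1≤j (ℕ.≤-trans (ℕ.≤-pred j≤a) (ℕ.m≤m+n a _)) (ℕ.<⇒≢ j≤a) (ℕ.<⇒≢ (ℕ.m≤n⇒m≤1+n j≤a))))
        (cong₂ _∷_ (cong h (trans (cong p at) (act-commutes mp φ _)))
          (cong₂ _∷_ (cong h (trans (cong p at-suc) (act-commutes mp φ _)))
            (map-range-cong (3 ℕ.+ a) m λ j a<j j< → cong (h ∘ p)
              (fixes j (ℕ.≤-trans (s≤s z≤n) a<j)
                (ℕ.≤-trans (ℕ.≤-pred j<) (ℕ.≤-reflexive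
                    (sym (trans (ℕ.+-suc a (suc m)) (cong suc (ℕ.+-suc a m))))))
                (ℕ.<⇒≢ (ℕ.<⇒≤ a<j) ∘ sym) (ℕ.<⇒≢ a<j ∘ sym))))))
      where open Double dg

-- The length function under multiplication by generators

-- Left multiplication of `w` by a generator is precomposition of `p` with it, and the quotients are
-- those of `p`; hence the two are carried together.
record Inverses (n : ℕ) (w p : ℤ → ℤ) : Set where
  field
    w-mirrored : Mirrored n w
    p-mirrored : Mirrored n p
    w∘p        : ∀ i → w (p i) ≡ i
    p∘w        : ∀ i → p (w i) ≡ i

open Inverses

∘-inverses : ∀ {n w p w′ p′} → Inverses n w p → Inverses n w′ p′ → Inverses n (w′ ∘ w) (p ∘ p′)
∘-inverses {w = w} {p} {w′} {p′} a b = record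
  { w-mirrored = ∘-mirrored (w-mirrored b) (w-mirrored a)
  ; p-mirrored = ∘-mirrored (p-mirrored a) (p-mirrored b)
  ; w∘p = λ i → trans (cong w′ (w∘p a (p′ i))) (w∘p b i)
  ; p∘w = λ i → trans (cong p (p∘w b (w i))) (p∘w a i)
  }

-- Multiples of `N` are fixed by `w`, so p j = q N would give j = q N, which is impossible for 1 ≤ j
-- ≤ n.
rem-nonzero : ∀ {n w p} → Inverses n w p → ∀ j → 1 ℕ.≤ j → j ℕ.≤ n → 1ℤ ≤ rem n (p (+ j))
rem-nonzero {n} {w} {p} inv j 1≤j j≤n with p (+ j) %ℕ suc (2 ℕ.* n) in eq
... | suc r = +≤+ (s≤s z≤n)
... | zero  = ⊥-elim (ℕ.<⇒≢ 1≤j (sym (ℤ.+-injective (trans (sym rem-j) rem-0))))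
  where
  q = ⌊_⌋ n (p (+ j))
  j≡ : + j ≡ 0ℤ + q * N n
  j≡ = begin
    + j              ≡⟨ w∘p inv (+ j) ⟨
    w (p (+ j))      ≡⟨ cong w (trans (div-rem n (p (+ j))) (cong (λ r → + r + q * N n) eq)) ⟩
    w (0ℤ + q * N n) ≡⟨ shifted-* (w-mirrored inv) 0ℤ q ⟩
    w 0ℤ + q * N n   ≡⟨ cong (_+ q * N n) (fixes-0 (w-mirrored inv)) ⟩
    0ℤ + q * N n     ∎
    where open ≡-Reasoning
  rem-j : rem n (+ j) ≡ + j
  rem-j = rem-unique {n} {+ j} {0ℤ} (+ j) (+≤+ z≤n) (+≤n⇒<M j≤n) (sym (ℤ.+-identityʳ (+ j)))
  rem-0 : rem n (+ j) ≡ 0ℤ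
  rem-0 = rem-unique {n} {+ j} {q} 0ℤ (+≤+ z≤n) (+≤+ (s≤s z≤n)) j≡

-- 1 + x₀ and 1 + xₙ as natural numbers.
e₀ eₙ : Type → ℕ
e₀ C̃/C = 1
e₀ B̃/B = 0
e₀ B̃/D = 1
e₀ D̃/D = 0
eₙ C̃/C = 1
eₙ B̃/B = 1
eₙ B̃/D = 0
eₙ D̃/D = 0

2≤minRank : ∀ t → 2 ℕ.≤ minRank t
2≤minRank C̃/C = s≤s (s≤s z≤n)
2≤minRank B̃/B = s≤s (s≤s z≤n)
2≤minRank B̃/D = s≤s (s≤s z≤n)
2≤minRank D̃/D = s≤s (s≤s z≤n)

module _ (n : ℕ) where

  quotient : (ℤ → ℤ) → ℕ → ℤ
  quotient p j = ⌊_⌋ n (p (+ j))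

  quotients : (ℤ → ℤ) → List ℤ
  quotients p = map (quotient p) (range 1 n)

  ℓ : Type → (ℤ → ℤ) → ℕ
  ℓ t p = Length.cosetLength (e₀ t) (eₙ t) (quotients p)

  ℓ-cong : ∀ t {p q} → p ≗ q → ℓ t p ≡ ℓ t q
  ℓ-cong t p≗q = cong (Length.cosetLength (e₀ t) (eₙ t))
    (List.map-cong (λ j → cong (⌊_⌋ n) (p≗q (+ j))) (range 1 n))

  module _ {w p : ℤ → ℤ} (inv : Inverses n w p) where

    private mp = p-mirrored inv

    ⌊p⌋ : ℕ → ℤ
    ⌊p⌋ = quotient p

    ⌊-p⌋ : ∀ j → 1 ℕ.≤ j → j ℕ.≤ n → ⌊_⌋ n (- p (+ j)) ≡ - 1ℤ - ⌊p⌋ j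
    ⌊-p⌋ j 1≤j j≤n = floor-neg n (p (+ j)) (rem-nonzero inv j 1≤j j≤n)

    ⌊M-p⌋ : ∀ j → 1 ℕ.≤ j → j ℕ.≤ n → ⌊_⌋ n (N n - p (+ j)) ≡ - ⌊p⌋ j
    ⌊M-p⌋ j 1≤j j≤n = floor-reflect n (p (+ j)) (rem-nonzero inv j 1≤j j≤n)

    ℓ-middle : ∀ t c d i → suc (suc i) ℕ.≤ n →
      c ℕ.+ pair (⌊p⌋ (suc (suc i))) (⌊p⌋ (suc i)) ℕ.≤ d ℕ.+ pair (⌊p⌋ (suc i)) (⌊p⌋ (suc (suc i))) →
      c ℕ.+ ℓ t (p ∘ s n (suc i)) ℕ.≤ d ℕ.+ ℓ t p
    ℓ-middle t c d i i<n h with ℕ.m≤n⇒∃[o]m+o≡n i<n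
    ... | m , e = subst₂ (λ u v → c ℕ.+ cosetLength u ℕ.≤ d ℕ.+ cosetLength v)
        (sym (double-list mp (⌊_⌋ n) i m n≡ (s-double n (suc i) (s≤s z≤n) i<n)))
        (sym (trans (cong (map ⌊p⌋ ∘ range 1) n≡) (map-range-++ ⌊p⌋ i (2 ℕ.+ m))))
        (length-swap c d (map ⌊p⌋ (range 1 i)) (⌊p⌋ (suc i)) (⌊p⌋ (suc (suc i)))
            (map ⌊p⌋ (range (3 ℕ.+ i) m)) h)
      where
      open Length (e₀ t) (eₙ t)
      n≡ : n ≡ i ℕ.+ (2 ℕ.+ m)
      n≡ = sym (trans (trans (ℕ.+-suc i (suc m)) (cong suc (ℕ.+-suc i m))) e)

    ℓ-s₀C : ∀ k c d → 1 ℕ.≤ n → c ℕ.+ ∣ - 1ℤ - ⌊p⌋ 1 ∣ ℕ.≤ d ℕ.+ ∣ ⌊p⌋ 1 ∣ → let open Length 1 k in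
      c ℕ.+ cosetLength (quotients (p ∘ s₀C n)) ℕ.≤ d ℕ.+ cosetLength (quotients p)
    ℓ-s₀C k c d 1≤n h with ℕ.m≤n⇒∃[o]m+o≡n 1≤n
    ... | m , e = subst₂ (λ u v → c ℕ.+ cosetLength u ℕ.≤ d ℕ.+ cosetLength v)
        (sym (trans (single-list mp (⌊_⌋ n) 0 m (sym e) (s₀C-single n 1≤n))
          (cong (_∷ map ⌊p⌋ (range 2 m)) (⌊-p⌋ 1 ℕ.≤-refl 1≤n))))
        (cong (map ⌊p⌋ ∘ range 1) e)
        (length-s₀C k c d (⌊p⌋ 1) (map ⌊p⌋ (range 2 m)) h)
      where open Length 1 k

    ℓ-s₀D : ∀ k c d → 2 ℕ.≤ n → c ℕ.+ pair (⌊p⌋ 2) (- 1ℤ - ⌊p⌋ 1) ℕ.≤ d ℕ.+ pair (- 1ℤ - ⌊p⌋ 1) (⌊p⌋ 2) →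
      let open Length 0 k in
      c ℕ.+ cosetLength (quotients (p ∘ s₀D n)) ℕ.≤ d ℕ.+ cosetLength (quotients p)
    ℓ-s₀D k c d 2≤n h with ℕ.m≤n⇒∃[o]m+o≡n 2≤n
    ... | m , e = subst₂ (λ u v → c ℕ.+ cosetLength u ℕ.≤ d ℕ.+ cosetLength v)
        (sym (trans (double-list mp (⌊_⌋ n) 0 m (sym e) (s₀D-double n 2≤n))
          (cong₂ (λ u v → u ∷ v ∷ map ⌊p⌋ (range 3 m)) (⌊-p⌋ 2 (s≤s z≤n) 2≤n) (⌊-p⌋ 1 ℕ.≤-refl (ℕ.<⇒≤ 2≤n)))))
        (cong (map ⌊p⌋ ∘ range 1) e)
        (length-s₀D k c d (⌊p⌋ 1) (⌊p⌋ 2) (map ⌊p⌋ (range 3 m)) h)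
      where open Length 0 k

    ℓ-sₙC : ∀ k c d → 1 ℕ.≤ n → c ℕ.+ fold (- ⌊p⌋ n) ℕ.≤ d ℕ.+ fold (⌊p⌋ n) → let open Length k 1 in
      c ℕ.+ cosetLength (quotients (p ∘ sₙC n)) ℕ.≤ d ℕ.+ cosetLength (quotients p)
    ℓ-sₙC k c d 1≤n h with ℕ.m≤n⇒∃[o]m+o≡n 1≤n
    ... | m , refl = subst₂ (λ u v → c ℕ.+ cosetLength u ℕ.≤ d ℕ.+ cosetLength v)
        (sym (trans (single-list mp (⌊_⌋ n) m 0 (ℕ.+-comm 1 m) (sₙC-single n 1≤n))
          (cong (λ u → map ⌊p⌋ (range 1 m) ++ u ∷ []) (⌊M-p⌋ n 1≤n ℕ.≤-refl))))
        (sym (trans (cong (map ⌊p⌋ ∘ range 1) (ℕ.+-comm 1 m)) (map-range-++ ⌊p⌋ m 1)))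
        (length-sₙC k c d (map ⌊p⌋ (range 1 m)) (⌊p⌋ n) h)
      where open Length k 1

    ℓ-sₙD : ∀ k c d i → suc (suc i) ≡ n → c ℕ.+ pair (- ⌊p⌋ n) (⌊p⌋ (suc i)) ℕ.≤ d ℕ.+ pair (⌊p⌋ (suc i))
        (- ⌊p⌋ n) →
      let open Length k 0 in
      c ℕ.+ cosetLength (quotients (p ∘ sₙD n)) ℕ.≤ d ℕ.+ cosetLength (quotients p)
    ℓ-sₙD k c d i refl h = subst₂ (λ u v → c ℕ.+ cosetLength u ℕ.≤ d ℕ.+ cosetLength v)
        (sym (trans (double-list mp (⌊_⌋ n) i 0 (ℕ.+-comm 2 i) (sₙD-double n (suc i) (s≤s z≤n) refl))
          (cong₂ (λ u v → map ⌊p⌋ (range 1 i) ++ u ∷ v ∷ []) (⌊M-p⌋ n (s≤s z≤n) ℕ.≤-refl)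
              (⌊M-p⌋ (suc i) (s≤s z≤n) (ℕ.n≤1+n _)))))
        (sym (trans (cong (map ⌊p⌋ ∘ range 1) (ℕ.+-comm 2 i)) (map-range-++ ⌊p⌋ i 2)))
        (length-sₙD k c d (map ⌊p⌋ (range 1 i)) (⌊p⌋ (suc i)) (⌊p⌋ n) h)
      where open Length k 0

    ℓ-first≤ : ∀ t → 2 ℕ.≤ n → ℓ t (p ∘ first t n) ℕ.≤ 1 ℕ.+ ℓ t p
    ℓ-first≤ C̃/C 2≤n = ℓ-s₀C 1 0 1 (ℕ.<⇒≤ 2≤n) (∣reflect∣≤ (⌊p⌋ 1))
    ℓ-first≤ B̃/B 2≤n = ℓ-s₀D 1 0 1 2≤n (pair-swap≤ (- 1ℤ - ⌊p⌋ 1) (⌊p⌋ 2))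
    ℓ-first≤ B̃/D 2≤n = ℓ-s₀C 0 0 1 (ℕ.<⇒≤ 2≤n) (∣reflect∣≤ (⌊p⌋ 1))
    ℓ-first≤ D̃/D 2≤n = ℓ-s₀D 0 0 1 2≤n (pair-swap≤ (- 1ℤ - ⌊p⌋ 1) (⌊p⌋ 2))

    ℓ-last≤ : ∀ t i → suc (suc i) ≡ n → ℓ t (p ∘ last t n) ℕ.≤ 1 ℕ.+ ℓ t p
    ℓ-last≤ C̃/C i refl = ℓ-sₙC 1 0 1 (s≤s z≤n) (fold-neg≤ (⌊p⌋ n))
    ℓ-last≤ B̃/B i refl = ℓ-sₙC 0 0 1 (s≤s z≤n) (fold-neg≤ (⌊p⌋ n))
    ℓ-last≤ B̃/D i e = ℓ-sₙD 1 0 1 i e (pair-swap≤ (⌊p⌋ (suc i)) (- ⌊p⌋ n))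
    ℓ-last≤ D̃/D i e = ℓ-sₙD 0 0 1 i e (pair-swap≤ (⌊p⌋ (suc i)) (- ⌊p⌋ n))

    ℓ-generator≤ : ∀ t → 2 ℕ.≤ n → ∀ k → ℓ t (p ∘ generator t n k) ℕ.≤ 1 ℕ.+ ℓ t p
    ℓ-generator≤ t 2≤n Fin.zero = ℓ-first≤ t 2≤n
    ℓ-generator≤ t 2≤n (Fin.suc k) with suc (toℕ k) ℕ.≟ n
    ... | no e = subst (λ g → ℓ t (p ∘ g) ℕ.≤ 1 ℕ.+ ℓ t p) (sym (generator-middle n t k e))
      (ℓ-middle t 0 1 (toℕ k) (ℕ.≤∧≢⇒< (Fin.toℕ<n k) e)
          (pair-swap≤ (⌊p⌋ (suc (toℕ k))) (⌊p⌋ (suc (suc (toℕ k))))))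
    ... | yes e with ℕ.m≤n⇒∃[o]m+o≡n 2≤n
    ...   | i , e′ = subst (λ g → ℓ t (p ∘ g) ℕ.≤ 1 ℕ.+ ℓ t p) (sym (generator-last n t k e)) (ℓ-last≤ t i e′)

    NoDescent : Type → Set
    NoDescent t = ∀ k → ¬ (ℓ t (p ∘ generator t n k) ℕ.< ℓ t p)

    -- The absence of a descent at s₀ gives q 1 ≥ 0 in type C, but only q 1 + q 2 ≥ -1 in type D.
    -- The weaker bound admits the exceptional bottom (-1, 0, ..., 0).
    data StartsWell : Type → Set where
      s₀C-ascent : ∀ {t} → 0ℤ ≤ ⌊p⌋ 1 → StartsWell t
      s₀D-ascent : ∀ {t} → e₀ t ≡ 0 → - 1ℤ - ⌊p⌋ 1 ≤ ⌊p⌋ 2 → StartsWell t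

    starts-well : ∀ t → 2 ℕ.≤ n → NoDescent t → StartsWell t
    starts-well C̃/C 2≤n nd = s₀C-ascent (ℤ.≮⇒≥ λ lt → nd Fin.zero
        (ℓ-s₀C 1 1 0 (ℕ.<⇒≤ 2≤n) (∣reflect∣< (⌊p⌋ 1) lt)))
    starts-well B̃/B 2≤n nd = s₀D-ascent refl (ℤ.≮⇒≥ λ lt → nd Fin.zero
        (ℓ-s₀D 1 1 0 2≤n (pair-swap< (- 1ℤ - ⌊p⌋ 1) (⌊p⌋ 2) lt)))
    starts-well B̃/D 2≤n nd = s₀C-ascent (ℤ.≮⇒≥ λ lt → nd Fin.zero
        (ℓ-s₀C 0 1 0 (ℕ.<⇒≤ 2≤n) (∣reflect∣< (⌊p⌋ 1) lt)))
    starts-well D̃/D 2≤n nd = s₀D-ascent refl (ℤ.≮⇒≥ λ lt → nd Fin.zero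
        (ℓ-s₀D 0 1 0 2≤n (pair-swap< (- 1ℤ - ⌊p⌋ 1) (⌊p⌋ 2) lt)))

    -- For the types ending in `sₙD` the minimal rank ensures n - 1 ≥ 2, so that q (n - 1) can later
    -- be compared with q 2.
    ends-well : ∀ t i → suc (suc i) ≡ n → minRank t ℕ.≤ n → ¬ (ℓ t (p ∘ last t n) ℕ.< ℓ t p) →
      ⌊p⌋ n ≤ 0ℤ ⊎ (1 ℕ.≤ i × ⌊p⌋ (suc i) ≤ - ⌊p⌋ n)
    ends-well C̃/C i refl _ nd = inj₁ (ℤ.≮⇒≥ λ lt → nd (ℓ-sₙC 1 1 0 (s≤s z≤n) (fold-neg< (⌊p⌋ n) lt)))
    ends-well B̃/B i refl _ nd = inj₁ (ℤ.≮⇒≥ λ lt → nd (ℓ-sₙC 0 1 0 (s≤s z≤n) (fold-neg< (⌊p⌋ n) lt)))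
    ends-well B̃/D i refl (s≤s (s≤s 1≤i)) nd = inj₂
        (1≤i , ℤ.≮⇒≥ λ lt → nd (ℓ-sₙD 1 1 0 i refl (pair-swap< (⌊p⌋ (suc i)) (- ⌊p⌋ n) lt)))
    ends-well D̃/D i refl (s≤s (s≤s 2≤i)) nd = inj₂
        (ℕ.<⇒≤ 2≤i , ℤ.≮⇒≥ λ lt → nd (ℓ-sₙD 0 1 0 i refl (pair-swap< (⌊p⌋ (suc i)) (- ⌊p⌋ n) lt)))

ascending : ∀ {n} (f : ℕ → ℤ) → (∀ i → suc (suc i) ℕ.≤ n → f (suc i) ≤ f (suc (suc i))) →
            ∀ {i j} → 1 ℕ.≤ i → i ℕ.≤ j → j ℕ.≤ n → f i ≤ f j
ascending f asc {i} {j} 1≤i i≤j j≤n = go (ℕ.≤⇒≤′ i≤j) j≤n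
  where
  go : ∀ {j} → i ℕ.≤′ j → j ℕ.≤ _ → f i ≤ f j
  go ℕ.≤′-refl _ = ℤ.≤-refl
  go {suc (suc j)} (ℕ.≤′-step i≤j) j≤n = ℤ.≤-trans (go i≤j (ℕ.<⇒≤ j≤n)) (asc j j≤n)
  go {suc zero} (ℕ.≤′-step i≤0) _ = ⊥-elim (ℕ.<⇒≱ 1≤i (ℕ.≤′⇒≤ i≤0))

generator-at : ∀ t n i → suc (suc i) ℕ.≤ n → ∃[ k ] generator t n (Fin.suc k) ≡ s n (suc i)
generator-at t n i i<n = k , trans (generator-middle n t k (subst (λ j → suc j ≢ n) (sym toℕ-k) (ℕ.<⇒≢ i<n)))
  (cong (λ j → s n (suc j)) toℕ-k)
  where
  k = Fin.fromℕ< (ℕ.<⇒≤ i<n)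
  toℕ-k : toℕ k ≡ i
  toℕ-k = Fin.toℕ-fromℕ< (ℕ.<⇒≤ i<n)

generator-at-last : ∀ t i → ∃[ k ] generator t (suc i) (Fin.suc k) ≡ last t (suc i)
generator-at-last t i = k , generator-last (suc i) t k (cong suc (Fin.toℕ-fromℕ i))
  where k = Fin.fromℕ i

module _ (n : ℕ) {w p : ℤ → ℤ} (inv : Inverses n w p) where

  private
    y : ℕ → ℤ
    y = quotient n p

  -- Without middle descents q is weakly increasing, so the two ends squeeze it: q 2 ≥ 0 comes from
  -- the left and q n ≤ 0 from the right.
  bottom : ∀ t → minRank t ℕ.≤ n → NoDescent n inv t →
    (∀ j → 2 ℕ.≤ j → j ℕ.≤ n → y j ≡ 0ℤ) × (y 1 ≡ 0ℤ ⊎ (e₀ t ≡ 0 × y 1 ≡ -1ℤ))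
  bottom t minRank≤n nd with ℕ.m≤n⇒∃[o]m+o≡n 2≤n
    where 2≤n = ℕ.≤-trans (2≤minRank t) minRank≤n
  ... | i , refl = zeros , x₁ start
    where
    2≤n : 2 ℕ.≤ n
    2≤n = ℕ.≤-trans (2≤minRank t) minRank≤n
    asc : ∀ i → suc (suc i) ℕ.≤ n → y (suc i) ≤ y (suc (suc i))
    asc i i<n with generator-at t n i i<n
    ... | k , e = ℤ.≮⇒≥ λ lt → nd (Fin.suc k) (subst (λ g → ℓ n t (p ∘ g) ℕ.< ℓ n t p) (sym e)
      (ℓ-middle n inv t 1 0 i i<n (pair-swap< (y (suc i)) (y (suc (suc i))) lt)))
    start : StartsWell n inv t
    start = starts-well n inv t 2≤n nd
    0≤x₂ : 0ℤ ≤ y 2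
    0≤x₂ with start
    ... | s₀C-ascent 0≤x₁ = ℤ.≤-trans 0≤x₁ (asc 0 2≤n)
    -- If q 2 were negative, then q 1 ≤ q 2 ≤ -1 would contradict q 1 + q 2 ≥ -1.
    ... | s₀D-ascent _ h = ℤ.≮⇒≥ λ x₂<0 →
      <-irrefl-by (linear₃ h (asc 0 2≤n) (<⇒1+≤ x₂<0) (lemma (y 1) (y 2))) (<⇒≤0 x₂<0)
      where
      lemma : ∀ a b → (b - (- 1ℤ - a)) + (b - a) + (0ℤ - (1ℤ + b)) ≡ b - (1ℤ + - 1ℤ)
      lemma = solve-∀
      <⇒≤0 : ∀ {z} → z < 0ℤ → z ≤ - 1ℤ
      <⇒≤0 {z} z<0 = linear₁ (<⇒1+≤ z<0) (lemma′ z)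
        where
        lemma′ : ∀ z → 0ℤ - (1ℤ + z) ≡ - 1ℤ - z
        lemma′ = solve-∀
    xₙ≤0 : y n ≤ 0ℤ
    xₙ≤0 with generator-at-last t (suc i)
    ... | k , e with ends-well n inv t i refl minRank≤n
        (subst (λ g → ¬ (ℓ n t (p ∘ g) ℕ.< ℓ n t p)) e (nd (Fin.suc k)))
    ...   | inj₁ h = h
    -- Here 0 ≤ q 2 ≤ q (n - 1) ≤ - q n.
    ...   | inj₂ (1≤i , h) = linear₂ h (ℤ.≤-trans 0≤x₂ (ascending y asc (s≤s z≤n) (s≤s 1≤i) (ℕ.n≤1+n _)))
      (lemma (y (suc i)) (y n))
      where
      lemma : ∀ a b → (- b - a) + (a - 0ℤ) ≡ 0ℤ - b
      lemma = solve-∀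
    zeros : ∀ j → 2 ℕ.≤ j → j ℕ.≤ n → y j ≡ 0ℤ
    zeros j 2≤j j≤n = ℤ.≤-antisym
      (ℤ.≤-trans (ascending y asc (ℕ.<⇒≤ 2≤j) j≤n ℕ.≤-refl) xₙ≤0)
      (ℤ.≤-trans 0≤x₂ (ascending y asc (s≤s z≤n) 2≤j j≤n))
    x₁≤0 : y 1 ≤ 0ℤ
    x₁≤0 = ℤ.≤-trans (asc 0 2≤n) (ℤ.≤-reflexive (zeros 2 ℕ.≤-refl 2≤n))
    x₁ : StartsWell n inv t → y 1 ≡ 0ℤ ⊎ (e₀ t ≡ 0 × y 1 ≡ -1ℤ)
    x₁ (s₀C-ascent h) = inj₁ (ℤ.≤-antisym x₁≤0 h)
    x₁ (s₀D-ascent e h) with y 1 ℤ.≟ 0ℤ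
    ... | yes x₁≡0 = inj₁ x₁≡0
    ... | no  x₁≢0 = inj₂ (e , ℤ.≤-antisym
      (linear₁ (<⇒1+≤ (ℤ.≤∧≢⇒< x₁≤0 x₁≢0)) (lemma (y 1)))
      (linear₁ h (trans (cong (_- (- 1ℤ - y 1)) (zeros 2 ℕ.≤-refl 2≤n)) (lemma′ (y 1)))))
      where
      lemma : ∀ a → 0ℤ - (1ℤ + a) ≡ -1ℤ - a
      lemma = solve-∀
      lemma′ : ∀ a → 0ℤ - (- 1ℤ - a) ≡ a - -1ℤ
      lemma′ = solve-∀

-- Words

-- The family is a parameter because words are formed both from all generators and from s₁, ..., sₙ
-- alone.
prod : ∀ {m} → (Fin m → ℤ → ℤ) → List (Fin m) → ℤ → ℤ
prod G = foldr (λ k f → G k ∘ f) id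

-- Applied to ℓ this splits off a word of length ≤ ℓ; applied to a second
-- potential it sorts an element of the parabolic subgroup.
greedy : ∀ {m} (G : Fin m → ℤ → ℤ) (μ : (ℤ → ℤ) → ℕ) p →
  ∃[ v ] length v ℕ.+ μ (p ∘ prod G v) ℕ.≤ μ p × (∀ k → ¬ (μ (p ∘ prod G v ∘ G k) ℕ.< μ (p ∘ prod G v)))
greedy G μ p = go (μ p) p ℕ.≤-refl
  where
  go : ∀ fuel p → μ p ℕ.≤ fuel →
    ∃[ v ] length v ℕ.+ μ (p ∘ prod G v) ℕ.≤ μ p × (∀ k → ¬ (μ (p ∘ prod G v ∘ G k) ℕ.< μ (p ∘ prod G v)))
  go fuel p h with Fin.any? (λ k → μ (p ∘ G k) ℕ.<? μ p)
  ... | no none = [] , ℕ.≤-refl , λ k lt → none (k , lt)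
  go zero p h | yes (k , lt) = ⊥-elim (ℕ.n≮0 (ℕ.<-≤-trans lt h))
  go (suc fuel) p h | yes (k , lt) with go fuel (p ∘ G k) (ℕ.≤-pred (ℕ.<-≤-trans lt h))
  ... | v , v≤ , none = k ∷ v , ℕ.<-≤-trans (s≤s v≤) lt , none

-- Each letter is its own inverse, so the reversed word is the inverse; the second argument of `go`
-- accumulates it.
prod-inverses : ∀ {n m} (G : Fin m → ℤ → ℤ) → (∀ k → Inverses n (G k) (G k)) →
                ∀ v → ∃[ v′ ] Inverses n (prod G v′) (prod G v)
prod-inverses {n} G G-inverses v = go v [] id-inverses
  where
  id-inverses : Inverses n id id
  id-inverses = record
    { w-mirrored = id-mirrored ; p-mirrored = id-mirrored ; w∘p = λ _ → refl ; p∘w = λ _ → refl }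
  go : ∀ v v′ {p} → Inverses n (prod G v′) p → ∃[ v″ ] Inverses n (prod G v″) (p ∘ prod G v)
  go []      v′ a = v′ , a
  go (k ∷ v) v′ a = go v (k ∷ v′) (∘-inverses a (G-inverses k))

module _ (t : Type) (n : ℕ) (2≤n : 2 ℕ.≤ n) where

  generator-inverses : ∀ k → Inverses n (generator t n k) (generator t n k)
  generator-inverses k = record
    { w-mirrored = generator-mirrored n t k ; p-mirrored = generator-mirrored n t k
    ; w∘p = generator-involutive t n 2≤n k ; p∘w = generator-involutive t n 2≤n k }

  word-inverses : ∀ v → ∃[ v′ ] Inverses n (product t n v′) (product t n v)
  word-inverses = prod-inverses (generator t n) generator-inverses

  ℓ-id : ℓ n t id ≡ 0
  ℓ-id = trans (cong cosetLength (map-range-cong 1 n λ j 1≤j j≤n →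
      floor-unique n {+ j} {0ℤ} (+ j) (+≤+ z≤n) (+≤n⇒<M {n} (ℕ.≤-pred j≤n)) (sym (ℤ.+-identityʳ (+ j)))))
    (zeros (range 1 n))
    where
    open Length (e₀ t) (eₙ t)
    cross-0 : ∀ js → cross 0ℤ (map (λ _ → 0ℤ) js) ≡ 0
    cross-0 [] = refl
    cross-0 (_ ∷ js) = cross-0 js
    zeros : ∀ (js : List ℕ) → cosetLength (map (λ _ → 0ℤ) js) ≡ 0
    zeros [] = refl
    zeros (_ ∷ js) = cong₂ ℕ._+_ (cong₂ ℕ._+_ (cong₂ ℕ._+_ (ℕ.*-zeroʳ (e₀ t)) (ℕ.*-zeroʳ (eₙ t)))
        (cross-0 js)) (zeros js)

  ℓ-word≤ : ∀ {w p} → Inverses n w p → ∀ v → ℓ n t p ℕ.≤ length v ℕ.+ ℓ n t (p ∘ product t n v)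
  ℓ-word≤ inv [] = ℕ.≤-refl
  ℓ-word≤ {w} {p} inv (k ∷ v) = begin
    -- Writing p as (p ∘ g) ∘ g turns the bound on growth under g into a bound on the decrease from
    -- p to p ∘ g.
    ℓ n t p ≡⟨ ℓ-cong n t (λ i → cong p (generator-involutive t n 2≤n k i)) ⟨
    ℓ n t (p ∘ g ∘ g) ≤⟨ ℓ-generator≤ n inv′ t 2≤n k ⟩
    1 ℕ.+ ℓ n t (p ∘ g) ≤⟨ s≤s (ℓ-word≤ inv′ v) ⟩
    suc (length v ℕ.+ ℓ n t (p ∘ g ∘ product t n v)) ∎
    where
    open ℕ.≤-Reasoning
    g = generator t n k
    inv′ : Inverses n (g ∘ w) (p ∘ g)
    inv′ = ∘-inverses inv (generator-inverses k)

  -- The letters of a word for `w` lead from `p` to the identity, where `ℓ` vanishes, and each of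
  -- them lowers `ℓ` by at most 1.
  lower-bound : ∀ {w p} → Inverses n w p → ∀ v → product t n v ≗ w → ℓ n t p ℕ.≤ length v
  lower-bound {w} {p} inv v v≗w = subst (ℓ n t p ℕ.≤_)
    (trans (cong (length v ℕ.+_) (trans (ℓ-cong n t (λ i → trans (cong p (v≗w i)) (p∘w inv i))) ℓ-id))
        (ℕ.+-identityʳ _))
    (ℓ-word≤ inv v)

  word-mirrored : ∀ v → Mirrored n (product t n v)
  word-mirrored v = p-mirrored (proj₂ (word-inverses v))

  -- Mirrored functions are determined by their values at 1, ..., n, which makes the comparison
  -- finite.
  _≗?_ : ∀ u v → Dec (product t n u ≗ product t n v)
  u ≗? v = map′ (λ h → agree (word-mirrored u) (word-mirrored v)
      (λ { (suc j) _ j<n → subst (λ i → product t n u (+ suc i) ≡ product t n v (+ suc i))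
      (Fin.toℕ-fromℕ< j<n) (h (Fin.fromℕ< j<n)) }))
    (λ h k → h _)
    (Fin.all? {n = n} λ k → product t n u (+ suc (toℕ k)) ℤ.≟ product t n v (+ suc (toℕ k)))

  shorter? : ∀ v l → Dec (∃[ u ] product t n u ≗ product t n v × length u ≡ l)
  shorter? v l = map′ (λ { (u , h , e) → u , h , e }) (λ { (u , h , e) → u , h , e })
      (search l (λ u → product t n u ≗ product t n v) (_≗? v))
    where
    search : ∀ l (P : Word n → Set) → (∀ u → Dec (P u)) → Dec (∃[ u ] P u × length u ≡ l)
    search zero P P? = map′ (λ h → [] , h , refl) (λ { ([] , h , _) → h }) (P? [])
    search (suc l) P P? = map′ (λ { (k , u , h , e) → k ∷ u , h , cong suc e })
      (λ { (k ∷ u , h , e) → k , u , h , ℕ.suc-injective e })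
      (Fin.any? λ k → search l (P ∘ (k ∷_)) (P? ∘ (k ∷_)))

  -- Minimality of a representative compares elements together with their exact lengths, so a least
  -- length has to be produced. It is found by trying all words of each length from 0 up to that of
  -- `v`.
  has-length : ∀ v → ∃[ l ] HasLength t n (product t n v) l × l ℕ.≤ length v
  has-length v = go (length v) 0 refl λ _ ()
    where
    go : ∀ d l → l ℕ.+ d ≡ length v → (∀ m → m ℕ.< l → ¬
        (∃[ u ] product t n u ≗ product t n v × length u ≡ m)) →
         ∃[ l ] HasLength t n (product t n v) l × l ℕ.≤ length v
    go d l e none with shorter? v l
    ... | yes found = l , (found , λ u h → ℕ.≮⇒≥ λ lt → none (length u) lt (u , h , refl)) ,
      subst (l ℕ.≤_) e (ℕ.m≤m+n l d)
    go zero l e none | no ¬p = ⊥-elim (¬p (v , (λ _ → refl) , trans (sym e) (ℕ.+-identityʳ l)))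
    go (suc d) l e none | no ¬p = go d (suc l) (trans (sym (ℕ.+-suc l d)) e)
      λ m m<1+l → case (ℕ.m≤n⇒m<n∨m≡n (ℕ.≤-pred m<1+l))
      where
      case : ∀ {m} → m ℕ.< l ⊎ m ≡ l → ¬ (∃[ u ] product t n u ≗ product t n v × length u ≡ m)
      case (inj₁ m<l) = none _ m<l
      case (inj₂ refl) = ¬p

-- The parabolic subgroup W

-- For x₁, ..., xₙ this is Σ (n + 1 - j) x_j. Earlier entries weigh more, so it drops when an
-- inversion is sorted as well as when an entry becomes smaller.
spread : List ℕ → ℕ
spread []       = 0
spread (x ∷ xs) = suc (length xs) ℕ.* x ℕ.+ spread xs

spread-prefix : ∀ xs {ys zs} → length ys ≡ length zs → spread ys ℕ.< spread zs →
                spread (xs ++ ys) ℕ.< spread (xs ++ zs)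
spread-prefix []       _ h = h
spread-prefix (x ∷ xs) {ys} {zs} e h = subst (λ l → suc l ℕ.* x ℕ.+ spread (xs ++ ys) ℕ.< suc
    (length (xs ++ zs)) ℕ.* x ℕ.+ spread (xs ++ zs))
  (trans (List.length-++ xs) (trans (cong (length xs ℕ.+_) (sym e)) (sym (List.length-++ xs))))
  (ℕ.+-monoʳ-< (suc (length (xs ++ zs)) ℕ.* x) (spread-prefix xs e h))

spread-swap : ∀ {x y} zs → y ℕ.< x → spread (y ∷ x ∷ zs) ℕ.< spread (x ∷ y ∷ zs)
spread-swap {x} {y} zs y<x = subst₂ ℕ._<_ (lemma (length zs) x y (spread zs))
    (lemma′ (length zs) x y (spread zs))
  (ℕ.+-monoˡ-< (suc (length zs) ℕ.* (x ℕ.+ y) ℕ.+ spread zs) y<x)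
  where
  lemma : ∀ l x y s → y ℕ.+ (suc l ℕ.* (x ℕ.+ y) ℕ.+ s) ≡ suc (suc l) ℕ.* y ℕ.+ (suc l ℕ.* x ℕ.+ s)
  lemma = ℕSolver.solve-∀
  lemma′ : ∀ l x y s → x ℕ.+ (suc l ℕ.* (x ℕ.+ y) ℕ.+ s) ≡ suc (suc l) ℕ.* x ℕ.+ (suc l ℕ.* y ℕ.+ s)
  lemma′ = ℕSolver.solve-∀

spreadOf : ℕ → (ℤ → ℤ) → ℕ
spreadOf n p = spread (map (λ j → ∣ p (+ j) ∣) (range 1 n))

Even : ℤ → Set
Even z = ∃[ c ] z ≡ c + c

¬even-1 : ¬ Even 1ℤ
¬even-1 (+ suc c , e) = ℕ.1+n≢0 (sym (trans (ℕ.suc-injective (ℤ.+-injective e)) (ℕ.+-suc c c)))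

-- The generators of W map the integers strictly between 0 and `N` to themselves, whereas s₀ does
-- not; being in the box is how q = 0 is expressed by values.
Box : ℕ → ℤ → Set
Box n x = 1ℤ ≤ x × 1ℤ + x ≤ N n

box-< : ∀ {n x y} → Box n x → Box n y → y < x → ∣ y ∣ ℕ.< ∣ x ∣
box-< {x = + _} {+ _} _ _ (+<+ y<x) = y<x

box-reflect : ∀ {n x} → Box n x → Box n (N n - x)
box-reflect {n} {x} (1≤x , x<M) = linear₁ x<M (lemma x (N n)) , linear₁ 1≤x (lemma′ x (N n))
  where
  lemma : ∀ x m → m - (1ℤ + x) ≡ m - x - 1ℤ
  lemma = solve-∀
  lemma′ : ∀ x m → x - 1ℤ ≡ m - (1ℤ + (m - x))
  lemma′ = solve-∀

+-box : ∀ {n} j → 1 ℕ.≤ j → j ℕ.≤ n → Box n (+ j)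
+-box {n} j 1≤j j≤n = +≤+ 1≤j , +≤n⇒<M {n} j≤n

box-preserved : ∀ {n p} → Mirrored n p → (∀ j → 1 ℕ.≤ j → j ℕ.≤ n → Box n (p (+ j))) →
                ∀ x → Box n x → Box n (p x)
box-preserved {n} {p} mp h (+ r) (+≤+ 1≤r , +≤+ r<M) with r ℕ.≤? n
... | yes r≤n = h r 1≤r r≤n
... | no r≰n with N-+ {n} (ℕ.≰⇒> r≰n) (ℕ.≤-pred r<M)
...   | j , 1≤j , j≤n , e = subst (Box n) (trans (sym (reflected mp (+ j))) (cong p e))
    (box-reflect {n} (h j 1≤j j≤n))

act-box : ∀ {n x} φ → φ ≢ negate → Box n x → Box n (act n φ x)
act-box keep    _ b = b
act-box negate  h b = ⊥-elim (h refl)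
act-box {n} {x} reflect _ b = box-reflect {n} {x} b

single-box : ∀ {n φ a g} → 1 ℕ.≤ a → a ℕ.≤ n → φ ≢ negate → Single n φ a g →
             ∀ j → 1 ℕ.≤ j → j ℕ.≤ n → Box n (g (+ j))
single-box {n} {φ} {a} {g} 1≤a a≤n φ≢ sg j 1≤j j≤n with j ℕ.≟ a
... | yes refl = subst (Box n) (sym (Single.at sg)) (act-box {n} {+ j} φ φ≢ (+-box j 1≤j j≤n))
... | no j≢a = subst (Box n) (sym (Single.fixes sg j 1≤j j≤n j≢a)) (+-box j 1≤j j≤n)

double-box : ∀ {n φ a g} → 1 ℕ.≤ a → suc a ℕ.≤ n → φ ≢ negate → Double n φ a g →
             ∀ j → 1 ℕ.≤ j → j ℕ.≤ n → Box n (g (+ j))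
double-box {n} {φ} {a} {g} 1≤a a<n φ≢ dg j 1≤j j≤n with j ℕ.≟ a | j ℕ.≟ suc a
... | yes refl | _ = subst (Box n) (sym (Double.at dg))
    (act-box {n} {+ suc j} φ φ≢ (+-box (suc j) (s≤s z≤n) a<n))
... | no _ | yes refl = subst (Box n) (sym (Double.at-suc dg))
    (act-box {n} {+ a} φ φ≢ (+-box a 1≤a (ℕ.<⇒≤ a<n)))
... | no j≢a | no j≢1+a = subst (Box n) (sym (Double.fixes dg j 1≤j j≤n j≢a j≢1+a)) (+-box j 1≤j j≤n)

last-box : ∀ t i {n} → suc (suc i) ≡ n → ∀ j → 1 ℕ.≤ j → j ℕ.≤ n → Box n (last t n (+ j))
last-box C̃/C i {n} refl = single-box {n} {reflect} (s≤s z≤n) ℕ.≤-refl (λ ()) (sₙC-single n (s≤s z≤n))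
last-box B̃/B i {n} refl = single-box {n} {reflect} (s≤s z≤n) ℕ.≤-refl (λ ()) (sₙC-single n (s≤s z≤n))
last-box B̃/D i {n} refl = double-box {n} {reflect} (s≤s z≤n) ℕ.≤-refl (λ ())
    (sₙD-double n (suc i) (s≤s z≤n) refl)
last-box D̃/D i {n} refl = double-box {n} {reflect} (s≤s z≤n) ℕ.≤-refl (λ ())
    (sₙD-double n (suc i) (s≤s z≤n) refl)

generator-box : ∀ t i {n} → suc (suc i) ≡ n → ∀ (k : Fin n) x → Box n x → Box n (generator t n (Fin.suc k) x)
generator-box t i {n} e k = box-preserved (generator-mirrored n t (Fin.suc k)) at
  where
  at : ∀ j → 1 ℕ.≤ j → j ℕ.≤ n → Box n (generator t n (Fin.suc k) (+ j))
  at j 1≤j j≤n with suc (toℕ k) ℕ.≟ n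
  ... | yes e′ = subst (λ g → Box n (g (+ j))) (sym (generator-last n t k e′)) (last-box t i e j 1≤j j≤n)
  ... | no e′ = subst (λ g → Box n (g (+ j))) (sym (generator-middle n t k e′))
    (double-box {n} {keep} (s≤s z≤n) k<n (λ ()) (s-double n (suc (toℕ k)) (s≤s z≤n) k<n) j 1≤j j≤n)
    where k<n = ℕ.≤∧≢⇒< (Fin.toℕ<n k) e′

Σℤ-++ : ∀ xs ys → Σℤ (xs ++ ys) ≡ Σℤ xs + Σℤ ys
Σℤ-++ []       ys = sym (ℤ.+-identityˡ (Σℤ ys))
Σℤ-++ (x ∷ xs) ys = trans (cong (λ z → x + z) (Σℤ-++ xs ys)) (sym (ℤ.+-assoc x (Σℤ xs) (Σℤ ys)))

roundSum : ℕ → (ℤ → ℤ) → ℤ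
roundSum n p = Σℤ (map (λ j → ⌊_⌉ n (p (+ j))) (range 1 n))

floorSum : ℕ → (ℤ → ℤ) → ℤ
floorSum n p = Σℤ (quotients n p)

-- Among the generators only `s₀C` changes the parity of the sum of floors, and only `sₙC` that of
-- the sum of nearest integers. Each parity is thus an invariant where the corresponding end has
-- type D.
FloorParity RoundParity : Type → ℕ → (ℤ → ℤ) → Set
FloorParity C̃/C n p = ⊤
FloorParity B̃/B n p = Even (floorSum n p)
FloorParity B̃/D n p = ⊤
FloorParity D̃/D n p = Even (floorSum n p)
RoundParity C̃/C n p = ⊤
RoundParity B̃/B n p = ⊤
RoundParity B̃/D n p = Even (roundSum n p)
RoundParity D̃/D n p = Even (roundSum n p)

-- Sorting an element with q = 0

module _ (t : Type) (i : ℕ) {w p : ℤ → ℤ} (inv : Inverses (suc (suc i)) w p)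
         (box : ∀ j → 1 ℕ.≤ j → j ℕ.≤ suc (suc i) → Box (suc (suc i)) (p (+ j)))
         (none : ∀ k → ¬ (spreadOf (suc (suc i)) (p ∘ generator t (suc (suc i)) (Fin.suc k)) ℕ.< spreadOf
             (suc (suc i)) p))
         where

  private
    n : ℕ
    n = suc (suc i)

    mp = p-mirrored inv

    a : ℕ → ℕ
    a j = ∣ p (+ j) ∣

    box-i : Box n (p (+ suc i))
    box-i = box (suc i) (s≤s z≤n) (ℕ.n≤1+n _)

    box-n : Box n (p (+ n))
    box-n = box n (s≤s z≤n) ℕ.≤-refl

  sorted : ∀ j → suc (suc j) ℕ.≤ n → p (+ suc j) ≤ p (+ suc (suc j))
  sorted j j<n with generator-at t n j j<n | ℕ.m≤n⇒∃[o]m+o≡n j<n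
  ... | k , e | m , e′ = ℤ.≮⇒≥ λ lt → none k (subst₂ ℕ._<_
    (cong spread (sym (trans (cong (λ g → map (λ j → ∣ p (g (+ j)) ∣) (range 1 n)) e)
      (double-list mp ∣_∣ j m n≡ (s-double n (suc j) (s≤s z≤n) j<n)))))
    (cong spread (sym (trans (cong (map a ∘ range 1) n≡) (map-range-++ a j (2 ℕ.+ m)))))
    (spread-prefix (map a (range 1 j)) refl
      (spread-swap (map a (range (3 ℕ.+ j) m))
          (box-< {n} (box (suc j) (s≤s z≤n) (ℕ.<⇒≤ j<n)) (box (suc (suc j)) (s≤s z≤n) j<n) lt))))
    where
    n≡ : n ≡ j ℕ.+ (2 ℕ.+ m)
    n≡ = sym (trans (trans (ℕ.+-suc j (suc m)) (cong suc (ℕ.+-suc j m))) e′)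

  strict : ∀ j → suc (suc j) ℕ.≤ n → 1ℤ + p (+ suc j) ≤ p (+ suc (suc j))
  strict j j<n = <⇒1+≤ (ℤ.≤∧≢⇒< (sorted j j<n) λ e →
    ℕ.1+n≢n {suc j} (ℤ.+-injective (trans (sym (w∘p inv _)) (trans (cong w (sym e)) (w∘p inv _)))))

  no-last : ¬ (spreadOf n (p ∘ last t n) ℕ.< spreadOf n p)
  no-last with generator-at-last t (suc i)
  ... | k , e = subst (λ g → ¬ (spreadOf n (p ∘ g) ℕ.< spreadOf n p)) e (none k)

  single-last : Single n reflect n (last t n) → p (+ n) ≤ N n - p (+ n)
  single-last sg = ℤ.≮⇒≥ λ lt → no-last (subst₂ ℕ._<_
    (cong spread (sym (single-list mp ∣_∣ (suc i) 0 (ℕ.+-comm 1 (suc i)) sg)))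
    (cong spread (sym (trans (cong (map a ∘ range 1) (ℕ.+-comm 1 (suc i))) (map-range-++ a (suc i) 1))))
    (spread-prefix (map a (range 1 (suc i))) refl
      (ℕ.+-monoˡ-< 0 (ℕ.+-monoˡ-< 0 (box-< {n} box-n (box-reflect {n} box-n) lt)))))

  -- The generator replaces the last two values x, y by N - y, N - x. As N - y < x is equivalent to
  -- N - x < y, a violation would make both of them smaller and so lower the `spread`.
  double-last : Double n reflect (suc i) (last t n) → p (+ suc i) ≤ N n - p (+ n)
  double-last dg = ℤ.≮⇒≥ λ lt → no-last (subst₂ ℕ._<_
    (cong spread (sym (double-list mp ∣_∣ i 0 (ℕ.+-comm 2 i) dg)))
    (cong spread (sym (trans (cong (map a ∘ range 1) (ℕ.+-comm 2 i)) (map-range-++ a i 2))))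
    (spread-prefix (map a (range 1 i)) refl
      (ℕ.+-mono-<-≤ (ℕ.*-monoʳ-< 2 (box-< {n} box-i (box-reflect {n} box-n) lt))
        (ℕ.+-monoˡ-≤ 0 (ℕ.+-monoˡ-≤ 0 (ℕ.<⇒≤ (box-< {n} box-n (box-reflect {n} box-i) (flip lt))))))))
    where
    flip : N n - p (+ n) < p (+ suc i) → N n - p (+ suc i) < p (+ n)
    flip lt = 1+≤⇒< (linear₁ (<⇒1+≤ lt) (lemma (p (+ suc i)) (p (+ n)) (N n)))
      where
      lemma : ∀ x y m → x - (1ℤ + (m - y)) ≡ y - (1ℤ + (m - x))
      lemma = solve-∀

  -- The hypotheses give 2 x ≤ x + y ≤ 2 n + 1, and x is an integer.
  half : ∀ {x y} → x ≤ y → x ≤ N n - y → x ≤ + n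
  half {x} {y} x≤y h = ℤ.≮⇒≥ λ n<x → <-irrefl-by {+ n} {x} (<⇒1+≤ {+ n} n<x)
      (linear₃ h x≤y (<⇒1+≤ {+ n} n<x) (trans
    (cong (λ m → m - y - x + (y - x) + (x - (1ℤ + + n))) (M≡ n)) (lemma x y (+ n))))
    where
    lemma : ∀ x y k → 1ℤ + (k + k) - y - x + (y - x) + (x - (1ℤ + k)) ≡ k - x
    lemma = solve-∀

  -- The difference p j - j is weakly increasing, at least 0 for j = 1 and at most 0 for j = n.
  fixes-all : p (+ n) ≤ + n → ∀ j → 1 ℕ.≤ j → j ℕ.≤ n → p (+ j) ≡ + j
  fixes-all pₙ≤n j 1≤j j≤n = ℤ.≤-antisym
    (linear₂ (ascending gap gap-ascends 1≤j j≤n ℕ.≤-refl) pₙ≤n (lemma (p (+ j)) (+ j) (p (+ n)) (+ n)))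
    (linear₂ (ascending gap gap-ascends (s≤s z≤n) 1≤j j≤n) (proj₁ (box 1 (s≤s z≤n) (s≤s z≤n)))
        (lemma′ 1ℤ (p (+ 1)) (+ j) (p (+ j))))
    where
    gap : ℕ → ℤ
    gap j = p (+ j) - + j
    gap-ascends : ∀ j → suc (suc j) ℕ.≤ n → gap (suc j) ≤ gap (suc (suc j))
    gap-ascends j j<n = linear₁ (strict j j<n) (lemma (p (+ suc j)) (p (+ suc (suc j))) (+ suc j))
      where
      lemma : ∀ x y k → y - (1ℤ + x) ≡ y - (1ℤ + k) - (x - k)
      lemma = solve-∀
    lemma′ : ∀ a x b y → (y - b - (x - a)) + (x - a) ≡ y - b
    lemma′ = solve-∀
    lemma : ∀ x a y b → (y - b - (x - a)) + (b - y) ≡ a - x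
    lemma = solve-∀

  round-small : ∀ {x} → 1ℤ ≤ x → x ≤ + n → ⌊_⌉ n x ≡ 0ℤ
  round-small {x} 1≤x x≤n = floor-unique n {x + + n} {0ℤ} (x + + n)
    (ℤ.≤-trans (+≤+ z≤n) (ℤ.+-monoˡ-≤ (+ n) 1≤x))
    (linear₁ x≤n (trans (lemma x (+ n)) (cong (_- (1ℤ + (x + + n))) (sym (M≡ n)))))
    (sym (ℤ.+-identityʳ _))
    where
    lemma : ∀ x k → k - x ≡ 1ℤ + (k + k) - (1ℤ + (x + k))
    lemma = solve-∀

  round-large : ∀ {x} → Box n x → 1ℤ + + n ≤ x → ⌊_⌉ n x ≡ 1ℤ
  round-large {x} (_ , x<M) n<x = floor-unique n {x + + n} {1ℤ} (x + + n - N n)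
    (linear₁ n<x (trans (lemma₁ x (+ n)) (cong (λ m → x + + n - m - 0ℤ) (sym (M≡ n)))))
    (linear₂ x<M (ℤ.≤-trans (ℤ.i≤suc[i] (+ n)) (+≤n⇒<M {n} ℕ.≤-refl)) (lemma₂ x (+ n) (N n)))
    (lemma₃ (x + + n) (N n))
    where
    lemma₁ : ∀ x k → x - (1ℤ + k) ≡ x + k - (1ℤ + (k + k)) - 0ℤ
    lemma₁ = solve-∀
    lemma₂ : ∀ x k m → m - (1ℤ + x) + (m - k) ≡ m - (1ℤ + (x + k - m))
    lemma₂ = solve-∀
    lemma₃ : ∀ x m → x ≡ x - m + 1ℤ * m
    lemma₃ = solve-∀

  -- In the box the nearest integer to x / N is 0 for x ≤ n and 1 for x > n. All values but the last
  -- are at most n, so a last value above n would make the sum equal to 1.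
  even⇒last≤n : p (+ suc i) ≤ + n → Even (roundSum n p) → p (+ n) ≤ + n
  even⇒last≤n pᵢ≤n even = ℤ.≮⇒≥ λ n<pₙ → ¬even-1 (subst Even (sum≡ n<pₙ) even)
    where
    f : ℕ → ℤ
    f j = ⌊_⌉ n (p (+ j))
    zeros : ∀ js → Σℤ (map (λ (_ : ℕ) → 0ℤ) js) ≡ 0ℤ
    zeros []       = refl
    zeros (_ ∷ js) = trans (ℤ.+-identityˡ _) (zeros js)
    sum≡ : + n < p (+ n) → roundSum n p ≡ 1ℤ
    sum≡ n<pₙ = begin
      Σℤ (map f (range 1 n)) ≡⟨ cong Σℤ (trans (cong (map f ∘ range 1) (ℕ.+-comm 1 (suc i)))
          (map-range-++ f (suc i) 1)) ⟩
      Σℤ (map f (range 1 (suc i)) ++ f n ∷ []) ≡⟨ Σℤ-++ (map f (range 1 (suc i))) _ ⟩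
      Σℤ (map f (range 1 (suc i))) + (f n + 0ℤ) ≡⟨ cong₂ _+_
          (trans (cong Σℤ (map-range-cong 1 (suc i) small)) (zeros (range 1 (suc i))))
                                                           (trans (ℤ.+-identityʳ (f n)) (round-large box-n
                                                               (<⇒1+≤ n<pₙ))) ⟩
      1ℤ ∎
      where
      open ≡-Reasoning
      small : ∀ j → 1 ℕ.≤ j → j ℕ.< 1 ℕ.+ suc i → f j ≡ 0ℤ
      small j 1≤j (s≤s j≤i) = round-small (proj₁ (box j 1≤j (ℕ.m≤n⇒m≤1+n j≤i)))
        (ℤ.≤-trans (ascending (λ j → p (+ j)) (λ j j≤ → sorted j (ℕ.m≤n⇒m≤1+n j≤)) 1≤j j≤i ℕ.≤-refl) pᵢ≤n)

  identity : RoundParity t n p → ∀ j → 1 ℕ.≤ j → j ℕ.≤ n → p (+ j) ≡ + j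
  identity = go t refl
    where
    single : Single n reflect n (last t n) → p (+ n) ≤ + n
    single sg = half ℤ.≤-refl (single-last sg)
    double : Double n reflect (suc i) (last t n) → Even (roundSum n p) → p (+ n) ≤ + n
    double dg = even⇒last≤n (half (sorted i ℕ.≤-refl) (double-last dg))
    go : ∀ t′ → t′ ≡ t → RoundParity t′ n p → ∀ j → 1 ℕ.≤ j → j ℕ.≤ n → p (+ j) ≡ + j
    go C̃/C refl _ = fixes-all (single (sₙC-single n (s≤s z≤n)))
    go B̃/B refl _ = fixes-all (single (sₙC-single n (s≤s z≤n)))
    go B̃/D refl e = fixes-all (double (sₙD-double n (suc i) (s≤s z≤n) refl) e)
    go D̃/D refl e = fixes-all (double (sₙD-double n (suc i) (s≤s z≤n) refl) e)

-- Invariance of the two parities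

module _ {n : ℕ} {w p : ℤ → ℤ} (inv : Inverses n w p) (h : ℤ → ℤ) where

  private
    mp = p-mirrored inv

  -- With the floor for `h` this is `floorSum`, with the nearest integer it is `roundSum`.
  sumOf : (ℤ → ℤ) → ℤ
  sumOf q = Σℤ (map (λ j → h (q (+ j))) (range 1 n))

  even-single : ∀ {g φ} a → suc a ℕ.≤ n → Single n φ (suc a) g →
                h (act n φ (p (+ suc a))) ≡ - h (p (+ suc a)) →
                Even (sumOf p) → Even (sumOf (p ∘ g))
  even-single {g} {φ} a a<n sg e (c , c≡) with ℕ.m≤n⇒∃[o]m+o≡n a<n
  ... | m , e′ = c - y , (begin
    sumOf (p ∘ g) ≡⟨ cong Σℤ (single-list mp h a m n≡ sg) ⟩
    Σℤ (A ++ h (act n φ (p (+ suc a))) ∷ Z) ≡⟨ Σℤ-++ A _ ⟩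
    Σℤ A + (h (act n φ (p (+ suc a))) + Σℤ Z) ≡⟨ cong (λ u → Σℤ A + (u + Σℤ Z)) e ⟩
    Σℤ A + (- y + Σℤ Z) ≡⟨ lemma (Σℤ A) y (Σℤ Z) ⟩
    Σℤ A + (y + Σℤ Z) - (y + y) ≡⟨ cong (_- (y + y)) (Σℤ-++ A (y ∷ Z)) ⟨
    Σℤ (A ++ y ∷ Z) - (y + y) ≡⟨ cong (λ u → Σℤ u - (y + y))
        (trans (cong (map f ∘ range 1) n≡) (map-range-++ f a (1 ℕ.+ m))) ⟨
    sumOf p - (y + y) ≡⟨ cong (_- (y + y)) c≡ ⟩
    c + c - (y + y) ≡⟨ lemma′ c y ⟩
    (c - y) + (c - y) ∎)
    where
    open ≡-Reasoning
    f : ℕ → ℤ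
    f j = h (p (+ j))
    y = f (suc a)
    A = map f (range 1 a)
    Z = map f (range (2 ℕ.+ a) m)
    n≡ : n ≡ a ℕ.+ (1 ℕ.+ m)
    n≡ = sym (trans (ℕ.+-suc a m) e′)
    lemma : ∀ a y z → a + (- y + z) ≡ a + (y + z) - (y + y)
    lemma = solve-∀
    lemma′ : ∀ c y → c + c - (y + y) ≡ (c - y) + (c - y)
    lemma′ = solve-∀

  even-double : ∀ {g φ} a → suc (suc a) ℕ.≤ n → Double n φ (suc a) g →
                (∃[ d ] h (act n φ (p (+ suc (suc a)))) + h (act n φ (p (+ suc a))) ≡
                        h (p (+ suc a)) + h (p (+ suc (suc a))) + (d + d)) →
                Even (sumOf p) → Even (sumOf (p ∘ g))
  even-double {g} {φ} a a<n dg (d , e) (c , c≡) with ℕ.m≤n⇒∃[o]m+o≡n a<n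
  ... | m , e′ = c + d , (begin
    sumOf (p ∘ g) ≡⟨ cong Σℤ (double-list mp h a m n≡ dg) ⟩
    Σℤ (A ++ y′ ∷ x′ ∷ Z) ≡⟨ Σℤ-++ A _ ⟩
    Σℤ A + (y′ + (x′ + Σℤ Z)) ≡⟨ cong (λ u → Σℤ A + u) (ℤ.+-assoc y′ x′ (Σℤ Z)) ⟨
    Σℤ A + (y′ + x′ + Σℤ Z) ≡⟨ cong (λ u → Σℤ A + (u + Σℤ Z)) e ⟩
    Σℤ A + (x + y + (d + d) + Σℤ Z) ≡⟨ lemma (Σℤ A) x y (Σℤ Z) d ⟩
    Σℤ A + (x + (y + Σℤ Z)) + (d + d) ≡⟨ cong (_+ (d + d)) (Σℤ-++ A (x ∷ y ∷ Z)) ⟨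
    Σℤ (A ++ x ∷ y ∷ Z) + (d + d) ≡⟨ cong (λ u → Σℤ u + (d + d))
        (trans (cong (map f ∘ range 1) n≡) (map-range-++ f a (2 ℕ.+ m))) ⟨
    sumOf p + (d + d) ≡⟨ cong (_+ (d + d)) c≡ ⟩
    c + c + (d + d) ≡⟨ lemma′ c d ⟩
    (c + d) + (c + d) ∎)
    where
    open ≡-Reasoning
    f : ℕ → ℤ
    f j = h (p (+ j))
    x = f (suc a)
    y = f (suc (suc a))
    x′ = h (act n φ (p (+ suc a)))
    y′ = h (act n φ (p (+ suc (suc a))))
    A = map f (range 1 a)
    Z = map f (range (3 ℕ.+ a) m)
    n≡ : n ≡ a ℕ.+ (2 ℕ.+ m)
    n≡ = sym (trans (trans (ℕ.+-suc a (suc m)) (cong suc (ℕ.+-suc a m))) e′)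
    lemma : ∀ a x y z d → a + (x + y + (d + d) + z) ≡ a + (x + (y + z)) + (d + d)
    lemma = solve-∀
    lemma′ : ∀ c d → c + c + (d + d) ≡ (c + d) + (c + d)
    lemma′ = solve-∀

-- The constant k is -1 for floors under `s₀D`, 1 for nearest integers under `sₙD`, and 0 for the
-- other two combinations.
complement-pair : ∀ k x y {x′ y′} → y′ ≡ k - y → x′ ≡ k - x → ∃[ d ] y′ + x′ ≡ x + y + (d + d)
complement-pair k x y refl refl = k - x - y , lemma k x y
  where
  lemma : ∀ k x y → (k - y) + (k - x) ≡ x + y + ((k - x - y) + (k - x - y))
  lemma = solve-∀

swap-pair : ∀ x y → ∃[ d ] y + x ≡ x + y + (d + d)
swap-pair x y = 0ℤ , lemma x y
  where
  lemma : ∀ x y → y + x ≡ x + y + (0ℤ + 0ℤ)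
  lemma = solve-∀

module _ (n : ℕ) {w p : ℤ → ℤ} (inv : Inverses n w p) where

  floor-first : ∀ t → 2 ℕ.≤ n → FloorParity t n p → FloorParity t n (p ∘ first t n)
  floor-first C̃/C _ _ = tt
  floor-first B̃/D _ _ = tt
  floor-first B̃/B 2≤n = even-double inv (⌊_⌋ n) 0 2≤n (s₀D-double n 2≤n)
    (complement-pair (- 1ℤ) (quotient n p 1) (quotient n p 2) (⌊-p⌋ n inv 2 (s≤s z≤n) 2≤n)
        (⌊-p⌋ n inv 1 ℕ.≤-refl (ℕ.<⇒≤ 2≤n)))
  floor-first D̃/D 2≤n = floor-first B̃/B 2≤n

  round-first : ∀ t → 2 ℕ.≤ n → RoundParity t n p → RoundParity t n (p ∘ first t n)
  round-first C̃/C _ _ = tt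
  round-first B̃/B _ _ = tt
  round-first B̃/D 2≤n = even-single inv (⌊_⌉ n) 0 (ℕ.<⇒≤ 2≤n) (s₀C-single n (ℕ.<⇒≤ 2≤n))
      (round-neg n (p (+ 1)))
  round-first D̃/D 2≤n = even-double inv (⌊_⌉ n) 0 2≤n (s₀D-double n 2≤n)
    (complement-pair 0ℤ (⌊_⌉ n (p (+ 1))) (⌊_⌉ n (p (+ 2)))
        (trans (round-neg n (p (+ 2))) (sym (ℤ.+-identityˡ (- ⌊_⌉ n (p (+ 2))))))
      (trans (round-neg n (p (+ 1))) (sym (ℤ.+-identityˡ (- ⌊_⌉ n (p (+ 1)))))))

  floor-middle : ∀ t i → suc (suc i) ℕ.≤ n → FloorParity t n p → FloorParity t n (p ∘ s n (suc i))
  floor-middle C̃/C i _ _ = tt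
  floor-middle B̃/D i _ _ = tt
  floor-middle B̃/B i i<n = even-double inv (⌊_⌋ n) i i<n (s-double n (suc i) (s≤s z≤n) i<n)
      (swap-pair (quotient n p (suc i)) (quotient n p (suc (suc i))))
  floor-middle D̃/D i i<n = floor-middle B̃/B i i<n

  round-middle : ∀ t i → suc (suc i) ℕ.≤ n → RoundParity t n p → RoundParity t n (p ∘ s n (suc i))
  round-middle C̃/C i _ _ = tt
  round-middle B̃/B i _ _ = tt
  round-middle B̃/D i i<n = even-double inv (⌊_⌉ n) i i<n (s-double n (suc i) (s≤s z≤n) i<n)
      (swap-pair (⌊_⌉ n (p (+ suc i))) (⌊_⌉ n (p (+ suc (suc i)))))
  round-middle D̃/D i i<n = round-middle B̃/D i i<n

  floor-last : ∀ t i → suc (suc i) ≡ n → FloorParity t n p → FloorParity t n (p ∘ last t n)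
  floor-last C̃/C i _ _ = tt
  floor-last B̃/D i _ _ = tt
  floor-last B̃/B i refl = even-single inv (⌊_⌋ n) (suc i) ℕ.≤-refl (sₙC-single n (s≤s z≤n))
      (⌊M-p⌋ n inv n (s≤s z≤n) ℕ.≤-refl)
  floor-last D̃/D i refl = even-double inv (⌊_⌋ n) i ℕ.≤-refl (sₙD-double n (suc i) (s≤s z≤n) refl)
    (complement-pair 0ℤ (quotient n p (suc i)) (quotient n p n)
      (trans (⌊M-p⌋ n inv n (s≤s z≤n) ℕ.≤-refl) (sym (ℤ.+-identityˡ (- quotient n p n))))
      (trans (⌊M-p⌋ n inv (suc i) (s≤s z≤n) (ℕ.n≤1+n _)) (sym (ℤ.+-identityˡ (- quotient n p (suc i))))))

  round-last : ∀ t i → suc (suc i) ≡ n → RoundParity t n p → RoundParity t n (p ∘ last t n)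
  round-last C̃/C i _ _ = tt
  round-last B̃/B i _ _ = tt
  round-last B̃/D i refl = even-double inv (⌊_⌉ n) i ℕ.≤-refl (sₙD-double n (suc i) (s≤s z≤n) refl)
    (complement-pair 1ℤ (⌊_⌉ n (p (+ suc i))) (⌊_⌉ n (p (+ n))) (round-reflect n (p (+ n)))
        (round-reflect n (p (+ suc i))))
  round-last D̃/D i refl = round-last B̃/D i refl

  floor-generator : ∀ t → 2 ℕ.≤ n → ∀ k → FloorParity t n p → FloorParity t n (p ∘ generator t n k)
  floor-generator t 2≤n Fin.zero = floor-first t 2≤n
  floor-generator t 2≤n (Fin.suc k) with suc (toℕ k) ℕ.≟ n
  ... | no e = subst (λ g → FloorParity t n p → FloorParity t n (p ∘ g)) (sym (generator-middle n t k e))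
    (floor-middle t (toℕ k) (ℕ.≤∧≢⇒< (Fin.toℕ<n k) e))
  ... | yes e with ℕ.m≤n⇒∃[o]m+o≡n 2≤n
  ...   | i , e′ = subst (λ g → FloorParity t n p → FloorParity t n (p ∘ g)) (sym (generator-last n t k e))
      (floor-last t i e′)

  round-generator : ∀ t → 2 ℕ.≤ n → ∀ k → RoundParity t n p → RoundParity t n (p ∘ generator t n k)
  round-generator t 2≤n Fin.zero = round-first t 2≤n
  round-generator t 2≤n (Fin.suc k) with suc (toℕ k) ℕ.≟ n
  ... | no e = subst (λ g → RoundParity t n p → RoundParity t n (p ∘ g)) (sym (generator-middle n t k e))
    (round-middle t (toℕ k) (ℕ.≤∧≢⇒< (Fin.toℕ<n k) e))
  ... | yes e with ℕ.m≤n⇒∃[o]m+o≡n 2≤n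
  ...   | i , e′ = subst (λ g → RoundParity t n p → RoundParity t n (p ∘ g)) (sym (generator-last n t k e))
      (round-last t i e′)

-- The length of a minimal representative

module _ (t : Type) (n : ℕ) (minRank≤n : minRank t ℕ.≤ n) where

  private
    2≤n : 2 ℕ.≤ n
    2≤n = ℕ.≤-trans (2≤minRank t) minRank≤n

  floor-word : ∀ v {w p} → Inverses n w p → FloorParity t n p → FloorParity t n (p ∘ product t n v)
  floor-word []      inv h = h
  floor-word (k ∷ v) inv h =
    floor-word v (∘-inverses inv (generator-inverses t n 2≤n k)) (floor-generator n inv t 2≤n k h)

  round-word : ∀ v {w p} → Inverses n w p → RoundParity t n p → RoundParity t n (p ∘ product t n v)
  round-word []      inv h = h
  round-word (k ∷ v) inv h =
    round-word v (∘-inverses inv (generator-inverses t n 2≤n k)) (round-generator n inv t 2≤n k h)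

  -- The entries (-1, 0, ..., 0) have an odd sum.
  odd-start : ∀ {p} → e₀ t ≡ 0 → FloorParity t n p → quotient n p 1 ≡ -1ℤ →
              ¬ (∀ j → 2 ℕ.≤ j → j ℕ.≤ n → quotient n p j ≡ 0ℤ)
  odd-start {p} e₀≡0 f x₁≡-1 zeros with ℕ.m≤n⇒∃[o]m+o≡n 2≤n
  ... | i , refl = ¬even--1 (subst Even sum≡ (even t e₀≡0 f))
    where
    even : ∀ t → e₀ t ≡ 0 → FloorParity t n p → Even (floorSum n p)
    even B̃/B _ f = f
    even D̃/D _ f = f
    zero-sum : ∀ js → Σℤ (map (λ (_ : ℕ) → 0ℤ) js) ≡ 0ℤ
    zero-sum []       = refl
    zero-sum (_ ∷ js) = trans (ℤ.+-identityˡ _) (zero-sum js)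
    sum≡ : floorSum n p ≡ -1ℤ
    sum≡ = cong₂ _+_ x₁≡-1 (trans (cong Σℤ (map-range-cong 2 (suc i) λ j 2≤j j< → zeros j 2≤j
        (ℕ.≤-pred j<))) (zero-sum (range 2 (suc i))))
    ¬even--1 : ¬ Even -1ℤ
    ¬even--1 (c , e) = ¬even-1 (- c , trans (cong -_ e) (ℤ.neg-distrib-+ c c))

  private
    reflection : Fin n → ℤ → ℤ
    reflection k = generator t n (Fin.suc k)

  prod-reflection : ∀ v → prod reflection v ≡ product t n (map Fin.suc v)
  prod-reflection []      = refl
  prod-reflection (k ∷ v) = cong (reflection k ∘_) (prod-reflection v)

  reflections-box : ∀ v x → Box n x → Box n (prod reflection v x)
  reflections-box v x b with ℕ.m≤n⇒∃[o]m+o≡n 2≤n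
  ... | i , e = go v
    where
    go : ∀ v → Box n (prod reflection v x)
    go []      = b
    go (k ∷ v) = generator-box t i e k _ (go v)

  quotient-0⇒box : ∀ {w p} → Inverses n w p → ∀ j → 1 ℕ.≤ j → j ℕ.≤ n → quotient n p j ≡ 0ℤ → Box n (p (+ j))
  quotient-0⇒box {w} {p} inv j 1≤j j≤n e = subst (Box n)
    (sym (trans (div-rem n (p (+ j))) (trans (cong (λ q → rem n (p (+ j)) + q * N n) e) (ℤ.+-identityʳ _))))
    (rem-nonzero inv j 1≤j j≤n , rem<M n (p (+ j)))

  sorted⇒identity : ∀ {w p} → Inverses n w p → RoundParity t n p →
    (∀ j → 1 ℕ.≤ j → j ℕ.≤ n → Box n (p (+ j))) → ∀ v →
    (∀ k → ¬ (spreadOf n (p ∘ prod reflection v ∘ reflection k) ℕ.< spreadOf n (p ∘ prod reflection v))) →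
    p ∘ prod reflection v ≗ id
  sorted⇒identity {w} {p} inv r box v none with ℕ.m≤n⇒∃[o]m+o≡n 2≤n
    | prod-inverses reflection (λ k → generator-inverses t n 2≤n (Fin.suc k)) v
  ... | i , refl | _ , word = agree (p-mirrored inv′) id-mirrored (identity t i inv′
      (λ j 1≤j j≤n → box-preserved (p-mirrored inv) box _ (reflections-box v (+ j) (+-box j 1≤j j≤n))) none
      (subst (λ g → RoundParity t n (p ∘ g)) (sym (prod-reflection v)) (round-word (map Fin.suc v) inv r)))
    where
    inv′ = ∘-inverses inv word

  -- Once q = 0, lowering `spread` by generators of W ends at the identity, and the letters used
  -- spell the inverse of `p`.
  bottom-∈W : ∀ {w p} (inv : Inverses n w p) → FloorParity t n p → RoundParity t n p → NoDescent n inv t →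
              ∃[ v ] p ∘ prod reflection v ≗ id
  bottom-∈W {w} {p} inv f r nd = sort (bottom n inv t minRank≤n nd) (greedy reflection (spreadOf n) p)
    where
    sort : (∀ j → 2 ℕ.≤ j → j ℕ.≤ n → quotient n p j ≡ 0ℤ) ×
        (quotient n p 1 ≡ 0ℤ ⊎ (e₀ t ≡ 0 × quotient n p 1 ≡ -1ℤ)) →
      (∃[ v ] length v ℕ.+ spreadOf n (p ∘ prod reflection v) ℕ.≤ spreadOf n p ×
              (∀ k → ¬ (spreadOf n (p ∘ prod reflection v ∘ reflection k) ℕ.< spreadOf n
                  (p ∘ prod reflection v)))) →
      ∃[ v ] p ∘ prod reflection v ≗ id
    sort (zeros , start) (v , _ , none) = v , sorted⇒identity inv r box v none
      where
      x₁≡0 : quotient n p 1 ≡ 0ℤ ⊎ (e₀ t ≡ 0 × quotient n p 1 ≡ -1ℤ) → quotient n p 1 ≡ 0ℤ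
      x₁≡0 (inj₁ e)        = e
      x₁≡0 (inj₂ (e , e′)) = ⊥-elim (odd-start e f e′ zeros)
      box : ∀ j → 1 ℕ.≤ j → j ℕ.≤ n → Box n (p (+ j))
      box (suc zero)    1≤j j≤n = quotient-0⇒box inv 1 1≤j j≤n (x₁≡0 start)
      box (suc (suc j)) 1≤j j≤n = quotient-0⇒box inv (suc (suc j)) 1≤j j≤n
          (zeros (suc (suc j)) (s≤s (s≤s z≤n)) j≤n)

  product-++ : ∀ v v′ i → product t n (v ++ v′) i ≡ product t n v (product t n v′ i)
  product-++ []      v′ i = refl
  product-++ (k ∷ v) v′ i = cong (generator t n k) (product-++ v v′ i)

  HasLength-resp : ∀ {f g l} → f ≗ g → HasLength t n f l → HasLength t n g l
  HasLength-resp f≗g ((u , u≗f , e) , least) =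
    (u , (λ i → trans (u≗f i) (f≗g i)) , e) , λ u′ u′≗g → least u′ (λ i → trans (u′≗g i) (sym (f≗g i)))

  -- The last hypothesis says w = v v′. Right multiplication by the inverse `u` of v′ turns w into
  -- v, so minimality bounds the length of w by that of v, hence by `ℓ`; the opposite bound holds
  -- for every word.
  factored-length : ∀ {w p} → Inverses n w p →
    (∀ u → InW t n u → ∀ l m → HasLength t n w l → HasLength t n (w ∘ u) m → l ℕ.≤ m) →
    ∀ v v′ → length v ℕ.≤ ℓ n t p → p ∘ product t n v ∘ prod reflection v′ ≗ id →
    HasLength t n w (ℓ n t p)
  factored-length {w} {p} inv minimal v v′ v≤ℓ h
    with has-length t n 2≤n (v ++ map Fin.suc v′) | has-length t n 2≤n v
       | prod-inverses reflection (λ k → generator-inverses t n 2≤n (Fin.suc k)) v′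
  ... | l , whole-length , _ | m , v-length , m≤ | u , u-inverse =
    subst (HasLength t n w) (ℕ.≤-antisym l≤ (≤l w-length)) w-length
    where
    split : ∀ i → product t n (v ++ map Fin.suc v′) i ≡ product t n v (prod reflection v′ i)
    split i = trans (product-++ v (map Fin.suc v′) i)
        (cong (λ g → product t n v (g i)) (sym (prod-reflection v′)))
    whole≗w : product t n (v ++ map Fin.suc v′) ≗ w
    whole≗w i = trans (split i) (trans (sym (w∘p inv _)) (cong w (h i)))
    w-length : HasLength t n w l
    w-length = HasLength-resp whole≗w whole-length
    ≤l : HasLength t n w l → ℓ n t p ℕ.≤ l
    ≤l ((u , u≗w , e) , _) = subst (ℓ n t p ℕ.≤_) e (lower-bound t n 2≤n inv u u≗w)
    v≗w∘u : product t n v ≗ w ∘ prod reflection u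
    v≗w∘u i = begin
      product t n v i ≡⟨ cong (product t n v) (p∘w u-inverse i) ⟨
      product t n v (prod reflection v′ (prod reflection u i)) ≡⟨ split _ ⟨
      product t n (v ++ map Fin.suc v′) (prod reflection u i) ≡⟨ whole≗w _ ⟩
      w (prod reflection u i) ∎
      where open ≡-Reasoning
    l≤ : l ℕ.≤ ℓ n t p
    l≤ = ℕ.≤-trans (minimal (prod reflection u) (u , λ i → cong (λ g → g i) (sym (prod-reflection u)))
                     l m w-length (HasLength-resp v≗w∘u v-length))
      (ℕ.≤-trans m≤ v≤ℓ)

  minimal-length : ∀ {w p} → Inverses n w p → FloorParity t n p → RoundParity t n p →
    (∀ u → InW t n u → ∀ l m → HasLength t n w l → HasLength t n (w ∘ u) m → l ℕ.≤ m) →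
    HasLength t n w (ℓ n t p)
  minimal-length {w} {p} inv f r minimal = go (greedy (generator t n) (ℓ n t) p)
    where
    go : (∃[ v ] length v ℕ.+ ℓ n t (p ∘ product t n v) ℕ.≤ ℓ n t p ×
                 (∀ k → ¬ (ℓ n t (p ∘ product t n v ∘ generator t n k) ℕ.< ℓ n t (p ∘ product t n v)))) →
         HasLength t n w (ℓ n t p)
    go (v , v≤ , none) = factor (bottom-∈W (∘-inverses inv (proj₂ (word-inverses t n 2≤n v)))
        (floor-word v inv f) (round-word v inv r) none)
      where
      factor : (∃[ v′ ] p ∘ product t n v ∘ prod reflection v′ ≗ id) → HasLength t n w (ℓ n t p)
      factor (v′ , h) = factored-length inv minimal v v′ (ℕ.≤-trans (ℕ.m≤m+n _ _) v≤) h

-- Counting by residue classes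

-- The lists in the theorem are arbitrary enumerations; this lets each be replaced by one that is
-- written down explicitly.
enumerations-↭ : ∀ {P xs ys} → Enumerates xs P → Enumerates ys P → xs ↭ ys
enumerations-↭ (xs! , xs⇔) (ys! , ys⇔) = ∼bag⇒↭ (unique∧set⇒bag xs! ys! λ {e} →
  mk⇔ (Equivalence.from (ys⇔ e) ∘ Equivalence.to (xs⇔ e)) (Equivalence.from (xs⇔ e) ∘ Equivalence.to (ys⇔ e)))

Σℤ-↭ : ∀ (h : ℤ → ℤ) {xs ys} → xs ↭ ys → Σℤ (map h xs) ≡ Σℤ (map h ys)
Σℤ-↭ h ↭.refl         = refl
Σℤ-↭ h (↭.prep x p)   = cong (λ z → h x + z) (Σℤ-↭ h p)
Σℤ-↭ h (↭.swap x y p) = trans (cong (λ z → h x + (h y + z)) (Σℤ-↭ h p)) (lemma (h x) (h y) _)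
  where
  lemma : ∀ a b c → a + (b + c) ≡ b + (a + c)
  lemma = solve-∀
Σℤ-↭ h (↭.trans p q)  = trans (Σℤ-↭ h p) (Σℤ-↭ h q)

interval : ℤ → ℕ → List ℤ
interval a l = map (λ i → a + + i) (upTo l)

infix 4 _∈[_,+_⟩
_∈[_,+_⟩ : ℤ → ℤ → ℕ → Set
t ∈[ a ,+ l ⟩ = a ≤ t × 1ℤ + t ≤ a + + l

interval! : ∀ a l → Unique (interval a l)
interval! a l = Unique.map⁺ (λ {i} {j} e → ℤ.+-injective
    (trans (undo a (+ i)) (trans (cong (_- a) e) (sym (undo a (+ j)))))) (Unique.upTo⁺ l)
  where
  undo : ∀ a i → i ≡ a + i - a
  undo = solve-∀

∈-interval⁻ : ∀ {t a l} → t ∈ interval a l → t ∈[ a ,+ l ⟩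
∈-interval⁻ {t} {a} {l} t∈ with ∈-map⁻ (λ i → a + + i) t∈
... | i , i∈ , refl = linear₁ (+≤+ {0} {i} z≤n) (lemma a (+ i)) ,
  linear₁ (+≤+ (∈-upTo⁻ i∈)) (lemma′ a (+ i) (+ l))
  where
  lemma : ∀ a i → i - 0ℤ ≡ a + i - a
  lemma = solve-∀
  lemma′ : ∀ a i l → l - (1ℤ + i) ≡ a + l - (1ℤ + (a + i))
  lemma′ = solve-∀

∈-interval⁺ : ∀ {t a l} → t ∈[ a ,+ l ⟩ → t ∈ interval a l
∈-interval⁺ {t} {a} {l} (a≤t , t<) with t - a in e | ℤ.i≤j⇒0≤j-i a≤t
... | + i | _ = subst (_∈ interval a l) (trans (cong (λ z → a + z) (sym e)) (lemma a t))
  (∈-map⁺ (λ i → a + + i) (∈-upTo⁺ (ℤ.drop‿+≤+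
      (linear₁ t< (trans (lemma′ a t (+ l)) (cong (λ z → + l - (1ℤ + z)) e))))))
  where
  lemma : ∀ a t → a + (t - a) ≡ t
  lemma = solve-∀
  lemma′ : ∀ a t l → a + l - (1ℤ + t) ≡ l - (1ℤ + (t - a))
  lemma′ = solve-∀

-- Class k unites the runners k and N - k. The parity counts take ρ k = k; for the abacus the sign
-- is chosen so that B(k) lies on the runner of ρ k.
module Classes (n : ℕ) (ρ : ℕ → ℤ) (±ρ : ∀ k → ρ k ≡ + k ⊎ ρ k ≡ - + k) where

  rem-+ : ∀ k t → k ℕ.≤ n → rem n (+ k + t * N n) ≡ + k
  rem-+ k t k≤n = rem-unique {n} {_} {t} (+ k) (+≤+ z≤n) (+≤n⇒<M {n} k≤n) refl

  rem-- : ∀ k t → 1 ℕ.≤ k → k ℕ.≤ n → rem n (- + k + t * N n) ≡ N n - + k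
  rem-- k t 1≤k k≤n = rem-unique {n} {_} {t - 1ℤ} (N n - + k)
    (ℤ.i≤j⇒0≤j-i (ℤ.≤-trans (ℤ.i≤suc[i] (+ k)) (+≤n⇒<M {n} k≤n)))
    (linear₁ (+≤+ 1≤k) (lemma (+ k) (N n)))
    (lemma′ (+ k) t (N n))
    where
    lemma : ∀ k m → k - 1ℤ ≡ m - (1ℤ + (m - k))
    lemma = solve-∀
    lemma′ : ∀ k t m → - k + t * m ≡ m - k + (t - 1ℤ) * m
    lemma′ = solve-∀

  Class : ℕ → ℤ → Set
  Class k e = ∃[ t ] (e ≡ ρ k + t * N n ⊎ e ≡ - ρ k + t * N n)

  class-rem : ∀ {k e} → 1 ℕ.≤ k → k ℕ.≤ n → Class k e → rem n e ≡ + k ⊎ rem n e ≡ N n - + k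
  class-rem {k} 1≤k k≤n (t , inj₁ refl) with ρ k | ±ρ k
  ... | _ | inj₁ refl = inj₁ (rem-+ k t k≤n)
  ... | _ | inj₂ refl = inj₂ (rem-- k t 1≤k k≤n)
  class-rem {k} 1≤k k≤n (t , inj₂ refl) with ρ k | ±ρ k
  ... | _ | inj₁ refl = inj₂ (rem-- k t 1≤k k≤n)
  ... | _ | inj₂ refl = inj₁ (subst (λ z → rem n (z + t * N n) ≡ + k) (sym (ℤ.neg-involutive (+ k)))
      (rem-+ k t k≤n))

  small≢large : ∀ {j k} → j ℕ.≤ n → k ℕ.≤ n → + j ≢ N n - + k
  small≢large {j} {k} j≤n k≤n e = <-irrefl-by {+ n + + n} {N n} (ℤ.≤-reflexive (sym (M≡ n)))
    (linear₂ (+≤+ j≤n) (+≤+ k≤n) (trans (lemma (+ j) (+ k) (+ n))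
        (cong (λ z → + n + + n - z) (trans (cong (_+ + k) e) (lemma′ (N n) (+ k))))))
    where
    lemma : ∀ j k n → n - j + (n - k) ≡ n + n - (j + k)
    lemma = solve-∀
    lemma′ : ∀ m k → m - k + k ≡ m
    lemma′ = solve-∀

  class-unique : ∀ {j k e} → 1 ℕ.≤ j → j ℕ.≤ n → 1 ℕ.≤ k → k ℕ.≤ n → Class j e → Class k e → j ≡ k
  class-unique {j} {k} 1≤j j≤n 1≤k k≤n cj ck with class-rem 1≤j j≤n cj | class-rem 1≤k k≤n ck
  ... | inj₁ a | inj₁ b = ℤ.+-injective (trans (sym a) b)
  ... | inj₁ a | inj₂ b = ⊥-elim (small≢large j≤n k≤n (trans (sym a) b))
  ... | inj₂ a | inj₁ b = ⊥-elim (small≢large k≤n j≤n (trans (sym b) a))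
  ... | inj₂ a | inj₂ b = ℤ.+-injective (trans (undo (N n) (+ j))
      (trans (cong (λ z → N n - z) (trans (sym a) b)) (sym (undo (N n) (+ k)))))
    where
    undo : ∀ m j → j ≡ m - (m - j)
    undo = solve-∀

  ±⇒class : ∀ k t {e} → e ≡ + k + t * N n ⊎ e ≡ - + k + t * N n → Class k e
  ±⇒class k t h with ρ k | ±ρ k | h
  ... | _ | inj₁ refl | h = t , h
  ... | _ | inj₂ refl | inj₁ h = t , inj₂ (trans h (cong (_+ t * N n) (sym (ℤ.neg-involutive (+ k)))))
  ... | _ | inj₂ refl | inj₂ h = t , inj₁ h

  class⇒± : ∀ k t {e} → e ≡ ρ k + t * N n ⊎ e ≡ - ρ k + t * N n → e ≡ + k + t * N n ⊎ e ≡ - + k + t * N n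
  class⇒± k t h with ρ k | ±ρ k | h
  ... | _ | inj₁ refl | h = h
  ... | _ | inj₂ refl | inj₁ h = inj₂ h
  ... | _ | inj₂ refl | inj₂ h = inj₁ (trans h (cong (_+ t * N n) (ℤ.neg-involutive (+ k))))

  entry-class : ∀ e → Entry n e → ∃[ k ] 1 ℕ.≤ k × k ℕ.≤ n × Class k e
  entry-class e entry = go (e %ℕ suc (2 ℕ.* n)) (ℕ.≤-pred (n%ℕd<d e (suc (2 ℕ.* n)))) (div-rem n e)
    where
    q = ⌊_⌋ n e
    go : ∀ r → r ℕ.≤ 2 ℕ.* n → e ≡ + r + q * N n → ∃[ k ] 1 ℕ.≤ k × k ℕ.≤ n × Class k e
    go zero r≤ h = ⊥-elim (entry (Signed.∣⇒∣ᵤ (Signed.divides q (trans h (ℤ.+-identityˡ _)))))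
    go (suc r) r≤ h with suc r ℕ.≤? n
    ... | yes r≤n = suc r , s≤s z≤n , r≤n , ±⇒class (suc r) q (inj₁ h)
    ... | no r≰n with N-+ {n} (ℕ.≰⇒> r≰n) r≤
    ...   | j , 1≤j , j≤n , e′ = j , 1≤j , j≤n , ±⇒class j (1ℤ + q)
      (inj₂ (trans h (trans (cong (_+ q * N n) (sym e′)) (lemma (N n) (+ j) q))))
      where
      lemma : ∀ m j q → m - j + q * m ≡ - j + (1ℤ + q) * m
      lemma = solve-∀

  class-entry : ∀ {k e} → 1 ℕ.≤ k → k ℕ.≤ n → Class k e → Entry n e
  class-entry {k} {e} 1≤k k≤n c M∣e with Signed.∣ᵤ⇒∣ {N n} {e} M∣e
  ... | Signed.divides q h = impossible (class-rem 1≤k k≤n c)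
    where
    rem-0 : rem n e ≡ 0ℤ
    rem-0 = rem-unique {n} {e} {q} 0ℤ (+≤+ z≤n) (+≤+ (s≤s z≤n)) (trans h (sym (ℤ.+-identityˡ _)))
    impossible : rem n e ≡ + k ⊎ rem n e ≡ N n - + k → ⊥
    impossible (inj₁ h) = ℕ.<⇒≢ 1≤k (ℤ.+-injective (trans (sym rem-0) h))
    impossible (inj₂ h) = small≢large {0} z≤n k≤n (trans (sym rem-0) h)

  opposite : ∀ {k t t′} → 1 ℕ.≤ k → k ℕ.≤ n → ρ k + t * N n ≢ - ρ k + t′ * N n
  opposite {k} {t} {t′} 1≤k k≤n h with ρ k | ±ρ k
  ... | _ | inj₁ refl = small≢large k≤n k≤n (trans (sym (rem-+ k t k≤n))
      (trans (cong (rem n) h) (rem-- k t′ 1≤k k≤n)))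
  ... | _ | inj₂ refl = small≢large k≤n k≤n (trans (sym (rem-+ k t′ k≤n)) (trans (cong (rem n)
    (trans (cong (_+ t′ * N n) (sym (ℤ.neg-involutive (+ k)))) (sym h))) (rem-- k t 1≤k k≤n)))

  same-level : ∀ x {t t′} → x + t * N n ≡ x + t′ * N n → t ≡ t′
  same-level x {t} {t′} h = ℤ.*-cancelʳ-≡ t t′ (N n)
      (trans (undo x (t * N n)) (trans (cong (_- x) h) (sym (undo x (t′ * N n)))))
    where
    undo : ∀ x i → i ≡ x + i - x
    undo = solve-∀

  -- The elements of P listed class by class: e = ± ρ k + t N is indexed by
  -- its level t.
  module Count (P : Pred ℤ 0ℓ) (a a′ : ℕ → ℤ) (l l′ : ℕ → ℕ)
    (P-entry : ∀ e → P e → Entry n e)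
    (P⁺ : ∀ k → 1 ℕ.≤ k → k ℕ.≤ n → ∀ t → P (ρ k + t * N n) ⇔ t ∈[ a k ,+ l k ⟩)
    (P⁻ : ∀ k → 1 ℕ.≤ k → k ℕ.≤ n → ∀ t → P (- ρ k + t * N n) ⇔ t ∈[ a′ k ,+ l′ k ⟩)
    where

    classList : ℕ → List ℤ
    classList k = map (λ t → ρ k + t * N n) (interval (a k) (l k)) ++ map (λ t → - ρ k + t * N n)
        (interval (a′ k) (l′ k))

    classLists : ℕ → ℕ → List ℤ
    classLists k zero    = []
    classLists k (suc m) = classList k ++ classLists (suc k) m

    ∈-classList⁻ : ∀ k {e} → e ∈ classList k →
      (∃[ t ] t ∈ interval (a k) (l k) × e ≡ ρ k + t * N n) ⊎
          (∃[ t ] t ∈ interval (a′ k) (l′ k) × e ≡ - ρ k + t * N n)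
    ∈-classList⁻ k e∈ with ∈-++⁻ (map (λ t → ρ k + t * N n) (interval (a k) (l k))) e∈
    ... | inj₁ h = inj₁ (∈-map⁻ _ h)
    ... | inj₂ h = inj₂ (∈-map⁻ _ h)

    classList-class : ∀ k {e} → e ∈ classList k → Class k e
    classList-class k e∈ with ∈-classList⁻ k e∈
    ... | inj₁ (t , _ , h) = t , inj₁ h
    ... | inj₂ (t , _ , h) = t , inj₂ h

    classList! : ∀ k → 1 ℕ.≤ k → k ℕ.≤ n → Unique (classList k)
    classList! k 1≤k k≤n = Unique.++⁺
      (Unique.map⁺ (same-level (ρ k)) (interval! (a k) (l k)))
      (Unique.map⁺ (same-level (- ρ k)) (interval! (a′ k) (l′ k)))
      λ { (e∈ , e∈′) → disjoint (∈-map⁻ _ e∈) (∈-map⁻ _ e∈′) }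
      where
      disjoint : ∀ {e} → (∃[ t ] t ∈ interval (a k) (l k) × e ≡ ρ k + t * N n) →
                 (∃[ t ] t ∈ interval (a′ k) (l′ k) × e ≡ - ρ k + t * N n) → ⊥
      disjoint (t , _ , h) (t′ , _ , h′) = opposite {k} {t} {t′} 1≤k k≤n (trans (sym h) h′)

    ∈-classLists⁻ : ∀ k m {e} → e ∈ classLists k m → ∃[ j ] k ℕ.≤ j × j ℕ.< k ℕ.+ m × e ∈ classList j
    ∈-classLists⁻ k (suc m) e∈ with ∈-++⁻ (classList k) e∈
    ... | inj₁ h = k , ℕ.≤-refl , ℕ.m<m+n k (s≤s z≤n) , h
    ... | inj₂ h with ∈-classLists⁻ (suc k) m h
    ...   | j , k<j , j< , h′ = j , ℕ.<⇒≤ k<j , subst (j ℕ.<_) (sym (ℕ.+-suc k m)) j< , h′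

    ∈-classLists⁺ : ∀ k m {e} j → k ℕ.≤ j → j ℕ.< k ℕ.+ m → e ∈ classList j → e ∈ classLists k m
    ∈-classLists⁺ k zero    j k≤j j< e∈ = ⊥-elim (ℕ.<⇒≱ j< (subst (ℕ._≤ j) (sym (ℕ.+-identityʳ k)) k≤j))
    ∈-classLists⁺ k (suc m) j k≤j j< e∈ with k ℕ.≟ j
    ... | yes refl = ∈-++⁺ˡ e∈
    ... | no k≢j = ∈-++⁺ʳ (classList k) (∈-classLists⁺ (suc k) m j (ℕ.≤∧≢⇒< k≤j k≢j)
        (subst (j ℕ.<_) (ℕ.+-suc k m) j<) e∈)

    classLists! : ∀ k m → 1 ℕ.≤ k → k ℕ.+ m ℕ.≤ suc n → Unique (classLists k m)
    classLists! k zero    1≤k k+m≤ = []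
    classLists! k (suc m) 1≤k k+m≤ = Unique.++⁺ (classList! k 1≤k k≤n)
        (classLists! (suc k) m (s≤s z≤n) 1+k+m≤)
      λ { (e∈ , e∈′) → disjoint e∈ (∈-classLists⁻ (suc k) m e∈′) }
      where
      1+k+m≤ : suc k ℕ.+ m ℕ.≤ suc n
      1+k+m≤ = subst (ℕ._≤ suc n) (ℕ.+-suc k m) k+m≤
      k≤n : k ℕ.≤ n
      k≤n = ℕ.≤-trans (ℕ.m≤m+n k m) (ℕ.≤-pred 1+k+m≤)
      disjoint : ∀ {e} → e ∈ classList k → ¬ (∃[ j ] suc k ℕ.≤ j × j ℕ.< suc k ℕ.+ m × e ∈ classList j)
      disjoint e∈ (j , k<j , j< , e∈′) = ℕ.<⇒≢ k<j (class-unique 1≤k k≤n (ℕ.≤-trans (s≤s z≤n) k<j)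
        (ℕ.≤-pred (ℕ.≤-trans j< 1+k+m≤)) (classList-class k e∈) (classList-class j e∈′))

    enumerates : Enumerates (classLists 1 n) P
    enumerates = classLists! 1 n ℕ.≤-refl ℕ.≤-refl , λ e → mk⇔ (to e ∘ ∈-classLists⁻ 1 n) (from e)
      where
      to : ∀ e → (∃[ k ] 1 ℕ.≤ k × k ℕ.< 1 ℕ.+ n × e ∈ classList k) → P e
      to e (k , 1≤k , k< , e∈) with ∈-classList⁻ k e∈
      ... | inj₁ (t , t∈ , refl) = Equivalence.from (P⁺ k 1≤k (ℕ.≤-pred k<) t) (∈-interval⁻ t∈)
      ... | inj₂ (t , t∈ , refl) = Equivalence.from (P⁻ k 1≤k (ℕ.≤-pred k<) t) (∈-interval⁻ t∈)
      from : ∀ e → P e → e ∈ classLists 1 n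
      from e Pe with entry-class e (P-entry e Pe)
      ... | k , 1≤k , k≤n , t , inj₁ refl = ∈-classLists⁺ 1 n k 1≤k (s≤s k≤n)
        (∈-++⁺ˡ (∈-map⁺ _ (∈-interval⁺ (Equivalence.to (P⁺ k 1≤k k≤n t) Pe))))
      ... | k , 1≤k , k≤n , t , inj₂ refl = ∈-classLists⁺ 1 n k 1≤k (s≤s k≤n)
        (∈-++⁺ʳ _ (∈-map⁺ _ (∈-interval⁺ (Equivalence.to (P⁻ k 1≤k k≤n t) Pe))))

    length-interval : ∀ a l → length (interval a l) ≡ l
    length-interval a l = trans (List.length-map _ (upTo l)) (List.length-upTo l)

    count : ∀ {xs} → Enumerates xs P → length xs ≡ sum (map (λ k → l k ℕ.+ l′ k) (range 1 n))
    count exs = trans (↭-length (enumerations-↭ exs enumerates)) (go 1 n)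
      where
      go : ∀ k m → length (classLists k m) ≡ sum (map (λ k → l k ℕ.+ l′ k) (range k m))
      go k zero    = refl
      go k (suc m) = trans (List.length-++ (classList k)) (cong₂ ℕ._+_
        (trans (List.length-++ (map (λ t → ρ k + t * N n) (interval (a k) (l k))))
          (cong₂ ℕ._+_ (trans (List.length-map _ (interval (a k) (l k))) (length-interval (a k) (l k)))
                       (trans (List.length-map _ (interval (a′ k) (l′ k))) (length-interval (a′ k) (l′ k)))))
        (go (suc k) m))

    total : ∀ (h : ℤ → ℤ) {xs} → Enumerates xs P → Σℤ (map h xs) ≡ Σℤ
        (map (λ k → Σℤ (map h (classList k))) (range 1 n))
    total h exs = trans (Σℤ-↭ h (enumerations-↭ exs enumerates)) (go 1 n)
      where
      go : ∀ k m → Σℤ (map h (classLists k m)) ≡ Σℤ (map (λ k → Σℤ (map h (classList k))) (range k m))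
      go k zero    = refl
      go k (suc m) = trans (cong Σℤ (List.map-++ h (classList k) _)) (trans (Σℤ-++ (map h (classList k)) _)
        (cong (λ z → Σℤ (map h (classList k)) + z) (go (suc k) m)))

map-enumerates : ∀ {n w p xs} {Q : Pred ℤ 0ℓ} → Inverses n w p → Enumerates xs Q → Enumerates (map w xs)
    (Q ∘ p)
map-enumerates {w = w} {p} {xs} {Q} inv (xs! , xs⇔) =
  Unique.map⁺ (λ {i} {j} h → trans (sym (p∘w inv i)) (trans (cong p h) (p∘w inv j))) xs! ,
  λ e → mk⇔ (λ e∈ → to e (∈-map⁻ w e∈)) λ q → subst (_∈ map w xs) (w∘p inv e)
      (∈-map⁺ w (Equivalence.from (xs⇔ (p e)) q))
  where
  to : ∀ e → (∃[ i ] i ∈ xs × e ≡ w i) → Q (p e)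
  to e (i , i∈ , refl) = subst Q (sym (p∘w inv i)) (Equivalence.to (xs⇔ i) i∈)

pos : ℤ → ℕ
pos (+ z)    = z
pos -[1+ _ ] = 0

-- Both sides are the absolute value of z; the right one shows that it has the parity of z.
pos-pos : ∀ z → + (pos (- z) ℕ.+ pos z) ≡ z + (+ pos (- z) + + pos (- z))
pos-pos (+ zero)  = refl
pos-pos (+ suc z) = cong +_ (sym (ℕ.+-identityʳ (suc z)))
pos-pos -[1+ z ]  = trans (cong (λ m → + suc m) (ℕ.+-identityʳ z)) (lemma (+ z))
  where
  lemma : ∀ z → 1ℤ + z ≡ - (1ℤ + z) + (1ℤ + z + (1ℤ + z))
  lemma = solve-∀

≤pos : ∀ {x} z → 1ℤ ≤ x → x ≤ z ⇔ x ≤ + pos z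
≤pos (+ z)    1≤x = mk⇔ id id
≤pos -[1+ z ] 1≤x = mk⇔ (λ h → ⊥-elim (absurd (ℤ.≤-trans 1≤x h))) (λ h → ⊥-elim (absurd′ (ℤ.≤-trans 1≤x h)))
  where
  absurd : ¬ (1ℤ ≤ -[1+ z ])
  absurd ()
  absurd′ : ¬ (1ℤ ≤ 0ℤ)
  absurd′ (+≤+ ())

interval-pos : ∀ {t} a z → (t ≤ a - 1ℤ + z × a ≤ t) ⇔ t ∈[ a ,+ pos z ⟩
interval-pos {t} a z = mk⇔
  (λ { (h , a≤t) → a≤t , linear₁ (Equivalence.to (≤pos z (1≤ a≤t)) (linear₁ h (lemma₁ t a z)))
      (lemma₂ t a (+ pos z)) })
  (λ { (a≤t , h) → linear₁ (Equivalence.from (≤pos z (1≤ a≤t)) (linear₁ h (lemma₃ t a (+ pos z))))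
      (lemma₄ t a z) , a≤t })
  where
  1≤ : a ≤ t → 1ℤ ≤ 1ℤ + t - a
  1≤ a≤t = linear₁ a≤t (lemma t a)
    where
    lemma : ∀ t a → t - a ≡ 1ℤ + t - a - 1ℤ
    lemma = solve-∀
  lemma₁ : ∀ t a z → a - 1ℤ + z - t ≡ z - (1ℤ + t - a)
  lemma₁ = solve-∀
  lemma₂ : ∀ t a p → p - (1ℤ + t - a) ≡ a + p - (1ℤ + t)
  lemma₂ = solve-∀
  lemma₃ : ∀ t a p → a + p - (1ℤ + t) ≡ p - (1ℤ + t - a)
  lemma₃ = solve-∀
  lemma₄ : ∀ t a z → z - (1ℤ + t - a) ≡ a - 1ℤ + z - t
  lemma₄ = solve-∀

infixl 20 _⨾_
_⨾_ : ∀ {A B C : Set} → A ⇔ B → B ⇔ C → A ⇔ C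
f ⨾ g = g ⇔-∘ f

subst-⇔ : ∀ {A : Set} (P : A → Set) {x y} → x ≡ y → P x ⇔ P y
subst-⇔ P e = mk⇔ (subst P e) (subst P (sym e))

move : ∀ {a b c d} → b - a ≡ d - c → a ≤ b ⇔ c ≤ d
move {a} {b} {c} {d} e = mk⇔ (λ h → linear₁ h e) (λ h → linear₁ h (sym e))

sum-even : ∀ (y : ℕ → ℤ) js → 2 ℕ.∣ sum (map (λ k → pos (- y k) ℕ.+ pos (y k)) js) → Even (Σℤ (map y js))
sum-even y js (ℕ.divides c h) = + c - σ , (begin
    Σℤ (map y js) ≡⟨ lemma (Σℤ (map y js)) σ ⟩
    Σℤ (map y js) + (σ + σ) - (σ + σ) ≡⟨ cong (_- (σ + σ)) (go js) ⟨
    + sum (map (λ k → pos (- y k) ℕ.+ pos (y k)) js) - (σ + σ) ≡⟨ cong (λ m → + m - (σ + σ)) h ⟩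
    + (c ℕ.* 2) - (σ + σ) ≡⟨ cong (λ m → + m - (σ + σ))
        (trans (ℕ.*-comm c 2) (cong (c ℕ.+_) (ℕ.+-identityʳ c))) ⟩
    + c + + c - (σ + σ) ≡⟨ lemma′ (+ c) σ ⟩
    (+ c - σ) + (+ c - σ) ∎)
  where
  open ≡-Reasoning
  σ = Σℤ (map (λ k → + pos (- y k)) js)
  lemma : ∀ s σ → s ≡ s + (σ + σ) - (σ + σ)
  lemma = solve-∀
  lemma′ : ∀ c σ → c + c - (σ + σ) ≡ (c - σ) + (c - σ)
  lemma′ = solve-∀
  go : ∀ js → let σ = Σℤ (map (λ k → + pos (- y k)) js) in
       + sum (map (λ k → pos (- y k) ℕ.+ pos (y k)) js) ≡ Σℤ (map y js) + (σ + σ)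
  go []       = refl
  go (j ∷ js) = trans (cong₂ _+_ (pos-pos (y j)) (go js))
    (lemma″ (y j) (+ pos (- y j)) (Σℤ (map y js)) (Σℤ (map (λ k → + pos (- y k)) js)))
    where
    lemma″ : ∀ y p s σ → y + (p + p) + (s + (σ + σ)) ≡ y + s + (p + σ + (p + σ))
    lemma″ = solve-∀

module _ (n : ℕ) {w p : ℤ → ℤ} (inv : Inverses n w p) where

  private
    mp = p-mirrored inv

  module _ (c a : ℤ) (y : ℕ → ℤ)
    (below⁺ : ∀ k → 1 ℕ.≤ k → k ℕ.≤ n → ∀ t → p (+ k) + t * N n ≤ c ⇔ t ≤ a - 1ℤ + - y k)
    (below⁻ : ∀ k → 1 ℕ.≤ k → k ℕ.≤ n → ∀ t → - p (+ k) + t * N n ≤ c ⇔ t ≤ 1ℤ - 1ℤ + y k)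
    (above⁺ : ∀ k → 1 ℕ.≤ k → k ℕ.≤ n → ∀ t → 1ℤ + c ≤ + k + t * N n ⇔ a ≤ t)
    (above⁻ : ∀ k → 1 ℕ.≤ k → k ℕ.≤ n → ∀ t → 1ℤ + c ≤ - + k + t * N n ⇔ 1ℤ ≤ t)
    where

    open Classes n +_ (λ _ → inj₁ refl)

    -- The values e = w i that cross c are counted by class. The runner of k contributes
    -- `pos (- y k)` and that of - k contributes `pos (y k)`, together |y k|, which has the parity
    -- of y k.
    crossing-even : EvenCardinality (λ i → i ≤ c × 1ℤ + c ≤ w i) → Even (Σℤ (map y (range 1 n)))
    crossing-even (xs , exs , 2∣) = sum-even y (range 1 n) (subst (2 ℕ.∣_)
      (trans (sym (List.length-map w xs)) (count (map-enumerates inv exs))) 2∣)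
      where
      P : Pred ℤ 0ℓ
      P e = p e ≤ c × 1ℤ + c ≤ w (p e)
      P-entry : ∀ e → P e → Entry n e
      P-entry e (h , h′) M∣e with Signed.∣ᵤ⇒∣ {N n} {e} M∣e
      -- A multiple of `N` is fixed by `w` and `p`, so it cannot cross c.
      ... | Signed.divides q e≡ = <-irrefl-by h′ (ℤ.≤-trans (ℤ.≤-reflexive (trans (w∘p inv e) (sym fixed))) h)
        where
        fixed : p e ≡ e
        fixed = trans (cong p (trans e≡ (sym (ℤ.+-identityˡ _)))) (trans (shifted-* mp 0ℤ q)
          (trans (cong (_+ q * N n) (fixes-0 mp)) (trans (ℤ.+-identityˡ _) (sym e≡))))
      P⁺ : ∀ k → 1 ℕ.≤ k → k ℕ.≤ n → ∀ t → P (+ k + t * N n) ⇔ t ∈[ a ,+ pos (- y k) ⟩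
      P⁺ k 1≤k k≤n t = _×-⇔_ (subst-⇔ (_≤ c) (shifted-* mp (+ k) t) ⨾ below⁺ k 1≤k k≤n t)
        (subst-⇔ (1ℤ + c ≤_) (w∘p inv _) ⨾ above⁺ k 1≤k k≤n t) ⨾ interval-pos a (- y k)
      P⁻ : ∀ k → 1 ℕ.≤ k → k ℕ.≤ n → ∀ t → P (- + k + t * N n) ⇔ t ∈[ 1ℤ ,+ pos (y k) ⟩
      P⁻ k 1≤k k≤n t = _×-⇔_
        (subst-⇔ (_≤ c) (trans (shifted-* mp (- + k) t) (cong (_+ t * N n) (mp .odd (+ k)))) ⨾ below⁻ k 1≤k
            k≤n t)
        (subst-⇔ (1ℤ + c ≤_) (w∘p inv _) ⨾ above⁻ k 1≤k k≤n t) ⨾ interval-pos 1ℤ (y k)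
      open Count P (λ _ → a) (λ _ → 1ℤ) (λ k → pos (- y k)) (λ k → pos (y k)) P-entry P⁺ P⁻

  floor-⇔ : ∀ x t → t * N n ≤ x ⇔ t ≤ ⌊_⌋ n x
  floor-⇔ x t = mk⇔ (floor-greatest n x) (floor-least n x)

  even₀⇒ : EvenCardinality (λ i → i ≤ 0ℤ × 1ℤ ≤ w i) → Even (floorSum n p)
  even₀⇒ = crossing-even 0ℤ 0ℤ (quotient n p)
    (λ k 1≤k k≤n t → move (lemma₁ (p (+ k)) (t * N n)) ⨾
        (floor-⇔ (- p (+ k)) t ⨾ subst-⇔ (t ≤_) (⌊-p⌋ n inv k 1≤k k≤n)))
    (λ k 1≤k k≤n t → move (lemma₂ (p (+ k)) (t * N n)) ⨾
        (floor-⇔ (p (+ k)) t ⨾ subst-⇔ (t ≤_) (sym (ℤ.+-identityˡ _))))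
    (λ k 1≤k k≤n t → mk⇔
      (λ h → level-≤ n {1ℤ} {+ k} {0ℤ} {t} h (ℤ.≤-trans (+≤n⇒<M {n} k≤n) (ℤ.i≤suc[i] (N n))))
      (λ h → level-mono n {1ℤ} {+ k} {0ℤ} {t} (+≤+ 1≤k) h))
    (λ k 1≤k k≤n t → mk⇔
      (λ h → level-< n {1ℤ} { - + k} {0ℤ} {t} h (linear₁ (+≤+ {0} {k} z≤n) (lemma₃ (+ k))))
      (λ h → level-mono-< n {1ℤ} { - + k} {0ℤ} {t} (linear₁ (+≤n⇒<M {n} k≤n) (lemma₄ (+ k) (N n))) h))
    where
    lemma₁ : ∀ x m → 0ℤ - (x + m) ≡ - x - m
    lemma₁ = solve-∀
    lemma₂ : ∀ x m → 0ℤ - (- x + m) ≡ x - m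
    lemma₂ = solve-∀
    lemma₃ : ∀ k → k - 0ℤ ≡ 1ℤ - (1ℤ + - k)
    lemma₃ = solve-∀
    lemma₄ : ∀ k m → m - (1ℤ + k) ≡ - k + m - 1ℤ
    lemma₄ = solve-∀

  evenₙ⇒ : EvenCardinality (λ i → i ≤ + n × + suc n ≤ w i) → Even (roundSum n p)
  -- As k ≤ n, the entries above n on the runner of k start at level 1; those above 0 in `even₀⇒`
  -- start at level 0.
  evenₙ⇒ = crossing-even (+ n) 1ℤ (λ k → ⌊_⌉ n (p (+ k)))
    (λ k 1≤k k≤n t → move (lemma₁ (p (+ k)) (t * N n) (+ n)) ⨾ (floor-⇔ (- p (+ k) + + n) t ⨾
      subst-⇔ (t ≤_) (trans (round-neg n (p (+ k))) (sym (ℤ.+-identityˡ _)))))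
    (λ k 1≤k k≤n t → move (lemma₂ (p (+ k)) (t * N n) (+ n)) ⨾
        (floor-⇔ (p (+ k) + + n) t ⨾ subst-⇔ (t ≤_) (sym (ℤ.+-identityˡ _))))
    (λ k 1≤k k≤n t → mk⇔
      (λ h → level-< n {+ suc n} {+ k} {0ℤ} (subst (_≤ + k + t * N n) (sym (ℤ.+-identityʳ (+ suc n))) h)
          (+≤+ (s≤s k≤n)))
      (λ h → subst (_≤ + k + t * N n) (ℤ.+-identityʳ (+ suc n))
        (level-mono-< n {+ suc n} {+ k} {0ℤ} {t}
            (linear₁ (+≤+ {0} {k ℕ.+ n} z≤n) (trans (lemma₅ (+ k) (+ n))
            (cong (λ m → + k + m - + suc n) (sym (M≡ n))))) h)))
    (λ k 1≤k k≤n t → mk⇔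
      (λ h → level-< n {+ suc n} { - + k} {0ℤ}
          (subst (_≤ - + k + t * N n) (sym (ℤ.+-identityʳ (+ suc n))) h)
          (linear₁ (+≤+ {0} {k ℕ.+ n} z≤n) (lemma₃ (+ k) (+ n))))
      (λ h → subst (_≤ - + k + t * N n) (ℤ.+-identityʳ (+ suc n))
        (level-mono-< n {+ suc n} { - + k} {0ℤ} {t}
            (linear₁ (+≤+ k≤n) (trans (lemma₄ (+ k) (+ n)) (cong (λ m → - + k + m - + suc n) (sym (M≡ n)))))
            h)))
    where
    lemma₁ : ∀ x m k → k - (x + m) ≡ - x + k - m
    lemma₁ = solve-∀
    lemma₂ : ∀ x m k → k - (- x + m) ≡ x + k - m
    lemma₂ = solve-∀
    lemma₃ : ∀ k n → k + n - 0ℤ ≡ 1ℤ + n - (1ℤ + - k)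
    lemma₃ = solve-∀
    lemma₄ : ∀ k n → n - k ≡ - k + (1ℤ + (n + n)) - (1ℤ + n)
    lemma₄ = solve-∀
    lemma₅ : ∀ k n → k + n - 0ℤ ≡ k + (1ℤ + (n + n)) - (1ℤ + n)
    lemma₅ = solve-∀

  floor-parity : ∀ t (W : MirroredPermutation n) → perm W ≡ w → InW̃ t W → FloorParity t n p
  floor-parity C̃/C W _ _ = tt
  floor-parity B̃/D W _ _ = tt
  floor-parity B̃/B W refl h = even₀⇒ h
  floor-parity D̃/D W refl (h , _) = even₀⇒ h

  round-parity : ∀ t (W : MirroredPermutation n) → perm W ≡ w → InW̃ t W → RoundParity t n p
  round-parity C̃/C W _ _ = tt
  round-parity B̃/B W _ _ = tt
  round-parity B̃/D W refl h = evenₙ⇒ h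
  round-parity D̃/D W refl (_ , h) = evenₙ⇒ h

-- Beads and gaps

δ : ℤ → ℤ → ℕ
δ x y with x ℤ.<? y
... | yes _ = 1
... | no  _ = 0

δ-< : ∀ {x y} → x < y → δ x y ≡ 1
δ-< {x} {y} x<y with x ℤ.<? y
... | yes _  = refl
... | no x≮y = ⊥-elim (x≮y x<y)

δ-≥ : ∀ {x y} → y ≤ x → δ x y ≡ 0
δ-≥ {x} {y} y≤x with x ℤ.<? y
... | yes x<y = ⊥-elim (ℤ.<⇒≱ x<y y≤x)
... | no _    = refl

δ-flip : ∀ {x y} → x ≢ y → δ x y ℕ.+ δ y x ≡ 1
δ-flip {x} {y} x≢y with x ℤ.<? y
... | yes x<y = cong suc (δ-≥ (ℤ.<⇒≤ x<y))
... | no  x≮y = δ-< (ℤ.≤∧≢⇒< (ℤ.≮⇒≥ x≮y) (x≢y ∘ sym))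

-- The offsets differ by less than `N`, so the levels decide and `δ` breaks the tie between equal
-- levels.
lex : ∀ n {x y} t s → 1ℤ + x ≤ y + N n → 1ℤ + y ≤ x + N n →
      x + t * N n < y + s * N n ⇔ t ≤ s - 1ℤ + + δ x y
lex n {x} {y} t s x<y+M y<x+M with x ℤ.<? y
... | yes x<y = mk⇔
  (λ h → subst (t ≤_) (lemma s) (level-≤ n {x} {y} {t} {s} (ℤ.<⇒≤ h) y<x+M))
  (λ h → 1+≤⇒< (subst (_≤ y + s * N n) (ℤ.+-assoc 1ℤ x (t * N n))
    (level-mono n {1ℤ + x} {y} {t} {s} (<⇒1+≤ x<y) (subst (t ≤_) (sym (lemma s)) h))))
  where
  lemma : ∀ s → s ≡ s - 1ℤ + 1ℤ
  lemma = solve-∀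
... | no x≮y = mk⇔
  (λ h → linear₁ (level-< n {1ℤ + x} {y} {t} {s}
      (subst (_≤ y + s * N n) (sym (ℤ.+-assoc 1ℤ x (t * N n))) (<⇒1+≤ h))
    (ℤ.+-monoʳ-≤ 1ℤ (ℤ.≮⇒≥ x≮y))) (lemma s t))
  (λ h → 1+≤⇒< (subst (_≤ y + s * N n) (ℤ.+-assoc 1ℤ x (t * N n))
    (level-mono-< n {1ℤ + x} {y} {t} {s} x<y+M (linear₁ h (sym (lemma s t))))))
  where
  lemma : ∀ s t → s - (1ℤ + t) ≡ s - 1ℤ + 0ℤ - t
  lemma = solve-∀

-- Of the two lowest beads k - q N and N - k + q N of a class, the second is the larger exactly when
-- q ≥ 0. In either case the larger one is `ρOf q k` plus 1 + `fold q` times N.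
ρOf : ℤ → ℕ → ℤ
ρOf (+ _)    k = - + k
ρOf -[1+ _ ] k = + k

negative : ℤ → ℕ
negative (+ _)    = 0
negative -[1+ _ ] = 1

±ρOf : ∀ q k → ρOf q k ≡ + k ⊎ ρOf q k ≡ - + k
±ρOf (+ _)    k = inj₂ refl
±ρOf -[1+ _ ] k = inj₁ refl

module _ (n : ℕ) where

  Small : ℤ → Set
  Small x = x ≤ + n × - x ≤ + n

  small-< : ∀ {x y} → Small x → Small y → 1ℤ + x ≤ y + N n
  small-< {x} {y} (x≤n , _) (_ , -y≤n) = linear₂ x≤n -y≤n
    (trans (lemma x y (+ n)) (cong (λ m → y + m - (1ℤ + x)) (sym (M≡ n))))
    where
    lemma : ∀ x y k → k - x + (k - - y) ≡ y + (1ℤ + (k + k)) - (1ℤ + x)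
    lemma = solve-∀

  small-+ : ∀ {k} → k ℕ.≤ n → Small (+ k)
  small-+ k≤n = +≤+ k≤n , ℤ.≤-trans ℤ.neg-≤-pos (+≤+ k≤n)

  small-neg : ∀ {x} → Small x → Small (- x)
  small-neg {x} (a , b) = b , subst (_≤ + n) (sym (ℤ.neg-involutive x)) a

module AbacusOf (n : ℕ) {p : ℤ → ℤ} (W : MirroredPermutation n) (inv : Inverses n (perm W) p)
  (a : Abacus n) (isA : IsAbacusOf W a) where

  open IsAbacusOf isA

  private
    w = perm W
    mp = p-mirrored inv
    q = quotient n p
    M′ = N n

  ρ : ℕ → ℤ
  ρ k = ρOf (q k) k

  m : ℕ → ℕ
  m k = fold (q k)

  open Classes n ρ (λ k → ±ρOf (q k) k) public

  -- If w j = t N + i with 1 ≤ j ≤ 2 n, then j = p i + t N lies strictly between 0 and N, which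
  -- forces t to be minus the floor of p i / N.
  lowest-bead : ∀ i → RunnerIndex n i → IsLowestBead a (OnRunner n i) (- ⌊_⌋ n (p i) * N n + i)
  lowest-bead i ri with lowest i ri
  ... | j , 1≤j , j≤ , bead , (t , wj≡) , max = subst (IsLowestBead a (OnRunner n i))
      (trans wj≡ (cong (λ t → t * N n + i) t≡)) (bead , (t , wj≡) , max)
    where
    j≡ : j ≡ p i + t * N n
    j≡ = trans (sym (p∘w inv j)) (trans (cong p (trans wj≡ (ℤ.+-comm (t * N n) i))) (shifted-* mp i t))
    floor-j : ⌊_⌋ n (p i) + t ≡ 0ℤ
    floor-j = trans (sym (floor-shift n (p i) t)) (trans (cong (⌊_⌋ n) (sym j≡))
      (floor-unique n {j} {0ℤ} j (ℤ.≤-trans (+≤+ z≤n) 1≤j) (ℤ.+-monoʳ-≤ 1ℤ j≤) (sym (ℤ.+-identityʳ j))))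
    t≡ : t ≡ - ⌊_⌋ n (p i)
    t≡ = trans (lemma (⌊_⌋ n (p i)) t) (trans (cong (_- ⌊_⌋ n (p i)) floor-j) (ℤ.+-identityˡ _))
      where
      lemma : ∀ q t → t ≡ q + t - q
      lemma = solve-∀

  runner-bead : ∀ i → RunnerIndex n i → ∀ t → Entry n (t * N n + i) → Bead a (t * N n + i) ⇔ t ≤ - ⌊_⌋ n (p i)
  runner-bead i ri t entry with lowest-bead i ri
  ... | bead , on , max = mk⇔ to from
    where
    L = - ⌊_⌋ n (p i)
    to : Bead a (t * N n + i) → t ≤ L
    to h = level-≤ n {i} {i} {t} {L} (subst₂ _≤_ (ℤ.+-comm (t * N n) i) (ℤ.+-comm (L * N n) i)
        (max _ h (t , refl)))
      (subst (1ℤ + i ≤_) (ℤ.+-comm (N n) i) (ℤ.+-monoˡ-≤ i (+≤+ (s≤s z≤n))))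
    from : t ≤ L → Bead a (t * N n + i)
    from t≤L with t ℤ.≟ L
    ... | yes refl = bead
    ... | no t≢L with bead? a (t * N n + i)
    ...   | yes h = h
    ...   | no ¬h = ⊥-elim (flush (i , ri , (t , refl) , (L , refl))
        (ℤ.+-monoˡ-< i (ℤ.*-monoʳ-<-pos (N n) (ℤ.≤∧≢⇒< t≤L t≢L))) bead (entry , ¬h))

  runner-+ : ∀ {k} → 1 ℕ.≤ k → k ℕ.≤ n → RunnerIndex n (+ k)
  runner-+ 1≤k k≤n = +≤+ 1≤k , +≤+ (ℕ.≤-trans k≤n (ℕ.m≤m+n n _))

  runner-- : ∀ {k} → 1 ℕ.≤ k → k ℕ.≤ n → RunnerIndex n (N n - + k)
  runner-- {k} 1≤k k≤n = proj₁ b , linear₁ (proj₂ b) (lemma (N n - + k) (+ (2 ℕ.* n)))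
    where
    b = box-reflect {n} {+ k} (+-box {n} k 1≤k k≤n)
    lemma : ∀ x y → 1ℤ + y - (1ℤ + x) ≡ y - x
    lemma = solve-∀

  bead-+ : ∀ k → 1 ℕ.≤ k → k ℕ.≤ n → ∀ t → Bead a (+ k + t * N n) ⇔ t ≤ - q k
  bead-+ k 1≤k k≤n t = subst-⇔ (Bead a) (ℤ.+-comm (+ k) (t * N n)) ⨾
    runner-bead (+ k) (runner-+ 1≤k k≤n) t (subst (Entry n) (ℤ.+-comm (+ k) (t * N n)) entry)
    where
    entry : Entry n (+ k + t * N n)
    entry = Classes.class-entry n +_ (λ _ → inj₁ refl) {k} 1≤k k≤n (t , inj₁ refl)

  bead-- : ∀ k → 1 ℕ.≤ k → k ℕ.≤ n → ∀ t → Bead a (- + k + t * N n) ⇔ t ≤ 1ℤ + q k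
  bead-- k 1≤k k≤n t = subst-⇔ (Bead a) e≡ ⨾
    (runner-bead (N n - + k) (runner-- 1≤k k≤n) (t - 1ℤ) (subst (Entry n) e≡ entry) ⨾
    (subst-⇔ (λ z → t - 1ℤ ≤ - z) (trans (cong (⌊_⌋ n) (reflected mp (+ k))) (⌊M-p⌋ n inv k 1≤k k≤n)) ⨾ move
        (lemma′ t (q k))))
    where
    entry : Entry n (- + k + t * N n)
    entry = Classes.class-entry n +_ (λ _ → inj₁ refl) {k} 1≤k k≤n (t , inj₂ refl)
    lemma : ∀ k t m → - k + t * m ≡ (t - 1ℤ) * m + (m - k)
    lemma = solve-∀
    e≡ : - + k + t * N n ≡ (t - 1ℤ) * N n + (N n - + k)
    e≡ = lemma (+ k) t (N n)
    lemma′ : ∀ t q → - - q - (t - 1ℤ) ≡ 1ℤ + q - t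
    lemma′ = solve-∀

  private
    select⁺ : ∀ z {k t} → Bead a (+ k + t * N n) ⇔ t ≤ - z → Bead a (- + k + t * N n) ⇔ t ≤ 1ℤ + z →
              Bead a (ρOf z k + t * N n) ⇔ t ≤ 1ℤ + + fold z
    select⁺ (+ _)    _ h = h
    select⁺ -[1+ _ ] h _ = h

    select⁻ : ∀ z {k t} → Bead a (+ k + t * N n) ⇔ t ≤ - z → Bead a (- + k + t * N n) ⇔ t ≤ 1ℤ + z →
              Bead a (- ρOf z k + t * N n) ⇔ t ≤ - + fold z
    select⁻ (+ _)    {k} {t} h _ = subst-⇔ (λ z → Bead a (z + t * N n)) (ℤ.neg-involutive (+ k)) ⨾ h
    select⁻ -[1+ z ] {k} {t} _ h = h ⨾ subst-⇔ (t ≤_) (lemma (+ z))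
      where
      lemma : ∀ q → 1ℤ + - (1ℤ + q) ≡ - q
      lemma = solve-∀

  -- The lowest beads of the two runners of a class add up to N. In terms of `ρ` and `m` they are ρ
  -- k + (1 + m k) N and - ρ k - m k N, whatever the sign of q k.
  bead⁺ : ∀ k → 1 ℕ.≤ k → k ℕ.≤ n → ∀ t → Bead a (ρ k + t * N n) ⇔ t ≤ 1ℤ + + m k
  bead⁺ k 1≤k k≤n t = select⁺ (q k) (bead-+ k 1≤k k≤n t) (bead-- k 1≤k k≤n t)

  bead⁻ : ∀ k → 1 ℕ.≤ k → k ℕ.≤ n → ∀ t → Bead a (- ρ k + t * N n) ⇔ t ≤ - + m k
  bead⁻ k 1≤k k≤n t = select⁻ (q k) (bead-+ k 1≤k k≤n t) (bead-- k 1≤k k≤n t)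

pos-⊖ : ∀ x y → pos (+ x - + y) ≡ x ∸ y
pos-⊖ x y with y ℕ.≤? x
... | yes y≤x = cong pos (trans (ℤ.m-n≡m⊖n x y) (ℤ.⊖-≥ y≤x))
... | no y≰x = trans (go (y ∸ x) (ℕ.m<n⇒0<n∸m x<y) (trans (ℤ.m-n≡m⊖n x y) (ℤ.⊖-< x<y)))
    (sym (ℕ.m≤n⇒m∸n≡0 (ℕ.<⇒≤ x<y)))
  where
  x<y = ℕ.≰⇒> y≰x
  go : ∀ d → 0 ℕ.< d → ∀ {z} → z ≡ - + d → pos z ≡ 0
  go (suc d) _ refl = refl

N+ : ∀ n x → N n + x ≡ x + 1ℤ * N n
N+ n x = lemma (N n) x
  where
  lemma : ∀ m k → m + k ≡ k + 1ℤ * m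
  lemma = solve-∀

-- The number of gaps of class k between b(i) and B(i). On the runner of ρ k gaps start at level 2 +
-- m k and the last entry before B(i) has level m i + δ; on the other runner all m i entries in
-- between are gaps.
gapCount : (ℕ → ℤ) → (ℕ → ℕ) → ℕ → ℕ → ℕ
gapCount ρ m i k = pos (+ (m i ℕ.+ δ (ρ k) (ρ i)) - + suc (m k)) ℕ.+ m i

module Beads (n : ℕ) (a : Abacus n) (ρ : ℕ → ℤ) (m sg : ℕ → ℕ)
  (±ρ : ∀ k → (ρ k ≡ + k × sg k ≡ 1) ⊎ (ρ k ≡ - + k × sg k ≡ 0))
  (bead⁺ : ∀ k → 1 ℕ.≤ k → k ℕ.≤ n → ∀ t → Bead a (ρ k + t * N n) ⇔ t ≤ 1ℤ + + m k)
  (bead⁻ : ∀ k → 1 ℕ.≤ k → k ℕ.≤ n → ∀ t → Bead a (- ρ k + t * N n) ⇔ t ≤ - + m k)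
  where

  open Classes n ρ (λ k → Sum.map proj₁ proj₁ (±ρ k))

  B-level b-level : ℕ → ℤ
  B-level k = ρ k + (1ℤ + + m k) * N n
  b-level k = ρ k + 1ℤ * N n

  small : ∀ {k} → k ℕ.≤ n → Small n (ρ k)
  small {k} k≤n with ρ k | ±ρ k
  ... | _ | inj₁ (refl , _) = small-+ n k≤n
  ... | _ | inj₂ (refl , _) = small-neg n (small-+ n k≤n)

  runner⇒class : ∀ k {e} → OnRunner n (+ k) e ⊎ OnRunner n (N n - + k) e → Class k e
  runner⇒class k (inj₁ (t , h)) = ±⇒class k t (inj₁ (trans h (ℤ.+-comm (t * N n) (+ k))))
  runner⇒class k (inj₂ (t , h)) = ±⇒class k (t + 1ℤ) (inj₂ (trans h (lemma t (N n) (+ k))))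
    where
    lemma : ∀ t m k → t * m + (m - k) ≡ - k + (t + 1ℤ) * m
    lemma = solve-∀

  class⇒runner : ∀ k {e} → Class k e → OnRunner n (+ k) e ⊎ OnRunner n (N n - + k) e
  class⇒runner k (t , h) = Sum.map
    (λ h → t , trans h (ℤ.+-comm (+ k) (t * N n)))
    (λ h → t - 1ℤ , trans h (lemma t (N n) (+ k)))
    (class⇒± k t h)
    where
    lemma : ∀ t m k → - k + t * m ≡ (t - 1ℤ) * m + (m - k)
    lemma = solve-∀

  level-bead : ∀ k → 1 ℕ.≤ k → k ℕ.≤ n → Bead a (B-level k)
  level-bead k 1≤k k≤n = Equivalence.from (bead⁺ k 1≤k k≤n (1ℤ + + m k)) ℤ.≤-refl

  -ρ≤ρ+N : ∀ k → k ℕ.≤ n → - ρ k ≤ ρ k + N n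
  -ρ≤ρ+N k k≤n = ℤ.≤-trans (ℤ.i≤suc[i] (- ρ k))
      (small-< n { - ρ k} {ρ k} (small-neg n {ρ k} (small k≤n)) (small k≤n))

  bead⁻-level : ∀ k → 1 ℕ.≤ k → k ℕ.≤ n → ∀ t → Bead a (- ρ k + t * N n) → 1ℤ + t ≤ 1ℤ + + m k
  bead⁻-level k 1≤k k≤n t bead = ℤ.+-monoʳ-≤ 1ℤ (ℤ.≤-trans t≤ (ℤ.neg-≤-pos {m k} {m k}))
    where
    t≤ : t ≤ - + m k
    t≤ = Equivalence.to (bead⁻ k 1≤k k≤n t) bead

  bead≤⁺ : ∀ k → 1 ℕ.≤ k → k ℕ.≤ n → ∀ t → Bead a (ρ k + t * N n) → ρ k + t * N n ≤ B-level k
  bead≤⁺ k 1≤k k≤n t bead =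
    level-mono n {ρ k} {ρ k} {t} {1ℤ + + m k} ℤ.≤-refl (Equivalence.to (bead⁺ k 1≤k k≤n t) bead)

  bead≤⁻ : ∀ k → 1 ℕ.≤ k → k ℕ.≤ n → ∀ t → Bead a (- ρ k + t * N n) → - ρ k + t * N n ≤ B-level k
  bead≤⁻ k 1≤k k≤n t bead =
    level-mono-< n { - ρ k} {ρ k} {t} {1ℤ + + m k} (-ρ≤ρ+N k k≤n) (bead⁻-level k 1≤k k≤n t bead)

  class-bead≤ : ∀ k → 1 ℕ.≤ k → k ℕ.≤ n → ∀ e → Bead a e → Class k e → e ≤ B-level k
  class-bead≤ k 1≤k k≤n e bead (t , inj₁ h) = subst (_≤ B-level k) (sym h)
      (bead≤⁺ k 1≤k k≤n t (subst (Bead a) h bead))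
  class-bead≤ k 1≤k k≤n e bead (t , inj₂ h) = subst (_≤ B-level k) (sym h)
      (bead≤⁻ k 1≤k k≤n t (subst (Bead a) h bead))

  B≡ : ∀ k → 1 ℕ.≤ k → k ℕ.≤ n → ∀ B →
    IsLowestBead a (λ e → OnRunner n (+ k) e ⊎ OnRunner n (N n - + k) e) B → B ≡ B-level k
  B≡ k 1≤k k≤n B (bead , on , max) = ℤ.≤-antisym
    (class-bead≤ k 1≤k k≤n B bead (runner⇒class k on))
    (max (B-level k) (level-bead k 1≤k k≤n) (class⇒runner k (1ℤ + + m k , inj₁ refl)))

  -- The N consecutive integers from n + 1 to N + n contain one entry of each runner, and ρ k + N is
  -- among them.
  b≡ : ∀ k → k ℕ.≤ n → ∀ b → Isb a (B-level k) b → b ≡ b-level k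
  b≡ k k≤n b (bead , n<b , b≤ , r , _ , (t₁ , e₁) , (t₂ , e₂)) = trans b≡ρ
      (cong (λ t → ρ k + t * N n) (ℤ.≤-antisym upper lower))
    where
    t = t₂ - t₁ + (1ℤ + + m k)
    b≡ρ : b ≡ ρ k + t * N n
    b≡ρ = trans e₂ (trans (lemma t₁ t₂ (N n) r)
        (trans (cong (λ z → (t₂ - t₁) * N n + z) (sym e₁)) (lemma′ (ρ k) (t₂ - t₁) (1ℤ + + m k) (N n))))
      where
      lemma : ∀ t u m r → u * m + r ≡ (u - t) * m + (t * m + r)
      lemma = solve-∀
      lemma′ : ∀ x t s m → t * m + (x + s * m) ≡ x + (t + s) * m
      lemma′ = solve-∀
    lower : 1ℤ ≤ t
    lower = level-< n {+ suc n} {ρ k} {0ℤ} {t} (subst₂ _≤_ (sym (ℤ.+-identityʳ (+ suc n))) b≡ρ n<b)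
        (ℤ.+-monoʳ-≤ 1ℤ (proj₁ (small k≤n)))
    upper : t ≤ 1ℤ
    upper = level-≤ n {ρ k} {+ n} {t} {1ℤ} (subst₂ _≤_ b≡ρ (lemma (N n) (+ n)) b≤)
        (small-< n (small-+ n ℕ.≤-refl) (small k≤n))
      where
      lemma : ∀ m k → m + k ≡ k + 1ℤ * m
      lemma = solve-∀

  ∣ρ∣ : ∀ k → ∣ ρ k ∣ ≡ k
  ∣ρ∣ k with ρ k | ±ρ k
  ... | _ | inj₁ (refl , _) = refl
  ... | _ | inj₂ (refl , _) = ℤ.∣-i∣≡∣i∣ (+ k)

  ρ≢-ρ : ∀ {i k} → 1 ℕ.≤ i → ρ i ≢ - ρ k
  ρ≢-ρ {i} {k} 1≤i h = ℕ.<⇒≢ 1≤i (sym (trans (sym (∣ρ∣ i))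
      (cong ∣_∣ (i≡-i⇒i≡0 (ρ i) (trans h (cong (λ j → - ρ j) (sym i≡k)))))))
    where
    i≡k : i ≡ k
    i≡k = trans (sym (∣ρ∣ i)) (trans (cong ∣_∣ h) (trans (ℤ.∣-i∣≡∣i∣ (ρ k)) (∣ρ∣ k)))

  ⇔-absurd : ∀ {A B : Set} → ¬ A → ¬ B → A ⇔ B
  ⇔-absurd ¬a ¬b = mk⇔ (⊥-elim ∘ ¬a) (⊥-elim ∘ ¬b)

  gaps-length : ∀ i → 1 ℕ.≤ i → i ℕ.≤ n → ∀ {xs} →
    Enumerates xs (λ e → Gap a e × Between (B-level i) (b-level i) e) →
    length xs ≡ sum (map (gapCount ρ m i) (range 1 n))
  gaps-length i 1≤i i≤n exs = count exs
    where
    P : Pred ℤ 0ℓ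
    P e = Gap a e × Between (B-level i) (b-level i) e
    -- Since m i ≥ 0, b(i) never lies beyond B(i), which leaves one of the two orders.
    between : ∀ e → Between (B-level i) (b-level i) e ⇔ (b-level i < e × e < B-level i)
    between e = mk⇔ to inj₂
      where
      to : Between (B-level i) (b-level i) e → b-level i < e × e < B-level i
      to (inj₂ h) = h
      to (inj₁ (B<e , e<b)) = ⊥-elim (ℤ.<⇒≱ (ℤ.<-trans B<e e<b)
        (level-mono n {ρ i} {ρ i} {1ℤ} {1ℤ + + m i} ℤ.≤-refl (ℤ.+-monoʳ-≤ 1ℤ (+≤+ {0} {m i} z≤n))))
    P⁺ : ∀ k → 1 ℕ.≤ k → k ℕ.≤ n → ∀ t → P (ρ k + t * N n) ⇔
         t ∈[ + 2 + + m k ,+ pos (+ (m i ℕ.+ δ (ρ k) (ρ i)) - + suc (m k)) ⟩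
    P⁺ k 1≤k k≤n t = mk⇔ to from ⨾ interval-pos (+ 2 + + m k) (+ (m i ℕ.+ δ (ρ k) (ρ i)) - + suc (m k))
      where
      d = δ (ρ k) (ρ i)
      upper : ρ k + t * N n < B-level i ⇔ t ≤ 1ℤ + + m i - 1ℤ + + d
      upper = lex n t (1ℤ + + m i) (small-< n (small k≤n) (small i≤n)) (small-< n (small i≤n) (small k≤n))
      bound : 1ℤ + + m i - 1ℤ + + d ≡ + 2 + + m k - 1ℤ + (+ (m i ℕ.+ d) - + suc (m k))
      bound = lemma (+ m i) (+ d) (+ m k)
        where
        lemma : ∀ i d k → 1ℤ + i - 1ℤ + d ≡ + 2 + k - 1ℤ + (i + d - (1ℤ + k))
        lemma = solve-∀
      to : P (ρ k + t * N n) → t ≤ + 2 + + m k - 1ℤ + (+ (m i ℕ.+ d) - + suc (m k)) × + 2 + + m k ≤ t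
      to ((_ , ¬bead) , btw) =
        subst (t ≤_) bound (Equivalence.to upper (proj₂ (Equivalence.to (between _) btw))) ,
        linear₁ (<⇒1+≤ (ℤ.≰⇒> (¬bead ∘ Equivalence.from (bead⁺ k 1≤k k≤n t)))) (lemma (+ m k) t)
        where
        lemma : ∀ k t → t - (1ℤ + (1ℤ + k)) ≡ t - (+ 2 + k)
        lemma = solve-∀
      from : t ≤ + 2 + + m k - 1ℤ + (+ (m i ℕ.+ d) - + suc (m k)) × + 2 + + m k ≤ t → P (ρ k + t * N n)
      from (t≤ , ≤t) =
        (class-entry {k} 1≤k k≤n (t , inj₁ refl) ,
         λ bead → <-irrefl-by (linear₁ ≤t (lemma (+ m k) t)) (Equivalence.to (bead⁺ k 1≤k k≤n t) bead)) ,
        -- Gaps on this runner have level at least 2, while b(i) has level 1.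
        inj₂ (1+≤⇒< (subst (_≤ ρ k + t * N n) (ℤ.+-assoc 1ℤ (ρ i) (1ℤ * N n))
                (level-mono-< n {1ℤ + ρ i} {ρ k} {1ℤ} {t} (small-< n (small i≤n) (small k≤n))
                    (ℤ.≤-trans (+≤+ {2} {2 ℕ.+ m k} (s≤s (s≤s z≤n))) ≤t))) ,
              Equivalence.from upper (subst (t ≤_) (sym bound) t≤))
        where
        lemma : ∀ k t → t - (+ 2 + k) ≡ t - (1ℤ + (1ℤ + k))
        lemma = solve-∀
    P⁻ : ∀ k → 1 ℕ.≤ k → k ℕ.≤ n → ∀ t → P (- ρ k + t * N n) ⇔ t ∈[ 1ℤ + + δ (- ρ k) (ρ i) ,+ m i ⟩
    P⁻ k 1≤k k≤n t = mk⇔ to from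
      where
      d = δ (- ρ k) (ρ i)
      small-ρk = small-neg n (small k≤n)
      upper : - ρ k + t * N n < B-level i ⇔ t ≤ 1ℤ + + m i - 1ℤ + + d
      upper = lex n t (1ℤ + + m i) (small-< n small-ρk (small i≤n)) (small-< n (small i≤n) small-ρk)
      lower : b-level i < - ρ k + t * N n ⇔ 1ℤ ≤ t - 1ℤ + + δ (ρ i) (- ρ k)
      lower = lex n 1ℤ t (small-< n (small i≤n) small-ρk) (small-< n small-ρk (small i≤n))
      -- As ρ i and - ρ k differ, the tie-breaks at the two ends are complementary, and the number
      -- of levels in between is m i in either case.
      d+d : + δ (ρ i) (- ρ k) + + d ≡ 1ℤ
      d+d = cong +_ (δ-flip (ρ≢-ρ {i} {k} 1≤i))
      start : t - 1ℤ + + δ (ρ i) (- ρ k) - 1ℤ ≡ t - (1ℤ + + d)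
      start = trans (lemma t (+ δ (ρ i) (- ρ k)) (+ d))
          (trans (cong (λ z → t - 1ℤ + z - 1ℤ - + d) d+d) (lemma′ t (+ d)))
        where
        lemma : ∀ t x d → t - 1ℤ + x - 1ℤ ≡ t - 1ℤ + (x + d) - 1ℤ - d
        lemma = solve-∀
        lemma′ : ∀ t d → t - 1ℤ + 1ℤ - 1ℤ - d ≡ t - (1ℤ + d)
        lemma′ = solve-∀
      end : ∀ i d t → 1ℤ + i - 1ℤ + d - t ≡ 1ℤ + d + i - (1ℤ + t)
      end = solve-∀
      to : P (- ρ k + t * N n) → t ∈[ 1ℤ + + d ,+ m i ⟩
      to (_ , btw) with Equivalence.to (between _) btw
      ... | b<e , e<B = linear₁ (Equivalence.to lower b<e) start , linear₁ (Equivalence.to upper e<B)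
          (end (+ m i) (+ d) t)
      from : t ∈[ 1ℤ + + d ,+ m i ⟩ → P (- ρ k + t * N n)
      from (≤t , t<) =
        (class-entry {k} 1≤k k≤n (t , inj₂ refl) ,
         λ bead → <-irrefl-by (ℤ.≤-trans (ℤ.+-monoʳ-≤ 1ℤ (+≤+ {0} {d} z≤n)) ≤t)
             (ℤ.≤-trans (Equivalence.to (bead⁻ k 1≤k k≤n t) bead) (neg≤0 (m k)))) ,
        inj₂ (Equivalence.from lower (linear₁ ≤t (sym start)) , Equivalence.from upper
            (linear₁ t< (sym (end (+ m i) (+ d) t))))
        where
        neg≤0 : ∀ j → - + j ≤ 0ℤ
        neg≤0 j = ℤ.neg-mono-≤ (+≤+ {0} {j} z≤n)
    open Count P (λ k → + 2 + + m k) (λ k → 1ℤ + + δ (- ρ k) (ρ i))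
      (λ k → pos (+ (m i ℕ.+ δ (ρ k) (ρ i)) - + suc (m k))) (λ _ → m i) (λ e h → proj₁ (proj₁ h)) P⁺ P⁻

  -- Offsets lie between - n and n, so the entries beyond N + n are those of level at least 2. Beads
  -- of such a level occur only on the runner of ρ k, at the levels 2, ..., 1 + m k.
  high-length : ∀ {xs} → Enumerates xs (λ e → Bead a e × N n + + n < e) → length xs ≡ sum
      (map (λ k → m k ℕ.+ 0) (range 1 n))
  high-length exs = count exs
    where
    P : Pred ℤ 0ℓ
    P e = Bead a e × N n + + n < e
    above : ∀ {x} → Small n x → ∀ t → N n + + n < x + t * N n ⇔ + 2 ≤ t
    above {x} sx t = subst-⇔ (_< x + t * N n) (N+ n (+ n)) ⨾
        (lex n 1ℤ t (small-< n small-n sx) (small-< n sx small-n) ⨾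
      (subst-⇔ (λ d → 1ℤ ≤ t - 1ℤ + + d) (δ-≥ (proj₁ sx)) ⨾ move (lemma t)))
      where
      small-n = small-+ n ℕ.≤-refl
      lemma : ∀ t → t - 1ℤ + 0ℤ - 1ℤ ≡ t - + 2
      lemma = solve-∀
    P⁺ : ∀ k → 1 ℕ.≤ k → k ℕ.≤ n → ∀ t → P (ρ k + t * N n) ⇔ t ∈[ + 2 ,+ m k ⟩
    P⁺ k 1≤k k≤n t = _×-⇔_ (bead⁺ k 1≤k k≤n t) (above (small k≤n) t) ⨾ mk⇔
      (λ { (t≤ , 2≤t) → 2≤t , linear₁ t≤ (lemma t (+ m k)) })
      (λ { (2≤t , t<) → linear₁ t< (sym (lemma t (+ m k))) , 2≤t })
      where
      lemma : ∀ t k → 1ℤ + k - t ≡ + 2 + k - (1ℤ + t)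
      lemma = solve-∀
    P⁻ : ∀ k → 1 ℕ.≤ k → k ℕ.≤ n → ∀ t → P (- ρ k + t * N n) ⇔ t ∈[ + 2 ,+ 0 ⟩
    P⁻ k 1≤k k≤n t = _×-⇔_ (bead⁻ k 1≤k k≤n t) (above (small-neg n (small k≤n)) t) ⨾ ⇔-absurd
      (λ { (t≤ , 2≤t) → absurd (m k) (ℤ.≤-trans 2≤t t≤) })
      (λ { (2≤t , t<) → <-irrefl-by t< 2≤t })
      where
      absurd : ∀ j → ¬ (+ 2 ≤ - + j)
      absurd zero (+≤+ ())
      absurd (suc j) ()
    open Count P (λ _ → + 2) (λ _ → + 2) m (λ _ → 0) (λ e h → bead-entry a (proj₁ h)) P⁺ P⁻

  mid-upper : ∀ {x t} → Small n x → x + t * N n ≤ N n + + n → t ≤ 1ℤ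
  mid-upper {x} {t} sx h = level-≤ n {x} {+ n} {t} {1ℤ} (subst (x + t * N n ≤_) (N+ n (+ n)) h)
    (small-< n (small-+ n ℕ.≤-refl) sx)

  -- The range from N + 1 to N + n selects level 1 and positive offset, so the only candidate is N +
  -- k, and it is present exactly when ρ k = k.
  mid-⇔ : ∀ k → 1 ℕ.≤ k → k ℕ.≤ n → ∀ t →
    (t ≤ 1ℤ + + m k × N n + 1ℤ ≤ ρ k + t * N n × ρ k + t * N n ≤ N n + + n) ⇔ t ∈[ 1ℤ ,+ sg k ⟩
  mid-⇔ k 1≤k k≤n t with ρ k | sg k | ±ρ k
  ... | _ | _ | inj₂ (refl , refl) = ⇔-absurd
      (λ { (_ , lo , hi) → <-irrefl-by {1ℤ} {t}
          (level-< n {1ℤ} { - + k} {1ℤ} {t} (subst (_≤ - + k + t * N n) (N+ n 1ℤ) lo)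
             (linear₁ (+≤+ {0} {k} z≤n) (lemma (+ k))))
           (mid-upper { - + k} {t} (small-neg n (small-+ n k≤n)) hi) })
      (λ { (1≤t , t<) → <-irrefl-by t< 1≤t })
      where
      lemma : ∀ k → k - 0ℤ ≡ 1ℤ - (1ℤ + - k)
      lemma = solve-∀
  ... | _ | _ | inj₁ (refl , refl) = mk⇔
      (λ { (_ , lo , hi) → level-≤ n {1ℤ} {+ k} {1ℤ} {t} (subst (_≤ + k + t * N n) (N+ n 1ℤ) lo)
          (ℤ.≤-trans (+≤n⇒<M {n} k≤n) (ℤ.i≤suc[i] (N n))) ,
           ℤ.+-monoʳ-≤ 1ℤ (mid-upper {+ k} {t} (small-+ n k≤n) hi) })
      (λ { (1≤t , t<) → at-1 (ℤ.≤-antisym (linear₁ t< (lemma t)) 1≤t) })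
      where
      lemma : ∀ t → 1ℤ + 1ℤ - (1ℤ + t) ≡ 1ℤ - t
      lemma = solve-∀
      at-1 : t ≡ 1ℤ → t ≤ 1ℤ + + m k × N n + 1ℤ ≤ + k + t * N n × + k + t * N n ≤ N n + + n
      at-1 refl = ℤ.+-monoʳ-≤ 1ℤ (+≤+ {0} {m k} z≤n) ,
        subst (_≤ + k + 1ℤ * N n) (sym (N+ n 1ℤ)) (ℤ.+-monoˡ-≤ (1ℤ * N n) (+≤+ 1≤k)) ,
        subst (+ k + 1ℤ * N n ≤_) (sym (N+ n (+ n))) (ℤ.+-monoˡ-≤ (1ℤ * N n) (+≤+ k≤n))

  mid-sum : ∀ c {xs} → Enumerates xs (λ e → Bead a e × N n + 1ℤ ≤ e × e ≤ N n + + n) →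
    Σℤ (map (λ e → e - N n + c) xs) ≡ Σℤ (map (λ k → + sg k * (+ k + c)) (range 1 n))
  mid-sum c exs = trans (total h exs) (cong Σℤ (List.map-cong (λ k → class-sum k) (range 1 n)))
    where
    h : ℤ → ℤ
    h e = e - N n + c
    P : Pred ℤ 0ℓ
    P e = Bead a e × N n + 1ℤ ≤ e × e ≤ N n + + n
    P⁻ : ∀ k → 1 ℕ.≤ k → k ℕ.≤ n → ∀ t → P (- ρ k + t * N n) ⇔ t ∈[ 1ℤ ,+ 0 ⟩
    P⁻ k 1≤k k≤n t = ⇔-absurd
      (λ { (bead , lo , _) → absurd (m k) (ℤ.≤-trans
        (level-≤ n {1ℤ} { - ρ k} {1ℤ} {t} (subst (_≤ - ρ k + t * N n) (lemma (N n)) lo)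
          (small-< n (small-neg n (small k≤n)) (small-+ n (ℕ.≤-trans 1≤k k≤n))))
        (Equivalence.to (bead⁻ k 1≤k k≤n t) bead)) })
      (λ { (1≤t , t<) → <-irrefl-by t< 1≤t })
      where
      lemma : ∀ m → m + 1ℤ ≡ 1ℤ + 1ℤ * m
      lemma = solve-∀
      absurd : ∀ j → ¬ (1ℤ ≤ - + j)
      absurd zero (+≤+ ())
      absurd (suc j) ()
    open Count P (λ _ → 1ℤ) (λ _ → 1ℤ) (λ k → sg k) (λ _ → 0) (λ e h → bead-entry a (proj₁ h))
      (λ k 1≤k k≤n t → _×-⇔_ (bead⁺ k 1≤k k≤n t) (mk⇔ id id) ⨾ mid-⇔ k 1≤k k≤n t) P⁻
    class-sum : ∀ k → Σℤ (map h (map (λ t → ρ k + t * N n) (interval 1ℤ (sg k)) ++ [])) ≡ + sg k * (+ k + c)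
    class-sum k with ρ k | sg k | ±ρ k
    ... | _ | _ | inj₂ (refl , refl) = sym (ℤ.*-zeroˡ (+ k + c))
    ... | _ | _ | inj₁ (refl , refl) = lemma (+ k) (N n) c
      where
      lemma : ∀ k m c → k + 1ℤ * m - m + c + 0ℤ ≡ 1ℤ * (k + c)
      lemma = solve-∀

-- Summation

∑ : (ℕ → ℕ) → List ℕ → ℕ
∑ f js = sum (map f js)

∑-+ : ∀ f g js → ∑ (λ j → f j ℕ.+ g j) js ≡ ∑ f js ℕ.+ ∑ g js
∑-+ f g []       = refl
∑-+ f g (j ∷ js) = trans (cong (f j ℕ.+ g j ℕ.+_) (∑-+ f g js)) (lemma (f j) (g j) (∑ f js) (∑ g js))
  where
  lemma : ∀ a b c d → a ℕ.+ b ℕ.+ (c ℕ.+ d) ≡ a ℕ.+ c ℕ.+ (b ℕ.+ d)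
  lemma = ℕSolver.solve-∀

∑-cong : ∀ {f g} a l → (∀ j → a ℕ.≤ j → j ℕ.< a ℕ.+ l → f j ≡ g j) → ∑ f (range a l) ≡ ∑ g (range a l)
∑-cong a l e = cong sum (map-range-cong a l e)

-- At most one of the truncated differences is nonzero. Without tie-breaks the identity would be a +
-- b + |a - b| = 2 max(a, b) for the two folds; the tie-breaks and the last summand turn 2 b into 2
-- |y| - 1.
fold-pair : ∀ x y →
  ((fold x ℕ.+ (1 ∸ negative y)) ∸ suc (fold y) ℕ.+ fold x) ℕ.+
      ((fold y ℕ.+ negative y) ∸ suc (fold x) ℕ.+ fold y) ℕ.+ negative y
  ≡ pair x y
fold-pair x y = go (fold x) y
  where
  double : ∀ a → 2 ℕ.* a ≡ a ℕ.+ a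
  double a = cong (a ℕ.+_) (ℕ.+-identityʳ a)
  go : ∀ a y → ((a ℕ.+ (1 ∸ negative y)) ∸ suc (fold y) ℕ.+ a) ℕ.+
      ((fold y ℕ.+ negative y) ∸ suc a ℕ.+ fold y) ℕ.+ negative y
               ≡ 2 ℕ.* a ⊔ (2 ℕ.* ∣ y ∣ ∸ 1)
  go a (+ b) with b ℕ.≤? a
  ... | yes b≤a = begin
    (a ℕ.+ 1 ∸ suc b ℕ.+ a) ℕ.+ (b ℕ.+ 0 ∸ suc a ℕ.+ b) ℕ.+ 0
      ≡⟨ cong₂ (λ u v → (u ∸ suc b ℕ.+ a) ℕ.+ (v ℕ.+ b) ℕ.+ 0) (ℕ.+-comm a 1)
           (ℕ.m≤n⇒m∸n≡0 (ℕ.≤-trans (ℕ.≤-reflexive (ℕ.+-identityʳ b)) (ℕ.m≤n⇒m≤1+n b≤a))) ⟩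
    (a ∸ b ℕ.+ a) ℕ.+ b ℕ.+ 0 ≡⟨ lemma (a ∸ b) a b ⟩
    (a ∸ b ℕ.+ b) ℕ.+ a ≡⟨ cong (ℕ._+ a) (ℕ.m∸n+n≡m b≤a) ⟩
    a ℕ.+ a ≡⟨ double a ⟨
    2 ℕ.* a ≡⟨ ℕ.m≥n⇒m⊔n≡m (ℕ.≤-trans (ℕ.m∸n≤m (2 ℕ.* b) 1) (ℕ.*-monoʳ-≤ 2 b≤a)) ⟨
    2 ℕ.* a ⊔ (2 ℕ.* b ∸ 1) ∎
    where
    open ≡-Reasoning
    lemma : ∀ d a b → d ℕ.+ a ℕ.+ b ℕ.+ 0 ≡ d ℕ.+ b ℕ.+ a
    lemma = ℕSolver.solve-∀
  ... | no b≰a with ℕ.m≤n⇒∃[o]m+o≡n (ℕ.≰⇒> b≰a)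
  ...   | d , refl = begin
    (a ℕ.+ 1 ∸ suc b ℕ.+ a) ℕ.+ (b ℕ.+ 0 ∸ suc a ℕ.+ b) ℕ.+ 0
      ≡⟨ cong₂ (λ u v → (u ℕ.+ a) ℕ.+ (v ℕ.+ b) ℕ.+ 0)
           (ℕ.m≤n⇒m∸n≡0 (ℕ.≤-trans (ℕ.≤-reflexive (ℕ.+-comm a 1)) (s≤s (ℕ.m≤n⇒m≤1+n (ℕ.m≤m+n a d)))))
           (trans (cong (_∸ suc a) (ℕ.+-identityʳ b)) (ℕ.m+n∸m≡n (suc a) d)) ⟩
    a ℕ.+ (d ℕ.+ b) ℕ.+ 0 ≡⟨ lemma a d ⟩
    a ℕ.+ d ℕ.+ suc (a ℕ.+ d) ≡⟨ cong (a ℕ.+ d ℕ.+_) (ℕ.+-identityʳ b) ⟨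
    2 ℕ.* b ∸ 1 ≡⟨ ℕ.m≤n⇒m⊔n≡n {2 ℕ.* a} (ℕ.≤-trans (ℕ.≤-reflexive (double a))
         (ℕ.+-mono-≤ (ℕ.m≤m+n a d) (ℕ.≤-trans (ℕ.m≤n⇒m≤1+n (ℕ.m≤m+n a d))
             (ℕ.≤-reflexive (sym (ℕ.+-identityʳ b)))))) ⟨
    2 ℕ.* a ⊔ (2 ℕ.* b ∸ 1) ∎
    where
    open ≡-Reasoning
    lemma : ∀ a d → a ℕ.+ (d ℕ.+ suc (a ℕ.+ d)) ℕ.+ 0 ≡ a ℕ.+ d ℕ.+ suc (a ℕ.+ d)
    lemma = ℕSolver.solve-∀
  go a -[1+ b ] with a ℕ.≤? b
  ... | yes a≤b = begin
    (a ℕ.+ 0 ∸ suc b ℕ.+ a) ℕ.+ (b ℕ.+ 1 ∸ suc a ℕ.+ b) ℕ.+ 1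
      ≡⟨ cong₂ (λ u v → (u ℕ.+ a) ℕ.+ (v ∸ suc a ℕ.+ b) ℕ.+ 1)
           (ℕ.m≤n⇒m∸n≡0 (ℕ.≤-trans (ℕ.≤-reflexive (ℕ.+-identityʳ a)) (ℕ.m≤n⇒m≤1+n a≤b))) (ℕ.+-comm b 1) ⟩
    a ℕ.+ (b ∸ a ℕ.+ b) ℕ.+ 1 ≡⟨ lemma (b ∸ a) a b ⟩
    (b ∸ a ℕ.+ a) ℕ.+ suc b ≡⟨ cong (ℕ._+ suc b) (ℕ.m∸n+n≡m a≤b) ⟩
    b ℕ.+ suc b ≡⟨ cong (λ c → b ℕ.+ suc c) (ℕ.+-identityʳ b) ⟨
    2 ℕ.* suc b ∸ 1 ≡⟨ ℕ.m≤n⇒m⊔n≡n {2 ℕ.* a} (ℕ.≤-trans (ℕ.*-monoʳ-≤ 2 a≤b) (ℕ.+-monoʳ-≤ b (ℕ.n≤1+n _))) ⟨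
    2 ℕ.* a ⊔ (2 ℕ.* suc b ∸ 1) ∎
    where
    open ≡-Reasoning
    lemma : ∀ d a b → a ℕ.+ (d ℕ.+ b) ℕ.+ 1 ≡ d ℕ.+ a ℕ.+ suc b
    lemma = ℕSolver.solve-∀
  ... | no a≰b with ℕ.m≤n⇒∃[o]m+o≡n (ℕ.≰⇒> a≰b)
  ...   | d , refl = begin
    (a ℕ.+ 0 ∸ suc b ℕ.+ a) ℕ.+ (b ℕ.+ 1 ∸ suc a ℕ.+ b) ℕ.+ 1
      ≡⟨ cong₂ (λ u v → (u ℕ.+ a) ℕ.+ (v ℕ.+ b) ℕ.+ 1)
           (trans (cong (_∸ suc b) (ℕ.+-identityʳ a)) (ℕ.m+n∸m≡n (suc b) d))
           (ℕ.m≤n⇒m∸n≡0 (ℕ.≤-trans (ℕ.≤-reflexive (ℕ.+-comm b 1)) (s≤s (ℕ.m≤n⇒m≤1+n (ℕ.m≤m+n b d))))) ⟩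
    (d ℕ.+ a) ℕ.+ b ℕ.+ 1 ≡⟨ lemma b d ⟩
    2 ℕ.* a ≡⟨ ℕ.m≥n⇒m⊔n≡m (ℕ.≤-trans (ℕ.m∸n≤m (2 ℕ.* suc b) 1) (ℕ.*-monoʳ-≤ 2 (s≤s (ℕ.m≤m+n b d)))) ⟨
    2 ℕ.* a ⊔ (2 ℕ.* suc b ∸ 1) ∎
    where
    open ≡-Reasoning
    lemma : ∀ b d → d ℕ.+ suc (b ℕ.+ d) ℕ.+ b ℕ.+ 1 ≡ 2 ℕ.* suc (b ℕ.+ d)
    lemma = ℕSolver.solve-∀

-- The double sum over all ordered pairs is regrouped into unordered pairs;
-- `before` sums, over the j with g j = 1, the number of earlier indices.
module Regroup (d : ℕ → ℕ → ℕ) (f g : ℕ → ℕ) (π : ℕ → ℕ → ℕ) where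

  before pairs : List ℕ → ℕ
  before []       = 0
  before (j ∷ js) = ∑ g js ℕ.+ before js
  pairs []       = 0
  pairs (j ∷ js) = ∑ (π j) js ℕ.+ pairs js

  regroup : ∀ a l →
    (∀ j → a ℕ.≤ j → j ℕ.< a ℕ.+ l → d j j ≡ f j) →
    (∀ i j → a ℕ.≤ i → i ℕ.< j → j ℕ.< a ℕ.+ l → d i j ℕ.+ d j i ℕ.+ g j ≡ π i j) →
    ∑ (λ i → ∑ (d i) (range a l)) (range a l) ℕ.+ before (range a l) ≡ ∑ f (range a l) ℕ.+ pairs (range a l)
  regroup a zero    diag off = refl
  regroup a (suc l) diag off = begin
    d a a ℕ.+ row ℕ.+ ∑ (λ i → d i a ℕ.+ ∑ (d i) js) js ℕ.+ (∑ g js ℕ.+ before js)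
      ≡⟨ cong₂ (λ u v → u ℕ.+ row ℕ.+ v ℕ.+ (∑ g js ℕ.+ before js)) (diag a ℕ.≤-refl (ℕ.m<m+n a (s≤s z≤n)))
          (∑-+ (λ i → d i a) (λ i → ∑ (d i) js) js) ⟩
    f a ℕ.+ row ℕ.+ (col ℕ.+ D) ℕ.+ (∑ g js ℕ.+ before js)
      ≡⟨ lemma (f a) row col D (∑ g js) (before js) ⟩
    f a ℕ.+ (row ℕ.+ col ℕ.+ ∑ g js) ℕ.+ (D ℕ.+ before js)
      ≡⟨ cong₂ (λ u v → f a ℕ.+ u ℕ.+ v) row+col (regroup (suc a) l
           (λ j a<j j< → diag j (ℕ.<⇒≤ a<j) (subst (j ℕ.<_) (sym (ℕ.+-suc a l)) j<))
           (λ i j a<i i<j j< → off i j (ℕ.<⇒≤ a<i) i<j (subst (j ℕ.<_) (sym (ℕ.+-suc a l)) j<))) ⟩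
    f a ℕ.+ ∑ (π a) js ℕ.+ (∑ f js ℕ.+ pairs js)
      ≡⟨ lemma′ (f a) (∑ (π a) js) (∑ f js) (pairs js) ⟩
    f a ℕ.+ ∑ f js ℕ.+ (∑ (π a) js ℕ.+ pairs js) ∎
    where
    open ≡-Reasoning
    js = range (suc a) l
    row = ∑ (d a) js
    col = ∑ (λ i → d i a) js
    D = ∑ (λ i → ∑ (d i) js) js
    row+col : row ℕ.+ col ℕ.+ ∑ g js ≡ ∑ (π a) js
    row+col = trans (cong (ℕ._+ ∑ g js) (sym (∑-+ (d a) (λ i → d i a) js)))
      (trans (sym (∑-+ (λ j → d a j ℕ.+ d j a) g js))
        (∑-cong (suc a) l λ j a<j j< → off a j ℕ.≤-refl a<j (subst (j ℕ.<_) (sym (ℕ.+-suc a l)) j<)))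
    lemma : ∀ x r c D g b → x ℕ.+ r ℕ.+ (c ℕ.+ D) ℕ.+ (g ℕ.+ b) ≡ x ℕ.+ (r ℕ.+ c ℕ.+ g) ℕ.+ (D ℕ.+ b)
    lemma = ℕSolver.solve-∀
    lemma′ : ∀ x p s q → x ℕ.+ p ℕ.+ (s ℕ.+ q) ≡ x ℕ.+ s ℕ.+ (p ℕ.+ q)
    lemma′ = ℕSolver.solve-∀

  -- A position exceeds the number of earlier positions in the range by `a`.
  positions : ∀ a l → ∑ (λ j → g j ℕ.* j) (range a l) ≡ before (range a l) ℕ.+ a ℕ.* ∑ g (range a l)
  positions a zero    = sym (ℕ.*-zeroʳ a)
  positions a (suc l) = trans (cong (g a ℕ.* a ℕ.+_) (positions (suc a) l))
    (lemma a (g a) (before (range (suc a) l)) (∑ g (range (suc a) l)))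
    where
    lemma : ∀ a x b s → x ℕ.* a ℕ.+ (b ℕ.+ suc a ℕ.* s) ≡ s ℕ.+ b ℕ.+ a ℕ.* (x ℕ.+ s)
    lemma = ℕSolver.solve-∀

module _ (e₀ eₙ : ℕ) (q : ℕ → ℤ) where
  open Length e₀ eₙ

  private
    module R = Regroup (λ _ _ → 0) (λ _ → 0) (λ _ → 0) (λ i j → pair (q i) (q j))

  cosetLength-∑ : ∀ js → cosetLength (map q js) ≡
    e₀ ℕ.* (∑ (fold ∘ q) js ℕ.+ ∑ (negative ∘ q) js) ℕ.+ eₙ ℕ.* ∑ (fold ∘ q) js ℕ.+ R.pairs js
  cosetLength-∑ []       = sym (cong₂ (λ u v → u ℕ.+ v ℕ.+ 0) (ℕ.*-zeroʳ e₀) (ℕ.*-zeroʳ eₙ))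
  cosetLength-∑ (j ∷ js) = trans (cong₂ (λ u v → e₀ ℕ.* u ℕ.+ eₙ ℕ.* fold (q j) ℕ.+ v ℕ.+ cosetLength
      (map q js)) (abs (q j)) (cross-∑ (q j) js))
    (trans (cong (λ u → e₀ ℕ.* (fold (q j) ℕ.+ negative (q j)) ℕ.+ eₙ ℕ.* fold (q j) ℕ.+ ∑
        (λ k → pair (q j) (q k)) js ℕ.+ u) (cosetLength-∑ js))
      (lemma e₀ eₙ (fold (q j)) (negative (q j)) (∑ (fold ∘ q) js) (∑ (negative ∘ q) js)
          (∑ (λ k → pair (q j) (q k)) js) (R.pairs js)))
    where
    abs : ∀ z → ∣ z ∣ ≡ fold z ℕ.+ negative z
    abs (+ z)    = sym (ℕ.+-identityʳ z)
    abs -[1+ z ] = ℕ.+-comm 1 z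
    cross-∑ : ∀ x js → cross x (map q js) ≡ ∑ (λ k → pair x (q k)) js
    cross-∑ x []       = refl
    cross-∑ x (k ∷ js) = cong (pair x (q k) ℕ.+_) (cross-∑ x js)
    lemma : ∀ e₀ eₙ m s M S p P → e₀ ℕ.* (m ℕ.+ s) ℕ.+ eₙ ℕ.* m ℕ.+ p ℕ.+
        (e₀ ℕ.* (M ℕ.+ S) ℕ.+ eₙ ℕ.* M ℕ.+ P) ≡
      e₀ ℕ.* (m ℕ.+ M ℕ.+ (s ℕ.+ S)) ℕ.+ eₙ ℕ.* (m ℕ.+ M) ℕ.+ (p ℕ.+ P)
    lemma = ℕSolver.solve-∀

-- Assembling the length formula

mirrored-inverse : ∀ {n} (W : MirroredPermutation n) → ∃[ p ] Inverses n (perm W) p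
mirrored-inverse {n} W = p , record
  { w-mirrored = w-mirrored′ ; p-mirrored = p-mirrored′ ; w∘p = w∘p′ ; p∘w = λ i → injective
      (w∘p′ (perm W i)) }
  where
  injective : ∀ {i j} → perm W i ≡ perm W j → i ≡ j
  injective = proj₁ (bijective W)
  p : ℤ → ℤ
  p i = proj₁ (proj₂ (bijective W) i)
  w∘p′ : ∀ i → perm W (p i) ≡ i
  w∘p′ i = proj₂ (proj₂ (bijective W) i) refl
  w-mirrored′ : Mirrored n (perm W)
  w-mirrored′ = record { shifted = shift W ; odd = mirror W }
  p-mirrored′ : Mirrored n p
  p-mirrored′ .shifted i = injective (trans (w∘p′ (i + N n))
      (sym (trans (shift W (p i)) (cong (_+ N n) (w∘p′ i)))))
  p-mirrored′ .odd     i = injective (trans (w∘p′ (- i)) (sym (trans (mirror W (p i)) (cong -_ (w∘p′ i)))))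

-- The absolute values of the two offsets are i < k, so the sign of the second offset alone decides
-- the comparison.
δ-ρ : ∀ x y {i k} → i ℕ.< k →
      δ (ρOf x i) (ρOf y k) ≡ negative y × δ (ρOf y k) (ρOf x i) ≡ 1 ∸ negative y
δ-ρ x (+ _) {i} {k} i<k = δ-≥ (ℤ.<⇒≤ -k<) , δ-< -k<
  where
  go : ∀ x → - + k < ρOf x i
  go (+ _)    = ℤ.neg-mono-< (+<+ i<k)
  go -[1+ _ ] = ℤ.<-≤-trans (ℤ.neg-mono-< (+<+ (ℕ.≤-trans (s≤s z≤n) i<k))) (+≤+ {0} {i} z≤n)
  -k< = go x
δ-ρ x -[1+ _ ] {i} {k} i<k = δ-< <k , δ-≥ (ℤ.<⇒≤ <k)
  where
  go : ∀ x → ρOf x i < + k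
  go (+ _)    = ℤ.≤-<-trans (ℤ.neg-≤-pos {i} {0}) (+<+ (ℕ.≤-trans (s≤s z≤n) i<k))
  go -[1+ _ ] = +<+ i<k
  <k = go x

module _ (t : Type) (n : ℕ) (q : ℕ → ℤ) where

  private
    m sg : ℕ → ℕ
    m k  = fold (q k)
    sg k = negative (q k)
    ρ : ℕ → ℤ
    ρ k = ρOf (q k) k
    js = range 1 n
    π : ℕ → ℕ → ℕ
    π i k = pair (q i) (q k)

  open Regroup (gapCount ρ m) m sg π

  -- The runner of B(j) has only beads between b(j) and B(j), so the gaps of class j all lie on the
  -- opposite runner.
  gapCount-diag : ∀ j → gapCount ρ m j j ≡ m j
  gapCount-diag j = cong (ℕ._+ m j) (trans (pos-⊖ (m j ℕ.+ δ (ρ j) (ρ j)) (suc (m j)))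
    (ℕ.m≤n⇒m∸n≡0 (ℕ.≤-trans (ℕ.≤-reflexive (trans (cong (m j ℕ.+_) (δ-≥ ℤ.≤-refl)) (ℕ.+-identityʳ (m j))))
        (ℕ.n≤1+n (m j)))))

  gapCount-pair : ∀ i j → i ℕ.< j → gapCount ρ m i j ℕ.+ gapCount ρ m j i ℕ.+ sg j ≡ π i j
  gapCount-pair i j i<j = trans (cong₂ (λ u v → u ℕ.+ m i ℕ.+ (v ℕ.+ m j) ℕ.+ sg j)
      (trans (pos-⊖ (m i ℕ.+ δ (ρ j) (ρ i)) (suc (m j)))
          (cong (λ d → m i ℕ.+ d ∸ suc (m j)) (proj₂ (δ-ρ (q i) (q j) i<j))))
      (trans (pos-⊖ (m j ℕ.+ δ (ρ i) (ρ j)) (suc (m i)))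
          (cong (λ d → m j ℕ.+ d ∸ suc (m i)) (proj₁ (δ-ρ (q i) (q j) i<j)))))
    (fold-pair (q i) (q j))

  pairs-indep : ∀ ks → pairs ks ≡ Regroup.pairs (λ _ _ → 0) (λ _ → 0) (λ _ → 0) π ks
  pairs-indep []       = refl
  pairs-indep (k ∷ ks) = cong (∑ (π k) ks ℕ.+_) (pairs-indep ks)

  weighted-sum : ∀ c ks → Σℤ (map (λ k → + sg k * (+ k + c)) ks) ≡ + ∑ (λ k → sg k ℕ.* k) ks + c * + ∑ sg ks
  weighted-sum c []       = sym (trans (ℤ.+-identityˡ _) (ℤ.*-zeroʳ c))
  weighted-sum c (k ∷ ks) = trans (cong (λ z → + sg k * (+ k + c) + z) (weighted-sum c ks))
    (trans (lemma (+ sg k) (+ k) c (+ ∑ (λ k → sg k ℕ.* k) ks) (+ ∑ sg ks))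
      (cong (λ z → z + + ∑ (λ k → sg k ℕ.* k) ks + c * (+ sg k + + ∑ sg ks)) (sym (ℤ.pos-* (sg k) k))))
    where
    lemma : ∀ s k c A S → s * (k + c) + (A + c * S) ≡ s * k + A + c * (s + S)
    lemma = solve-∀

  -- The summand k + x₀ of each q k < 0 splits into k - 1, which the pairs absorb, and 1 + x₀, which
  -- completes (1 + x₀) m k to (1 + x₀) |q k|. The diagonal gaps supply the copy of Σ m by which the
  -- sum of 1 + x₀ and 1 + xₙ exceeds 1 + x₀ + xₙ.
  coset-length-formula :
    + ∑ (λ i → ∑ (gapCount ρ m i) js) js + (1ℤ + x₀ t + xₙ t) * + ∑ (λ k → m k ℕ.+ 0) js
      + Σℤ (map (λ k → + sg k * (+ k + x₀ t)) js)
    ≡ + Length.cosetLength (e₀ t) (eₙ t) (map q js)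
  coset-length-formula = begin
    + D + (1ℤ + x₀ t + xₙ t) * + ∑ (λ k → m k ℕ.+ 0) js + Σℤ (map (λ k → + sg k * (+ k + x₀ t)) js)
      ≡⟨ cong₂ (λ u v → + D + (1ℤ + x₀ t + xₙ t) * + u + v)
           (∑-cong 1 n λ j _ _ → ℕ.+-identityʳ (m j))
           (trans (weighted-sum (x₀ t) js) (cong (λ u → + u + x₀ t * + S)
               (trans (positions 1 n) (cong (Bf ℕ.+_) (ℕ.*-identityˡ S))))) ⟩
    + D + (1ℤ + x₀ t + xₙ t) * + Mm + (+ Bf + + S + x₀ t * + S)
      ≡⟨ lemma (+ D) (+ Bf) (x₀ t) (xₙ t) (+ Mm) (+ S) ⟩
    + D + + Bf + ((1ℤ + x₀ t + xₙ t) * + Mm + + S + x₀ t * + S)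
      ≡⟨ cong (λ u → + u + ((1ℤ + x₀ t + xₙ t) * + Mm + + S + x₀ t * + S))
           (regroup 1 n (λ j _ _ → gapCount-diag j) (λ i j _ i<j _ → gapCount-pair i j i<j)) ⟩
    + Mm + + P + ((1ℤ + x₀ t + xₙ t) * + Mm + + S + x₀ t * + S)
      ≡⟨ lemma′ (+ P) (x₀ t) (xₙ t) (+ Mm) (+ S) ⟩
    (1ℤ + x₀ t) * (+ Mm + + S) + (1ℤ + xₙ t) * + Mm + + P
      ≡⟨ cong₂ (λ u v → u * (+ Mm + + S) + v * + Mm + + P) (e₀≡ t) (eₙ≡ t) ⟨
    + e₀ t * + (Mm ℕ.+ S) + + eₙ t * + Mm + + P
      ≡⟨ cong₂ (λ u v → u + v + + P) (ℤ.pos-* (e₀ t) (Mm ℕ.+ S)) (ℤ.pos-* (eₙ t) Mm) ⟨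
    + (e₀ t ℕ.* (Mm ℕ.+ S) ℕ.+ eₙ t ℕ.* Mm ℕ.+ P)
      ≡⟨ cong +_ (trans (cosetLength-∑ (e₀ t) (eₙ t) q js)
          (cong (e₀ t ℕ.* (Mm ℕ.+ S) ℕ.+ eₙ t ℕ.* Mm ℕ.+_) (sym (pairs-indep js)))) ⟨
    + Length.cosetLength (e₀ t) (eₙ t) (map q js) ∎
    where
    open ≡-Reasoning
    D = ∑ (λ i → ∑ (gapCount ρ m i) js) js
    Bf = before js
    Mm = ∑ m js
    S = ∑ sg js
    P = pairs js
    e₀≡ : ∀ t → + e₀ t ≡ 1ℤ + x₀ t
    e₀≡ C̃/C = refl
    e₀≡ B̃/B = refl
    e₀≡ B̃/D = refl
    e₀≡ D̃/D = refl
    eₙ≡ : ∀ t → + eₙ t ≡ 1ℤ + xₙ t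
    eₙ≡ C̃/C = refl
    eₙ≡ B̃/B = refl
    eₙ≡ B̃/D = refl
    eₙ≡ D̃/D = refl
    lemma : ∀ d b x y m s → d + (1ℤ + x + y) * m + (b + s + x * s) ≡ d + b + ((1ℤ + x + y) * m + s + x * s)
    lemma = solve-∀
    lemma′ : ∀ p x y m s → m + p + ((1ℤ + x + y) * m + s + x * s) ≡ (1ℤ + x) * (m + s) + (1ℤ + y) * m + p
    lemma′ = solve-∀

Σℤ-tabulate : ∀ n a (f : Fin n → ℤ) (g : ℕ → ℕ) → (∀ i → f i ≡ + g (a ℕ.+ toℕ i)) →
              Σℤ (tabulate f) ≡ + ∑ g (range a n)
Σℤ-tabulate zero    a f g e = refl
Σℤ-tabulate (suc n) a f g e = cong₂ _+_ (trans (e Fin.zero) (cong (λ j → + g j) (ℕ.+-identityʳ a)))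
  (Σℤ-tabulate n (suc a) (f ∘ Fin.suc) g λ i → trans (e (Fin.suc i)) (cong (λ j → + g j) (ℕ.+-suc a (toℕ i))))

module _ (t : Type) (n : ℕ) {p : ℤ → ℤ} (W : MirroredPermutation n) (inv : Inverses n (perm W) p)
  (a : Abacus n) (isA : IsAbacusOf W a)
  (B b : Fin n → ℤ) (B-is : ∀ i → IsB a i (B i)) (b-is : ∀ i → Isb a (B i) (b i)) where

  open AbacusOf n W inv a isA using (ρ; m; bead⁺; bead⁻)

  private
    q = quotient n p
    sg : ℕ → ℕ
    sg k = negative (q k)

  ±ρ : ∀ k → (ρ k ≡ + k × sg k ≡ 1) ⊎ (ρ k ≡ - + k × sg k ≡ 0)
  ±ρ k = go (q k)
    where
    go : ∀ z → (ρOf z k ≡ + k × negative z ≡ 1) ⊎ (ρOf z k ≡ - + k × negative z ≡ 0)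
    go (+ _)    = inj₂ (refl , refl)
    go -[1+ _ ] = inj₁ (refl , refl)

  open Beads n a ρ m sg ±ρ bead⁺ bead⁻

  gaps-count : ∀ i {xs} → Enumerates xs (λ e → Gap a e × Between (B i) (b i) e) →
    length xs ≡ ∑ (gapCount ρ m (suc (toℕ i))) (range 1 n)
  gaps-count i {xs} exs = gaps-length k (s≤s z≤n) k≤n
    (subst₂ (λ x y → Enumerates xs (λ e → Gap a e × Between x y e)) B-eq b-eq exs)
    where
    k = suc (toℕ i)
    k≤n : k ℕ.≤ n
    k≤n = Fin.toℕ<n i
    B-eq : B i ≡ B-level k
    B-eq = B≡ k (s≤s z≤n) k≤n (B i) (B-is i)
    b-eq : b i ≡ b-level k
    b-eq = b≡ k k≤n (b i) (subst (λ x → Isb a x (b i)) B-eq (b-is i))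

  abacus-formula :
    (gaps : Fin n → List ℤ) → (∀ i → Enumerates (gaps i) (λ e → Gap a e × Between (B i) (b i) e)) →
    (high : List ℤ) → Enumerates high (λ e → Bead a e × N n + + n < e) →
    (mid : List ℤ) → Enumerates mid (λ e → Bead a e × N n + 1ℤ ≤ e × e ≤ N n + + n) →
    + ℓ n t p ≡ Σℤ (tabulate (λ i → + length (gaps i))) + (1ℤ + x₀ t + xₙ t) * + length high
                + Σℤ (map (λ e → e - N n + x₀ t) mid)
  abacus-formula gaps gaps! high high! mid mid! = sym (trans
    (cong₂ _+_ (cong₂ (λ u v → u + (1ℤ + x₀ t + xₙ t) * + v)
        (Σℤ-tabulate n 1 _ (λ i → ∑ (gapCount ρ m i) (range 1 n)) λ i → cong +_ (gaps-count i (gaps! i)))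
        (high-length high!))
      (mid-sum (x₀ t) mid!))
    (coset-length-formula t n q))

corollary8p1 : (t : Type) (n : ℕ) → minRank t ℕ.≤ n →
    (w : MirroredPermutation n) → IsMinimalRepresentative t w →
    (a : Abacus n) → IsAbacusOf w a →
    (B b : Fin n → ℤ) →
    (∀ i → IsB a i (B i)) →
    (∀ i → Isb a (B i) (b i)) →
    (gaps : Fin n → List ℤ) →
    (∀ i → Enumerates (gaps i) (λ e → Gap a e × Between (B i) (b i) e)) →
    (high : List ℤ) →
    Enumerates high (λ e → Bead a e × N n + + n < e) →
    (mid : List ℤ) →
    Enumerates mid (λ e → Bead a e × N n + 1ℤ ≤ e × e ≤ N n + + n) →
    ∃[ l ] HasLength t n (perm w) l ×
    + l ≡ Σℤ (tabulate (λ i → + length (gaps i)))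
    + (1ℤ + x₀ t + xₙ t) * + length high
    + Σℤ (map (λ e → e - N n + x₀ t) mid)
corollary8p1 t n minRank≤n w isMin a isA B b B-is b-is gaps gaps! high high! mid mid! =
  ℓ n t p ,
  minimal-length t n minRank≤n inv (floor-parity n inv t w refl inW̃) (round-parity n inv t w refl inW̃)
      minimal ,
  abacus-formula t n w inv a isA B b B-is b-is gaps gaps! high high! mid mid!
  where
  open IsMinimalRepresentative isMin
  p : ℤ → ℤ
  p = proj₁ (mirrored-inverse w)
  inv : Inverses n (perm w) p
  inv = proj₂ (mirrored-inverse w)
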